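{- Let $S_8=\{(1,-4,-3,4),(3,-3,-1,3)\}$. If $(t_1,t_2,t_3,t_4)\in S_8$, then for all integers $n\geq 0$, $$a_{1^{t_1}2^{t_2}3^{t_3}4^{t_4}}(2n)>0,\qquad a_{1^{t_1}2^{t_2}3^{t_3}4^{t_4}}(6n+1)<0,$$ $$a_{1^{t_1}2^{t_2}3^{t_3}4^{t_4}}(6n+3)<0,\qquad a_{1^{t_1}2^{t_2}3^{t_3}4^{t_4}}(6n+5)=0.$$
   Context: For $|q|<1$ (or as formal power series in $q$) let $f_j:=(q^j;q^j)_\infty=\prod_{k\ge 1}(1-q^{jk})$ for each positive integer $j$. For a positive integer $m$ and integers $t_1,\dots,t_m$ (possibly zero or negative), the integers $a_{1^{t_1}2^{t_2}\cdots m^{t_m}}(n)$, $n\ge 0$, are defined by $\sum_{n=0}^\infty a_{1^{t_1}2^{t_2}\cdots m^{t_m}}(n)q^n=f_1^{t_1}f_2^{t_2}\cdots f_m^{t_m}$. -}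

module Defs where

open import Data.Bool using (if_then_else_)
open import Data.Fin using (Fin; zero; suc; toℕ)
open import Data.Integer using (ℤ; +_; -[1+_]; 0ℤ; 1ℤ; -_; _+_; _-_; _*_)
import Data.Integer.Properties as ℤₚ
open import Data.List using (List; []; _∷_)
open import Data.Nat as ℕ using (ℕ; zero; suc; _∸_; NonZero)
import Data.Nat.Properties as ℕₚ
open import Data.Vec using (Vec; []; _∷_; head; lookup)
open import Relation.Binary.PropositionalEquality
open import Relation.Nullary using (yes; no; contradiction)
open import Relation.Nullary.Decidable using (⌊_⌋)

open import Algebra.Properties.Semiring.Sum ℤₚ.+-*-semiring
  using (sum; sum-cong-≗) public

-- Formal power series in q over ℤ, as coefficient functions.
Series : Set
Series = ℕ → ℤ

q^_ : ℕ → Series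
(q^ m) n = if ⌊ n ℕ.≟ m ⌋ then 1ℤ else 0ℤ

𝟙 : Series
𝟙 = q^ 0

infixl 6 _⊖_
infixl 7 _⊛_
infixr 8 _^ℕ_ _^ℤ_

_⊖_ : Series → Series → Series
(a ⊖ b) n = a n - b n

-- Cauchy product.
_⊛_ : Series → Series → Series
(a ⊛ b) n = sum {suc n} (λ i → a (toℕ i) * b (n ∸ toℕ i))

_^ℕ_ : Series → ℕ → Series
a ^ℕ zero  = 𝟙
a ^ℕ suc k = a ⊛ a ^ℕ k

-- For a series a with constant term 1, the first n + 1 coefficients
-- bₙ, …, b₀ (highest first) of its multiplicative inverse b, from b₀ = 1 and
-- bₙ₊₁ = - (a₁ bₙ + a₂ bₙ₋₁ + ⋯ + aₙ₊₁ b₀).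
invCoeffs : Series → (n : ℕ) → Vec ℤ (suc n)
invCoeffs a zero    = 1ℤ ∷ []
invCoeffs a (suc n) =
  - sum (λ i → a (suc (toℕ i)) * lookup (invCoeffs a n) i) ∷ invCoeffs a n

-- Meaningful only for series with constant term 1; see ⊛-inv.
inv : Series → Series
inv a n = head (invCoeffs a n)

_^ℤ_ : Series → ℤ → Series
a ^ℤ (+ k)    = a ^ℕ k
a ^ℤ -[1+ k ] = inv a ^ℕ suc k

-- ∏_{k=1}^{N} (1 - q^{jk})
partialProduct : ℕ → ℕ → Series
partialProduct j zero    = 𝟙
partialProduct j (suc N) = partialProduct j N ⊛ (𝟙 ⊖ q^ (j ℕ.* suc N))

-- f_j = ∏_{k≥1} (1 - q^{jk}).  As j ≥ 1, the factors with k > n do not affect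
-- the coefficient of q^n, so it can be read off the product of the first n
-- factors; see f-limit.
f : (j : ℕ) → .{{NonZero j}} → Series
f j n = partialProduct j n n

-- f_s^{t₁} f_{s+1}^{t₂} ⋯ f_{s+m-1}^{tₘ}
fProductFrom : (s : ℕ) → .{{NonZero s}} → ∀ {m} → Vec ℤ m → Series
fProductFrom s []       = 𝟙
fProductFrom s (t ∷ ts) = f s ^ℤ t ⊛ fProductFrom (suc s) ts

-- a (t₁ ∷ ⋯ ∷ tₘ ∷ []) n is the coefficient of q^n in f_1^{t₁} ⋯ f_m^{tₘ}.
a : ∀ {m} → Vec ℤ m → ℕ → ℤ
a = fProductFrom 1

S₈ : List (Vec ℤ 4)
S₈ = (+ 1 ∷ - + 4 ∷ - + 3 ∷ + 4 ∷ [])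
   ∷ (+ 3 ∷ - + 3 ∷ - + 1 ∷ + 3 ∷ [])
   ∷ []

-- The remaining lemmas justify the definitions of inv and f.

lookup-invCoeffs : ∀ b n (i : Fin (suc n)) →
                   lookup (invCoeffs b n) i ≡ inv b (n ∸ toℕ i)
lookup-invCoeffs b zero    zero    = refl
lookup-invCoeffs b (suc n) zero    = refl
lookup-invCoeffs b (suc n) (suc i) = lookup-invCoeffs b n i

⊛-inv : ∀ b → b 0 ≡ 1ℤ → ∀ n → (b ⊛ inv b) n ≡ 𝟙 n
⊛-inv b b₀≡1 zero    = trans (ℤₚ.+-identityʳ _) (trans (ℤₚ.*-identityʳ _) b₀≡1)
⊛-inv b b₀≡1 (suc n) = begin
  b 0 * - S + S′  ≡⟨ cong (λ c → c * - S + S′) b₀≡1 ⟩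
  1ℤ * - S + S′   ≡⟨ cong₂ _+_ (ℤₚ.*-identityˡ (- S)) (sym S≡S′) ⟩
  - S + S         ≡⟨ ℤₚ.+-inverseˡ S ⟩
  0ℤ              ∎
  where
  open ≡-Reasoning
  S S′ : ℤ
  S  = sum {suc n} (λ i → b (suc (toℕ i)) * lookup (invCoeffs b n) i)
  S′ = sum {suc n} (λ i → b (suc (toℕ i)) * inv b (n ∸ toℕ i))
  S≡S′ : S ≡ S′
  S≡S′ = sum-cong-≗ {suc n} λ i → cong (b (suc (toℕ i)) *_) (lookup-invCoeffs b n i)

f-constant : ∀ j .{{_ : NonZero j}} → f j 0 ≡ 1ℤ
f-constant j = refl

⊛-identityʳ : ∀ b n → (b ⊛ 𝟙) n ≡ b n
⊛-identityʳ b zero    = trans (ℤₚ.+-identityʳ _) (ℤₚ.*-identityʳ _)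
⊛-identityʳ b (suc n) = begin
  b 0 * 0ℤ + rest  ≡⟨ cong (_+ rest) (ℤₚ.*-zeroʳ (b 0)) ⟩
  0ℤ + rest        ≡⟨ ℤₚ.+-identityˡ rest ⟩
  rest             ≡⟨ ⊛-identityʳ (λ k → b (suc k)) n ⟩
  b (suc n)        ∎
  where
  open ≡-Reasoning
  rest : ℤ
  rest = ((λ k → b (suc k)) ⊛ 𝟙) n

⊛-1-q^ : ∀ b {m n} → n ℕ.< m → (b ⊛ (𝟙 ⊖ q^ m)) n ≡ b n
⊛-1-q^ b {m} {n} n<m = trans
  (sum-cong-≗ {suc n} λ i → cong (b (toℕ i) *_)
    (low (n ∸ toℕ i) (ℕₚ.≤-<-trans (ℕₚ.m∸n≤m n (toℕ i)) n<m)))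
  (⊛-identityʳ b n)
  where
  low : ∀ k → k ℕ.< m → (𝟙 ⊖ q^ m) k ≡ 𝟙 k
  low k k<m with k ℕ.≟ m
  ... | yes k≡m = contradiction k≡m (ℕₚ.<⇒≢ k<m)
  ... | no  _   = ℤₚ.+-identityʳ (𝟙 k)

f-limit : ∀ j .{{_ : NonZero j}} n d → partialProduct j (d ℕ.+ n) n ≡ f j n
f-limit j n zero    = refl
f-limit j n (suc d) = trans
  (⊛-1-q^ (partialProduct j (d ℕ.+ n))
    (ℕₚ.<-≤-trans (ℕ.s≤s (ℕₚ.m≤n+m n d)) (ℕₚ.m≤n*m (suc (d ℕ.+ n)) j)))
  (f-limit j n d)

{-# OPTIONS --safe #-}

-- Put ψ = f₂²/f₁, φ = f₂⁵/(f₁²f₄²), F = f₂f₃²/(f₁f₆), G = f₂²f₃f₁₂/(f₁f₄f₆) and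
-- C = f₃³/f₁.  By the Jacobi triple product ψ, φ, F, G are theta series, and
-- sorting lattice points by residue classes modulo 2, 3 and 4 yields
--   ψ(q³) F(q)² = ψ(q) Σ q^(3(m²+mn+n²)+m+2n),  so that this sum equals C(q),
--   C(q)      = ψ(q²) F(q²) +   q C(q⁴),
--   φ(q) G(q) = ψ(q²) F(q²) + 3 q C(q⁴).
-- Replacing q by -q turns the two eta quotients of the theorem into
-- C · f₄³f₁₂³/(f₂f₆⁹) and φ G · f₄³/(f₂f₆²).  Hence their coefficients of q^(2n)
-- are those of ψ³ h(q³), and those of q^(2n+1) are those of -c ψ g(q³), where
-- c is 1 or 3 and h, g are products of powers of ψ, 1/f₁ and 1/f₂.  Since ψ is
-- supported on triangular numbers, which are 0 or 1 modulo 3, the signs follow.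
module Submission where

open import Defs
open import Algebra.Bundles using (CommutativeRing)
import Algebra.Properties.AbelianGroup
import Algebra.Properties.Semiring.Sum
import Algebra.Solver.Ring
open import Algebra.Solver.Ring.AlmostCommutativeRing using (fromCommutativeRing; _-Raw-AlmostCommutative⟶_)
open import Algebra.Structures using (IsCommutativeRing)
open import Data.Empty using (⊥)
open import Data.Fin using (Fin; zero; suc; toℕ; fromℕ<)
import Data.Fin.Permutation as Permutation
import Data.Fin.Properties as Finₚ
open import Data.Integer as ℤ using (ℤ; +_; -[1+_]; 0ℤ; 1ℤ; _<_; _>_)
import Data.Integer.DivMod as ℤDivMod
import Data.Integer.Properties as ℤₚ
import Data.Integer.Tactic.RingSolver as ℤSolver
open import Data.List using (List; []; _∷_; _++_)
open import Data.List.Membership.Propositional using (_∈_)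
open import Data.List.Relation.Unary.All as All using (All)
open import Data.List.Relation.Unary.Any using (here; there)
open import Data.Maybe using (Maybe; just; nothing)
open import Data.Nat as ℕ using (ℕ; zero; suc; _+_; _*_; _∸_; NonZero; z≤n; s≤s)
open import Data.Nat.Divisibility using (_∣_; _∣?_; divides; quotient; ∣⇒≤)
open import Data.Nat.DivMod using (_%_; _/_; m*n%n≡0; m≡m%n+[m/n]*n; m%n<n)
open import Data.Nat.Induction using (<-rec)
import Data.Nat.Properties as ℕₚ
import Data.Nat.Tactic.RingSolver as ℕSolver
open import Data.Product using (_×_; _,_; proj₁; proj₂; Σ-syntax; ∃)
open import Data.Product.Function.Dependent.Propositional using (Σ-↔)
open import Data.Product.Function.NonDependent.Propositional using (_×-↔_)
open import Data.Sum using (_⊎_; inj₁; inj₂; [_,_])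
open import Data.Sum.Function.Propositional using (_⊎-↔_)
open import Data.Unit using (⊤; tt)
open import Function using (_∘_)
open import Function.Bundles using (_↔_; mk↔ₛ′; Inverse)
open import Function.Construct.Composition using (_↔-∘_)
open import Function.Construct.Identity using (↔-id)
open import Function.Construct.Symmetry using (↔-sym)
open import Level using (0ℓ)
open import Relation.Binary.Definitions using (tri<; tri≈; tri>)
open import Relation.Binary.PropositionalEquality hiding (setoid; [_])
open import Relation.Nullary using (Dec; yes; no; contradiction; ¬_)

-- The dissection of C(q) comes from an auxiliary lattice sum, that of m²+mn+n²+m+n, counted in two
-- ways. A rotation of order three shows that it equals 3C(q). Sorting by the parity of m gives
-- 2ψ(q²)F(q²) + φ(q)G(q). The same form reappears, at q⁴, in the odd part of φG, and this closes
-- the relation for C on itself; division by 3 is harmless over ℤ. The obstacle is that theta series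
-- are sums over ℤ or ℤ², while a series here is a coefficient function on ℕ. A coefficient is
-- therefore tied to the number of indices with the given exponent, and an identity between lattice
-- sums becomes an affine bijection of index sets together with an equality of exponents. These
-- involve halves such as j(j+1)/2, so they are doubled and compared as polynomials over ℤ. Limits
-- enter only through infinite products and the passage from the finite to the infinite triple
-- product, where congruence modulo q^N takes the place of convergence.

module Sumℤ = Algebra.Properties.Semiring.Sum ℤₚ.+-*-semiring
module ℤGroup = Algebra.Properties.AbelianGroup ℤₚ.+-0-abelianGroup

-- The commutative ring of formal power series

infix 4 _≈_

-- A record rather than a bare family of equations, so that both series can be recovered from the
-- type of a proof.
record _≈_ (x y : Series) : Set where
  constructor mk≈
  field coeff : ∀ n → x n ≡ y n
open _≈_ public

infixl 6 _⊕_

𝟘 : Series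
𝟘 n = 0ℤ

_⊕_ : Series → Series → Series
(x ⊕ y) n = x n ℤ.+ y n

⊝_ : Series → Series
(⊝ x) n = ℤ.- x n

tail : Series → Series
tail x n = x (suc n)

≈-refl : ∀ {x} → x ≈ x
≈-refl = mk≈ λ n → refl

≈-sym : ∀ {x y} → x ≈ y → y ≈ x
≈-sym p = mk≈ λ n → sym (coeff p n)

≈-trans : ∀ {x y z} → x ≈ y → y ≈ z → x ≈ z
≈-trans p q = mk≈ λ n → trans (coeff p n) (coeff q n)

⊛-local : ∀ {x x′ y y′} n → (∀ i → i ℕ.≤ n → x i ≡ x′ i) → (∀ i → i ℕ.≤ n → y i ≡ y′ i) →
          (x ⊛ y) n ≡ (x′ ⊛ y′) n
⊛-local n p q = sum-cong-≗ {suc n} λ i →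
  cong₂ ℤ._*_ (p (toℕ i) (Finₚ.toℕ≤pred[n] i)) (q (n ∸ toℕ i) (ℕₚ.m∸n≤m n (toℕ i)))

⊛-cong : ∀ {x x′ y y′} → x ≈ x′ → y ≈ y′ → x ⊛ y ≈ x′ ⊛ y′
⊛-cong p q = mk≈ λ n → ⊛-local n (λ i _ → coeff p i) (λ i _ → coeff q i)

⊛-distribʳ : ∀ z x y → (x ⊕ y) ⊛ z ≈ x ⊛ z ⊕ y ⊛ z
⊛-distribʳ z x y = mk≈ λ n → trans
  (sum-cong-≗ {suc n} λ i → ℤₚ.*-distribʳ-+ (z (n ∸ toℕ i)) (x (toℕ i)) (y (toℕ i)))
  (Sumℤ.∑-distrib-+ {suc n} (λ i → x (toℕ i) ℤ.* z (n ∸ toℕ i)) (λ i → y (toℕ i) ℤ.* z (n ∸ toℕ i)))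

scale-⊛ : ∀ c x y → (λ n → c ℤ.* x n) ⊛ y ≈ λ n → c ℤ.* (x ⊛ y) n
scale-⊛ c x y = mk≈ λ n → trans
  (sum-cong-≗ {suc n} λ i → ℤₚ.*-assoc c (x (toℕ i)) (y (n ∸ toℕ i)))
  (sym (Sumℤ.*-distribˡ-sum {suc n} c (λ i → x (toℕ i) ℤ.* y (n ∸ toℕ i))))

-- Splitting off the first summand shows, by computation, that the tail of `x ⊛ y` is `x 0` times
-- `tail y` plus `tail x ⊛ y`. Induction on `n` with this recursion replaces the exchange of a
-- double sum.
⊛-assoc-coeff : ∀ n x y z → ((x ⊛ y) ⊛ z) n ≡ (x ⊛ (y ⊛ z)) n
⊛-assoc-coeff zero x y z = (λ (a b c : ℤ) → identity a b c) (x 0) (y 0) (z 0)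
  where
  identity : ∀ a b c → (a ℤ.* b ℤ.+ 0ℤ) ℤ.* c ℤ.+ 0ℤ ≡ a ℤ.* (b ℤ.* c ℤ.+ 0ℤ) ℤ.+ 0ℤ
  identity = ℤSolver.solve-∀
⊛-assoc-coeff (suc n) x y z = begin
  (x ⊛ y) 0 ℤ.* z (suc n) ℤ.+ (((λ n → x 0 ℤ.* tail y n) ⊕ tail x ⊛ y) ⊛ z) n
    ≡⟨ cong (ℤ._+_ ((x ⊛ y) 0 ℤ.* z (suc n))) (trans
         (coeff (⊛-distribʳ z ((λ n → x 0 ℤ.* tail y n)) (tail x ⊛ y)) n)
         (cong₂ ℤ._+_ (coeff (scale-⊛ (x 0) (tail y) z) n) (⊛-assoc-coeff n (tail x) y z))) ⟩
  (x ⊛ y) 0 ℤ.* z (suc n) ℤ.+ (x 0 ℤ.* (tail y ⊛ z) n ℤ.+ (tail x ⊛ (y ⊛ z)) n)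
    ≡⟨ identity (x 0) (y 0) (z (suc n)) _ _ ⟩
  x 0 ℤ.* (y 0 ℤ.* z (suc n) ℤ.+ (tail y ⊛ z) n) ℤ.+ (tail x ⊛ (y ⊛ z)) n ∎
  where
  open ≡-Reasoning
  identity : ∀ a b c d e → (a ℤ.* b ℤ.+ 0ℤ) ℤ.* c ℤ.+ (a ℤ.* d ℤ.+ e) ≡ a ℤ.* (b ℤ.* c ℤ.+ d) ℤ.+ e
  identity = ℤSolver.solve-∀

-- The mirror image of the recursion built into `⊛`: here the last summand is split off.
-- Commutativity follows by playing the two recursions against each other.
⊛-suc-right : ∀ n x y → (x ⊛ y) (suc n) ≡ (x ⊛ tail y) n ℤ.+ x (suc n) ℤ.* y 0
⊛-suc-right zero    x y = identity (x 0) (y 1) (x 1) (y 0)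
  where
  identity : ∀ a b c d → a ℤ.* b ℤ.+ (c ℤ.* d ℤ.+ 0ℤ) ≡ (a ℤ.* b ℤ.+ 0ℤ) ℤ.+ c ℤ.* d
  identity = ℤSolver.solve-∀
⊛-suc-right (suc n) x y = trans
  (cong (ℤ._+_ (x 0 ℤ.* y (suc (suc n)))) (⊛-suc-right n (tail x) y))
  (sym (ℤₚ.+-assoc (x 0 ℤ.* y (suc (suc n))) _ _))

⊛-comm-coeff : ∀ n x y → (x ⊛ y) n ≡ (y ⊛ x) n
⊛-comm-coeff zero    x y = cong (ℤ._+ 0ℤ) (ℤₚ.*-comm (x 0) (y 0))
⊛-comm-coeff (suc n) x y = begin
  x 0 ℤ.* y (suc n) ℤ.+ (tail x ⊛ y) n  ≡⟨ ℤₚ.+-comm (x 0 ℤ.* y (suc n)) _ ⟩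
  (tail x ⊛ y) n ℤ.+ x 0 ℤ.* y (suc n)
    ≡⟨ cong₂ ℤ._+_ (⊛-comm-coeff n (tail x) y) (ℤₚ.*-comm (x 0) _) ⟩
  (y ⊛ tail x) n ℤ.+ y (suc n) ℤ.* x 0  ≡⟨ ⊛-suc-right n y x ⟨
  (y ⊛ x) (suc n)                        ∎
  where open ≡-Reasoning

⊛-comm : ∀ x y → x ⊛ y ≈ y ⊛ x
⊛-comm x y = mk≈ λ n → ⊛-comm-coeff n x y

⊛-distribˡ : ∀ z x y → z ⊛ (x ⊕ y) ≈ z ⊛ x ⊕ z ⊛ y
⊛-distribˡ z x y = ≈-trans (⊛-comm z (x ⊕ y)) (≈-trans (⊛-distribʳ z x y)
  (mk≈ λ n → cong₂ ℤ._+_ (⊛-comm-coeff n x z) (⊛-comm-coeff n y z)))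

-- Opaque copies of the operations: otherwise unification unfolds the
-- coefficients of every product.
infixl 6 _∔_
infixl 7 _·_

opaque
  _∔_ : Series → Series → Series
  _∔_ = _⊕_

  _·_ : Series → Series → Series
  _·_ = _⊛_

  scale : ℤ → Series → Series
  scale c x n = c ℤ.* x n

opaque
  unfolding _∔_

  ∔-⊕ : ∀ x y → x ∔ y ≈ x ⊕ y
  ∔-⊕ x y = ≈-refl

  ·-⊛ : ∀ x y → x · y ≈ x ⊛ y
  ·-⊛ x y = ≈-refl

  scale-coeff : ∀ c x n → scale c x n ≡ c ℤ.* x n
  scale-coeff c x n = refl

  ·-local : ∀ {x x′ y y′} n → (∀ i → i ℕ.≤ n → x i ≡ x′ i) → (∀ i → i ℕ.≤ n → y i ≡ y′ i) →
            (x · y) n ≡ (x′ · y′) n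
  ·-local = ⊛-local

  scale-· : ∀ c x y → scale c x · y ≈ scale c (x · y)
  scale-· = scale-⊛

  isCommutativeRing : IsCommutativeRing _≈_ _∔_ _·_ ⊝_ 𝟘 𝟙
  isCommutativeRing = record
    { isRing = record
      { +-isAbelianGroup = record
        { isGroup = record
          { isMonoid = record
            { isSemigroup = record
              { isMagma = record
                { isEquivalence = record { refl = ≈-refl ; sym = ≈-sym ; trans = ≈-trans }
                ; ∙-cong = λ p q → mk≈ λ n → cong₂ ℤ._+_ (coeff p n) (coeff q n) }
              ; assoc = λ x y z → mk≈ λ n → ℤₚ.+-assoc (x n) (y n) (z n) }
            ; identity = (λ x → mk≈ λ n → ℤₚ.+-identityˡ (x n)) , λ x → mk≈ λ n → ℤₚ.+-identityʳ (x n) }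
          ; inverse = (λ x → mk≈ λ n → ℤₚ.+-inverseˡ (x n)) , λ x → mk≈ λ n → ℤₚ.+-inverseʳ (x n)
          ; ⁻¹-cong = λ p → mk≈ λ n → cong ℤ.-_ (coeff p n) }
        ; comm = λ x y → mk≈ λ n → ℤₚ.+-comm (x n) (y n) }
      ; *-cong = ⊛-cong
      ; *-assoc = λ x y z → mk≈ λ n → ⊛-assoc-coeff n x y z
      ; *-identity = (λ x → ≈-trans (⊛-comm 𝟙 x) (mk≈ (⊛-identityʳ x))) , λ x → mk≈ (⊛-identityʳ x)
      ; distrib = ⊛-distribˡ , ⊛-distribʳ }
    ; *-comm = ⊛-comm }

seriesRing : CommutativeRing 0ℓ 0ℓ
seriesRing = record { isCommutativeRing = isCommutativeRing }

module R where
  open CommutativeRing seriesRing public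


·-cong : ∀ {x x′ y y′} → x ≈ x′ → y ≈ y′ → x · y ≈ x′ · y′
·-cong = R.*-cong

∔-cong : ∀ {x x′ y y′} → x ≈ x′ → y ≈ y′ → x ∔ y ≈ x′ ∔ y′
∔-cong = R.+-cong

·-distribʳ : ∀ z x y → (x ∔ y) · z ≈ x · z ∔ y · z
·-distribʳ = R.distribʳ

∔-coeff : ∀ x y n → (x ∔ y) n ≡ x n ℤ.+ y n
∔-coeff x y n = coeff (∔-⊕ x y) n

-- Chosen so that the solver's constants 0 and 1 are definitionally 𝟘 and 𝟙.
constant : ℤ → Series
constant (+ 0) = 𝟘
constant (+ 1) = 𝟙
constant c     = scale c 𝟙

constant-scale : ∀ c → constant c ≈ scale c 𝟙
constant-scale (+ 0)           = mk≈ λ n → sym (scale-coeff 0ℤ 𝟙 n)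
constant-scale (+ 1)           = mk≈ λ n → sym (trans (scale-coeff 1ℤ 𝟙 n) (ℤₚ.*-identityˡ (𝟙 n)))
constant-scale (+ suc (suc c)) = ≈-refl
constant-scale -[1+ c ]        = ≈-refl

opaque
  unfolding _∔_

  constant-+ : ∀ c d → constant (c ℤ.+ d) ≈ constant c ∔ constant d
  constant-+ c d = ≈-trans (constant-scale (c ℤ.+ d)) (mk≈ λ n → trans
    (ℤₚ.*-distribʳ-+ (𝟙 n) c d)
    (sym (cong₂ ℤ._+_ (coeff (constant-scale c) n) (coeff (constant-scale d) n))))

  constant-* : ∀ c d → constant (c ℤ.* d) ≈ constant c · constant d
  constant-* c d = ≈-trans (constant-scale (c ℤ.* d)) (mk≈ λ n → trans
    (trans (ℤₚ.*-assoc c d (𝟙 n)) (cong (c ℤ.*_) (sym (coeff (constant-scale d) n))))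
    (sym (trans (coeff (⊛-cong {y = constant d} (constant-scale c) ≈-refl) n)
      (trans (coeff (scale-⊛ c 𝟙 (constant d)) n)
        (cong (c ℤ.*_) (trans (coeff (⊛-comm 𝟙 (constant d)) n) (⊛-identityʳ (constant d) n)))))))

  constant-neg : ∀ c → constant (ℤ.- c) ≈ ⊝ constant c
  constant-neg c = ≈-trans (constant-scale (ℤ.- c)) (mk≈ λ n → trans
    (sym (ℤₚ.neg-distribˡ-* c (𝟙 n))) (cong ℤ.-_ (sym (coeff (constant-scale c) n))))

constant-homo : ℤ.+-*-rawRing -Raw-AlmostCommutative⟶ fromCommutativeRing seriesRing
constant-homo = record
  { ⟦_⟧ = constant ; +-homo = constant-+ ; *-homo = constant-* ; -‿homo = constant-neg
  ; 0-homo = ≈-refl ; 1-homo = ≈-refl }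

constant-≟ : ∀ c d → Maybe (constant c ≈ constant d)
constant-≟ c d with c ℤ.≟ d
... | yes refl = just ≈-refl
... | no _     = nothing

open import Algebra.Solver.Ring ℤ.+-*-rawRing (fromCommutativeRing seriesRing) constant-homo constant-≟
  using (solve; _:=_; _:+_; _:*_; _:-_; :-_; con)

-- Monomials and multiplication by powers of q

q^-diag : ∀ m → (q^ m) m ≡ 1ℤ
q^-diag m with m ℕ.≟ m
... | yes _  = refl
... | no m≢m = contradiction refl m≢m

q^-off : ∀ {m n} → n ≢ m → (q^ m) n ≡ 0ℤ
q^-off {m} {n} n≢m with n ℕ.≟ m
... | yes n≡m = contradiction n≡m n≢m
... | no _    = refl

tail-q^ : ∀ m → tail (q^ suc m) ≈ q^ m
tail-q^ m = mk≈ λ n → go n (n ℕ.≟ m)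
  where
  go : ∀ n → _ → (q^ suc m) (suc n) ≡ (q^ m) n
  go n (yes refl) = trans (q^-diag (suc n)) (sym (q^-diag n))
  go n (no n≢m)   = trans (q^-off (n≢m ∘ ℕₚ.suc-injective)) (sym (q^-off n≢m))

opaque
  unfolding _∔_

  q^·-suc : ∀ m x n → (q^ suc m · x) (suc n) ≡ (q^ m · x) n
  q^·-suc m x n = trans (cong (ℤ._+ (tail (q^ suc m) ⊛ x) n) (ℤₚ.*-zeroˡ (x (suc n))))
    (trans (ℤₚ.+-identityˡ _) (coeff (⊛-cong {y = x} (tail-q^ m) ≈-refl) n))

·-head : ∀ x y → (x · y) 0 ≡ x 0 ℤ.* y 0
·-head x y = trans (coeff (·-⊛ x y) 0) (ℤₚ.+-identityʳ _)

q^·-low : ∀ m x {n} → n ℕ.< m → (q^ m · x) n ≡ 0ℤ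
q^·-low (suc m) x {zero}  _       = trans (·-head (q^ suc m) x) (ℤₚ.*-zeroˡ (x 0))
q^·-low (suc m) x {suc n} (s≤s p) = trans (q^·-suc m x n) (q^·-low m x p)

q^·-shift : ∀ m x n → (q^ m · x) (m + n) ≡ x n
q^·-shift zero    x n = coeff (R.*-identityˡ x) n
q^·-shift (suc m) x n = trans (q^·-suc m x (m + n)) (q^·-shift m x n)

module _ (m : ℕ) {x y : Series} where
  q^·-unique : (∀ {n} → n ℕ.< m → y n ≡ 0ℤ) → (∀ n → y (m + n) ≡ x n) → q^ m · x ≈ y
  q^·-unique low high = mk≈ λ n → go n (ℕₚ.≤-total m n) (n ℕₚ.<? m)
    where
    go : ∀ n → _ → _ → (q^ m · x) n ≡ y n
    go n _ (yes n<m) = trans (q^·-low m x n<m) (sym (low n<m))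
    go n _ (no n≮m)  = subst (λ k → (q^ m · x) k ≡ y k) (ℕₚ.m+[n∸m]≡n (ℕₚ.≮⇒≥ n≮m))
      (trans (q^·-shift m x (n ∸ m)) (sym (high (n ∸ m))))

q^-+ : ∀ m n → q^ m · q^ n ≈ q^ (m + n)
q^-+ m n = q^·-unique m (λ i<m → q^-off (ℕₚ.<⇒≢ (ℕₚ.<-≤-trans i<m (ℕₚ.m≤m+n m n)))) λ i → go i (i ℕ.≟ n)
  where
  go : ∀ i → _ → (q^ (m + n)) (m + i) ≡ (q^ n) i
  go i (yes refl) = trans (q^-diag (m + i)) (sym (q^-diag i))
  go i (no i≢n)   = trans (q^-off (i≢n ∘ ℕₚ.+-cancelˡ-≡ m i n)) (sym (q^-off i≢n))

q^-cong : ∀ {m n} → m ≡ n → q^ m ≈ q^ n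
q^-cong refl = ≈-refl

opaque
  unfolding _∔_

  head-tail : ∀ x → x ≈ scale (x 0) 𝟙 ∔ q^ 1 · tail x
  head-tail x = mk≈ λ
    { zero    → sym (trans (cong₂ ℤ._+_ (ℤₚ.*-identityʳ (x 0)) (q^·-low 1 (tail x) {0} (s≤s z≤n)))
                           (ℤₚ.+-identityʳ (x 0)))
    ; (suc n) → sym (trans (cong₂ ℤ._+_ (ℤₚ.*-zeroʳ (x 0)) (q^·-shift 1 (tail x) n))
                           (ℤₚ.+-identityˡ (x (suc n)))) }

-- Congruence modulo q^N and cancellation of units

infix 4 _≈[_]_

record _≈[_]_ (x : Series) (N : ℕ) (y : Series) : Set where
  constructor mk≈[]
  field below : ∀ {n} → n ℕ.< N → x n ≡ y n
open _≈[_]_ public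

≈⇒≈[] : ∀ {x y N} → x ≈ y → x ≈[ N ] y
≈⇒≈[] p = mk≈[] λ {n} _ → coeff p n

≈[]-sym : ∀ {x y N} → x ≈[ N ] y → y ≈[ N ] x
≈[]-sym p = mk≈[] λ n<N → sym (below p n<N)

≈[]-trans : ∀ {x y z N} → x ≈[ N ] y → y ≈[ N ] z → x ≈[ N ] z
≈[]-trans p q = mk≈[] λ n<N → trans (below p n<N) (below q n<N)

≈[]-weaken : ∀ {x y M N} → M ℕ.≤ N → x ≈[ N ] y → x ≈[ M ] y
≈[]-weaken M≤N p = mk≈[] λ n<M → below p (ℕₚ.<-≤-trans n<M M≤N)

≈[]⇒≈ : ∀ {x y} → (∀ N → x ≈[ N ] y) → x ≈ y
≈[]⇒≈ p = mk≈ λ n → below (p (suc n)) ℕₚ.≤-refl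

·-cong[] : ∀ {x x′ y y′ N} → x ≈[ N ] x′ → y ≈[ N ] y′ → x · y ≈[ N ] x′ · y′
·-cong[] p q = mk≈[] λ {n} n<N → ·-local n
  (λ i i≤n → below p (ℕₚ.≤-<-trans i≤n n<N)) (λ i i≤n → below q (ℕₚ.≤-<-trans i≤n n<N))

-- The gain of `e` in precision drives the induction in `D-·` and the error estimate in the triple
-- product.
≈[]-q^· : ∀ e {x y N} → x ≈[ N ] y → q^ e · x ≈[ e + N ] q^ e · y
≈[]-q^· e {x} {y} {N} p = mk≈[] λ {n} → go n (n ℕₚ.<? e)
  where
  go : ∀ n → _ → n ℕ.< e + N → (q^ e · x) n ≡ (q^ e · y) n
  go n (yes n<e) _ = trans (q^·-low e x n<e) (sym (q^·-low e y n<e))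
  go n (no n≮e) lt = subst (λ k → (q^ e · x) k ≡ (q^ e · y) k) e+[n∸e]≡n
    (trans (q^·-shift e x (n ∸ e)) (trans (below p bound) (sym (q^·-shift e y (n ∸ e)))))
    where
    e+[n∸e]≡n : e + (n ∸ e) ≡ n
    e+[n∸e]≡n = ℕₚ.m+[n∸m]≡n (ℕₚ.≮⇒≥ n≮e)
    bound : n ∸ e ℕ.< N
    bound = ℕₚ.+-cancelˡ-< e (n ∸ e) N (subst (ℕ._< e + N) (sym e+[n∸e]≡n) lt)

q^≈[]𝟘 : ∀ {m N} → N ℕ.≤ m → q^ m ≈[ N ] 𝟘
q^≈[]𝟘 N≤m = mk≈[] λ n<N → q^-off (ℕₚ.<⇒≢ (ℕₚ.<-≤-trans n<N N≤m))

x·inv : ∀ {x} → x 0 ≡ 1ℤ → x · inv x ≈ 𝟙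
x·inv {x} x₀≡1 = ≈-trans (·-⊛ x (inv x)) (mk≈ (⊛-inv x x₀≡1))

·-cancelˡ[] : ∀ {x y z N} → x 0 ≡ 1ℤ → x · y ≈[ N ] x · z → y ≈[ N ] z
·-cancelˡ[] {x} {y} {z} x₀≡1 p =
  ≈[]-trans (≈⇒≈[] (≈-sym (undo y))) (≈[]-trans (·-cong[] (≈⇒≈[] ≈-refl) p) (≈⇒≈[] (undo z)))
  where
  undo : ∀ w → inv x · (x · w) ≈ w
  undo w = ≈-trans (solve 3 (λ i x w → i :* (x :* w) := (x :* i) :* w) ≈-refl (inv x) x w)
    (≈-trans (·-cong (x·inv x₀≡1) ≈-refl) (R.*-identityˡ w))

·-cancelˡ : ∀ {x y z} → x 0 ≡ 1ℤ → x · y ≈ x · z → y ≈ z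
·-cancelˡ x₀≡1 p = ≈[]⇒≈ λ N → ·-cancelˡ[] x₀≡1 (≈⇒≈[] p)

·-unit₀ : ∀ {x y} → x 0 ≡ 1ℤ → y 0 ≡ 1ℤ → (x · y) 0 ≡ 1ℤ
·-unit₀ {x} {y} p q = trans (·-head x y) (cong₂ ℤ._*_ p q)

-- Infinite products

partial : (ℕ → Series) → ℕ → Series
partial g zero    = 𝟙
partial g (suc N) = partial g N · g N

∏ : (ℕ → Series) → Series
∏ g n = partial g n n

-- Enough for the coefficients of the partial products to be eventually
-- constant with the value recorded by ∏.
Conv : (ℕ → Series) → Set
Conv g = ∀ i → g i ≈[ suc i ] 𝟙

partial-stable : ∀ {g} → Conv g → ∀ d N → partial g (d + N) ≈[ suc N ] partial g N
partial-stable conv zero    N = ≈⇒≈[] ≈-refl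
partial-stable {g} conv (suc d) N = ≈[]-trans
  (·-cong[] (partial-stable conv d N) (≈[]-weaken (s≤s (ℕₚ.m≤n+m N d)) (conv (d + N))))
  (≈⇒≈[] (R.*-identityʳ (partial g N)))

∏-partial : ∀ {g} → Conv g → ∀ {n N} → n ℕ.≤ N → ∏ g n ≡ partial g N n
∏-partial {g} conv {n} {N} n≤N = subst (λ M → ∏ g n ≡ partial g M n) (ℕₚ.m∸n+n≡m n≤N)
  (sym (below (partial-stable conv (N ∸ n) n) ℕₚ.≤-refl))

∏≈[]partial : ∀ {g} → Conv g → ∀ N → ∏ g ≈[ suc N ] partial g N
∏≈[]partial conv N = mk≈[] λ { (s≤s n≤N) → ∏-partial conv n≤N }

partial-cong : ∀ {g h} → (∀ i → g i ≈ h i) → ∀ N → partial g N ≈ partial h N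
partial-cong p zero    = ≈-refl
partial-cong p (suc N) = ·-cong (partial-cong p N) (p N)

∏-cong : ∀ {g h} → (∀ i → g i ≈ h i) → ∏ g ≈ ∏ h
∏-cong p = mk≈ λ n → coeff (partial-cong p n) n

partial-· : ∀ g h N → partial g N · partial h N ≈ partial (λ i → g i · h i) N
partial-· g h zero    = R.*-identityˡ 𝟙
partial-· g h (suc N) = ≈-trans
  (solve 4 (λ a b c d → (a :* b) :* (c :* d) := (a :* c) :* (b :* d)) ≈-refl
    (partial g N) (g N) (partial h N) (h N))
  (·-cong (partial-· g h N) ≈-refl)

∏-· : ∀ {g h} → Conv g → Conv h → ∏ g · ∏ h ≈ ∏ (λ i → g i · h i)
∏-· {g} {h} conv conv′ = mk≈ λ n → trans
  (below (·-cong[] (∏≈[]partial conv n) (∏≈[]partial conv′ n)) ℕₚ.≤-refl)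
  (coeff (partial-· g h n) n)

partial-+ : ∀ g M N → partial g (M + N) ≈ partial g M · partial (λ i → g (M + i)) N
partial-+ g M zero    = subst (λ k → partial g k ≈ partial g M · 𝟙) (sym (ℕₚ.+-identityʳ M))
  (≈-sym (R.*-identityʳ (partial g M)))
partial-+ g M (suc N) = subst (λ k → partial g k ≈ partial g M · partial (λ i → g (M + i)) (suc N))
  (sym (ℕₚ.+-suc M N))
  (≈-trans (·-cong (partial-+ g M N) ≈-refl) (R.*-assoc (partial g M) _ _))

partial-blocks : ∀ g m N → partial g (N * m) ≈ partial (λ i → partial (λ r → g (i * m + r)) m) N
partial-blocks g m zero    = ≈-refl
partial-blocks g m (suc N) = subst
  (λ k → partial g k ≈ partial (λ i → partial (λ r → g (i * m + r)) m) (suc N)) (ℕₚ.+-comm (N * m) m)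
  (≈-trans (partial-+ g (N * m) m) (·-cong (partial-blocks g m N) ≈-refl))

∏-blocks : ∀ g m .{{_ : NonZero m}} → Conv g → ∏ g ≈ ∏ (λ i → partial (λ r → g (i * m + r)) m)
∏-blocks g m conv = mk≈ λ n → trans (∏-partial conv (ℕₚ.m≤m*n n m)) (coeff (partial-blocks g m n) n)

opaque
  unfolding _∔_

  scale-cong : ∀ c {x y} → x ≈ y → scale c x ≈ scale c y
  scale-cong c p = mk≈ λ n → cong (c ℤ.*_) (coeff p n)

-- The substitution q ↦ q^k

D : ℕ → Series → Series
D k x n with k ∣? n
... | yes k∣n = x (quotient k∣n)
... | no _    = 0ℤ

D-* : ∀ k .{{_ : NonZero k}} x n → D k x (n * k) ≡ x n
D-* k x n with k ∣? (n * k)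
... | yes (divides m eq) = cong x (sym (ℕₚ.*-cancelʳ-≡ n m k eq))
... | no ¬k∣n            = contradiction (divides n refl) ¬k∣n

D-off : ∀ k x {n} → ¬ k ∣ n → D k x n ≡ 0ℤ
D-off k x {n} ¬k∣n with k ∣? n
... | yes k∣n = contradiction k∣n ¬k∣n
... | no _    = refl

module _ (k : ℕ) .{{_ : NonZero k}} where

  D-unique : ∀ {x y} → (∀ n → y (n * k) ≡ x n) → (∀ {n} → ¬ k ∣ n → y n ≡ 0ℤ) → D k x ≈ y
  D-unique {x} {y} on off = mk≈ λ n → go n (k ∣? n)
    where
    go : ∀ n → _ → D k x n ≡ y n
    go n (yes (divides m refl)) = trans (D-* k x m) (sym (on m))
    go n (no ¬k∣n)              = trans (D-off k x ¬k∣n) (sym (off ¬k∣n))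

  D-cong : ∀ {x y} → x ≈ y → D k x ≈ D k y
  D-cong {x} {y} p = D-unique (λ n → trans (D-* k y n) (sym (coeff p n))) (D-off k y)

  opaque
    unfolding _∔_

    D-∔ : ∀ x y → D k (x ∔ y) ≈ D k x ∔ D k y
    D-∔ x y = D-unique (λ n → cong₂ ℤ._+_ (D-* k x n) (D-* k y n))
      (λ ¬k∣n → cong₂ ℤ._+_ (D-off k x ¬k∣n) (D-off k y ¬k∣n))

    D-scale : ∀ c x → D k (scale c x) ≈ scale c (D k x)
    D-scale c x = D-unique (λ n → cong (c ℤ.*_) (D-* k x n))
      (λ ¬k∣n → trans (cong (c ℤ.*_) (D-off k x ¬k∣n)) (ℤₚ.*-zeroʳ c))

  D-q^ : ∀ m → D k (q^ m) ≈ q^ (m * k)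
  D-q^ m = D-unique (λ n → go n (n ℕ.≟ m)) (λ ¬k∣n → q^-off λ eq → ¬k∣n (divides m eq))
    where
    go : ∀ n → _ → (q^ (m * k)) (n * k) ≡ (q^ m) n
    go n (yes refl) = trans (q^-diag (n * k)) (sym (q^-diag n))
    go n (no n≢m)   = trans (q^-off (n≢m ∘ ℕₚ.*-cancelʳ-≡ n m k)) (sym (q^-off n≢m))

  D-q· : ∀ x → D k (q^ 1 · x) ≈ q^ k · D k x
  D-q· x = D-unique on off
    where
    on : ∀ n → (q^ k · D k x) (n * k) ≡ (q^ 1 · x) n
    on zero    = trans (q^·-low k (D k x) (ℕ.>-nonZero⁻¹ k)) (sym (q^·-low 1 x {0} (s≤s z≤n)))
    on (suc n) = trans (q^·-shift k (D k x) (n * k)) (trans (D-* k x n) (sym (q^·-shift 1 x n)))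
    off : ∀ {n} → ¬ k ∣ n → (q^ k · D k x) n ≡ 0ℤ
    off {n} ¬k∣n with n ℕₚ.<? k
    ... | yes n<k = q^·-low k (D k x) n<k
    ... | no n≮k  = subst (λ i → (q^ k · D k x) i ≡ 0ℤ) k+[n∸k]≡n
      (trans (q^·-shift k (D k x) (n ∸ k)) (D-off k x λ { (divides m eq) →
        ¬k∣n (divides (suc m) (trans (sym k+[n∸k]≡n) (cong (λ i → k + i) eq))) }))
      where
      k+[n∸k]≡n : k + (n ∸ k) ≡ n
      k+[n∸k]≡n = ℕₚ.m+[n∸m]≡n (ℕₚ.≮⇒≥ n≮k)

  head-· : ∀ x y → x · y ≈ scale (x 0) y ∔ q^ 1 · (tail x · y)
  head-· x y = ≈-trans (·-cong (head-tail x) ≈-refl) (≈-trans (·-distribʳ y _ _)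
    (∔-cong (≈-trans (scale-· (x 0) 𝟙 y) (scale-cong (x 0) (R.*-identityˡ y)))
      (R.*-assoc (q^ 1) (tail x) y)))

  D-head : ∀ x → D k x ≈ scale (x 0) 𝟙 ∔ q^ k · D k (tail x)
  D-head x = ≈-trans (D-cong (head-tail x)) (≈-trans (D-∔ _ _) (∔-cong
    (≈-trans (D-scale (x 0) 𝟙) (scale-cong (x 0) (D-q^ 0)))
    (D-q· (tail x))))

  -- Both sides satisfy the recursion z(x) = x₀ y(q^k) + q^k z(tail x), where the factor q^k leaves
  -- only coefficients below `n` to be compared. Strong induction on `n`, for all `x` at once, thus
  -- avoids reindexing the Cauchy sum.
  D-· : ∀ x y → D k x · D k y ≈ D k (x · y)
  D-· x y = mk≈ λ n → <-rec (λ n → ∀ x → (D k x · D k y) n ≡ D k (x · y) n) step n x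
    where
    left : ∀ x → D k x · D k y ≈ scale (x 0) (D k y) ∔ q^ k · (D k (tail x) · D k y)
    left x = ≈-trans (·-cong (D-head x) ≈-refl) (≈-trans (·-distribʳ (D k y) _ _)
      (∔-cong (≈-trans (scale-· (x 0) 𝟙 _) (scale-cong (x 0) (R.*-identityˡ (D k y))))
        (R.*-assoc (q^ k) (D k (tail x)) (D k y))))
    right : ∀ x → D k (x · y) ≈ scale (x 0) (D k y) ∔ q^ k · D k (tail x · y)
    right x = ≈-trans (D-cong (head-· x y)) (≈-trans (D-∔ _ _)
      (∔-cong (D-scale (x 0) y) (D-q· (tail x · y))))
    step : ∀ n → (∀ {m} → m ℕ.< n → ∀ x → (D k x · D k y) m ≡ D k (x · y) m) →
           ∀ x → (D k x · D k y) n ≡ D k (x · y) n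
    step n ih x = trans (coeff (left x) n) (trans
      (trans (∔-coeff (scale (x 0) (D k y)) _ n)
        (trans (cong (ℤ._+_ (scale (x 0) (D k y) n))
          (below (≈[]-q^· k {N = n} (mk≈[] λ m<n → ih m<n (tail x))) (ℕₚ.m<n+m n (ℕ.>-nonZero⁻¹ k))))
          (sym (∔-coeff (scale (x 0) (D k y)) _ n))))
      (sym (coeff (right x) n)))

-- The substitution q ↦ -q

sgn : ℕ → ℤ
sgn zero    = 1ℤ
sgn (suc n) = ℤ.- sgn n

sgn-+ : ∀ m n → sgn (m + n) ≡ sgn m ℤ.* sgn n
sgn-+ zero    n = sym (ℤₚ.*-identityˡ (sgn n))
sgn-+ (suc m) n = trans (cong ℤ.-_ (sgn-+ m n)) (ℤₚ.neg-distribˡ-* (sgn m) (sgn n))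

opaque
  unfolding _∔_

  σ : Series → Series
  σ x n = sgn n ℤ.* x n

  σ-cong : ∀ {x y} → x ≈ y → σ x ≈ σ y
  σ-cong p = mk≈ λ n → cong (sgn n ℤ.*_) (coeff p n)

  σ-q^ : ∀ m → σ (q^ m) ≈ scale (sgn m) (q^ m)
  σ-q^ m = mk≈ λ n → go n (n ℕ.≟ m)
    where
    go : ∀ n → Dec (n ≡ m) → σ (q^ m) n ≡ scale (sgn m) (q^ m) n
    go n (yes refl) = refl
    go n (no n≢m)   = trans (trans (cong (sgn n ℤ.*_) (q^-off n≢m)) (ℤₚ.*-zeroʳ (sgn n)))
      (sym (trans (cong (sgn m ℤ.*_) (q^-off n≢m)) (ℤₚ.*-zeroʳ (sgn m))))

  σ-𝟙 : σ 𝟙 ≈ 𝟙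
  σ-𝟙 = ≈-trans (σ-q^ 0) (mk≈ λ n → ℤₚ.*-identityˡ (𝟙 n))

  σ-· : ∀ x y → σ x · σ y ≈ σ (x · y)
  σ-· x y = mk≈ λ n → trans
    (sum-cong-≗ {suc n} λ i → trans
      (interchange (sgn (toℕ i)) (x (toℕ i)) (sgn (n ∸ toℕ i)) (y (n ∸ toℕ i)))
      (cong (ℤ._* (x (toℕ i) ℤ.* y (n ∸ toℕ i))) (trans (sym (sgn-+ (toℕ i) (n ∸ toℕ i)))
        (cong sgn (ℕₚ.m+[n∸m]≡n (Finₚ.toℕ≤pred[n] i))))))
    (sym (Sumℤ.*-distribˡ-sum {suc n} (sgn n) λ i → x (toℕ i) ℤ.* y (n ∸ toℕ i)))
    where
    interchange : ∀ a b c d → (a ℤ.* b) ℤ.* (c ℤ.* d) ≡ (a ℤ.* c) ℤ.* (b ℤ.* d)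
    interchange = ℤSolver.solve-∀

  σ-coeff : ∀ x n → σ x n ≡ sgn n ℤ.* x n
  σ-coeff x n = refl

-- Common interface of `D k` and `σ`, so that inverses, powers and eta quotients are transported
-- once for both. The field `h-0` keeps constant terms equal to 1, hence units units.
record Endo (h : Series → Series) : Set where
  field
    h-cong : ∀ {x y} → x ≈ y → h x ≈ h y
    h-·    : ∀ x y → h x · h y ≈ h (x · y)
    h-𝟙    : h 𝟙 ≈ 𝟙
    h-0    : ∀ x → h x 0 ≡ x 0

  h-inv : ∀ {x} → x 0 ≡ 1ℤ → h (inv x) ≈ inv (h x)
  h-inv {x} x₀≡1 = ·-cancelˡ hx₀≡1
    (≈-trans (≈-trans (h-· x (inv x)) (≈-trans (h-cong (x·inv x₀≡1)) h-𝟙)) (≈-sym (x·inv hx₀≡1)))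
    where
    hx₀≡1 : h x 0 ≡ 1ℤ
    hx₀≡1 = trans (h-0 x) x₀≡1

  h-^ℕ : ∀ x n → h (x ^ℕ n) ≈ h x ^ℕ n
  h-^ℕ x zero    = h-𝟙
  h-^ℕ x (suc n) = ≈-trans (h-cong (≈-sym (·-⊛ x (x ^ℕ n)))) (≈-trans (≈-sym (h-· x (x ^ℕ n)))
    (≈-trans (·-cong ≈-refl (h-^ℕ x n)) (·-⊛ (h x) (h x ^ℕ n))))

  h-partial : ∀ g N → h (partial g N) ≈ partial (λ i → h (g i)) N
  h-partial g zero    = h-𝟙
  h-partial g (suc N) = ≈-trans (≈-sym (h-· (partial g N) (g N))) (·-cong (h-partial g N) ≈-refl)

D-endo : ∀ k .{{_ : NonZero k}} → Endo (D k)
D-endo k = record { h-cong = D-cong k ; h-· = D-· k ; h-𝟙 = D-q^ k 0 ; h-0 = λ x → D-* k x 0 }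

σ-endo : Endo σ
σ-endo = record { h-cong = σ-cong ; h-· = σ-· ; h-𝟙 = σ-𝟙 ; h-0 = λ x → trans (σ-coeff x 0) (ℤₚ.*-identityˡ (x 0)) }

D-∏ : ∀ k .{{_ : NonZero k}} g → Conv g → D k (∏ g) ≈ ∏ (λ i → D k (g i))
D-∏ k g conv = mk≈ λ n → go n (k ∣? n)
  where
  go : ∀ n → _ → D k (∏ g) n ≡ ∏ (λ i → D k (g i)) n
  go n (yes (divides m refl)) = trans (D-* k (∏ g) m) (trans (∏-partial conv (ℕₚ.m≤m*n m k))
    (trans (sym (D-* k (partial g (m * k)) m)) (coeff (Endo.h-partial (D-endo k) g (m * k)) (m * k))))
  go n (no ¬k∣n) = trans (D-off k (∏ g) ¬k∣n) (trans (sym (D-off k (partial g n) ¬k∣n))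
    (coeff (Endo.h-partial (D-endo k) g n) n))

σ-∏ : ∀ g → σ (∏ g) ≈ ∏ (λ i → σ (g i))
σ-∏ g = mk≈ λ n → trans (σ-coeff (∏ g) n)
  (trans (sym (σ-coeff (partial g n) n)) (coeff (Endo.h-partial σ-endo g n) n))

-- Integer powers of series with constant term 1

^ℕ-suc : ∀ x n → x ^ℕ suc n ≈ x · x ^ℕ n
^ℕ-suc x n = ≈-sym (·-⊛ x (x ^ℕ n))

^ℕ-+ : ∀ x m n → x ^ℕ (m + n) ≈ x ^ℕ m · x ^ℕ n
^ℕ-+ x zero    n = ≈-sym (R.*-identityˡ (x ^ℕ n))
^ℕ-+ x (suc m) n = ≈-trans (^ℕ-suc x (m + n)) (≈-trans (·-cong ≈-refl (^ℕ-+ x m n))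
  (≈-trans (≈-sym (R.*-assoc x (x ^ℕ m) (x ^ℕ n))) (·-cong (≈-sym (^ℕ-suc x m)) ≈-refl)))

^ℕ-unit₀ : ∀ {x} → x 0 ≡ 1ℤ → ∀ n → (x ^ℕ n) 0 ≡ 1ℤ
^ℕ-unit₀ x₀≡1 zero    = refl
^ℕ-unit₀ {x} x₀≡1 (suc n) = trans (coeff (^ℕ-suc x n) 0) (·-unit₀ x₀≡1 (^ℕ-unit₀ x₀≡1 n))

^ℤ-unit₀ : ∀ {x} → x 0 ≡ 1ℤ → ∀ t → (x ^ℤ t) 0 ≡ 1ℤ
^ℤ-unit₀ x₀≡1 (+ n)    = ^ℕ-unit₀ x₀≡1 n
^ℤ-unit₀ {x} x₀≡1 -[1+ n ] = ^ℕ-unit₀ {inv x} refl (suc n)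

^ℕ-cong : ∀ {x y} → x ≈ y → ∀ n → x ^ℕ n ≈ y ^ℕ n
^ℕ-cong p zero    = ≈-refl
^ℕ-cong {x} {y} p (suc n) =
  ≈-trans (^ℕ-suc x n) (≈-trans (·-cong p (^ℕ-cong p n)) (≈-sym (^ℕ-suc y n)))

inv-cong : ∀ {x y} → x 0 ≡ 1ℤ → x ≈ y → inv x ≈ inv y
inv-cong {x} {y} x₀≡1 p = ·-cancelˡ x₀≡1 (≈-trans (x·inv x₀≡1) (≈-sym
  (≈-trans (·-cong p ≈-refl) (x·inv (trans (sym (coeff p 0)) x₀≡1)))))

^ℤ-cong : ∀ {x y} → x 0 ≡ 1ℤ → x ≈ y → ∀ t → x ^ℤ t ≈ y ^ℤ t
^ℤ-cong x₀≡1 p (+ n)    = ^ℕ-cong p n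
^ℤ-cong x₀≡1 p -[1+ n ] = ^ℕ-cong (inv-cong x₀≡1 p) (suc n)

module _ {x : Series} (x₀≡1 : x 0 ≡ 1ℤ) where

  ^ℤ-⊖ : ∀ m n → x ^ℤ (m ℤ.⊖ n) · x ^ℕ n ≈ x ^ℕ m
  ^ℤ-⊖ zero    zero    = R.*-identityˡ 𝟙
  ^ℤ-⊖ (suc m) zero    = R.*-identityʳ (x ^ℕ suc m)
  ^ℤ-⊖ zero    (suc n) = invPower (suc n)
    where
    invPower : ∀ n → inv x ^ℕ n · x ^ℕ n ≈ 𝟙
    invPower zero    = R.*-identityˡ 𝟙
    invPower (suc n) = ≈-trans (·-cong (^ℕ-suc (inv x) n) (^ℕ-suc x n))
      (≈-trans (solve 4 (λ i a x b → (i :* a) :* (x :* b) := (x :* i) :* (a :* b)) ≈-refl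
        (inv x) (inv x ^ℕ n) x (x ^ℕ n))
      (≈-trans (·-cong (x·inv x₀≡1) (invPower n)) (R.*-identityˡ 𝟙)))
  ^ℤ-⊖ (suc m) (suc n) = subst (λ t → x ^ℤ t · x ^ℕ suc n ≈ x ^ℕ suc m) (sym (ℤₚ.[1+m]⊖[1+n]≡m⊖n m n))
    (≈-trans (·-cong ≈-refl (^ℕ-suc x n))
    (≈-trans (solve 3 (λ a x b → a :* (x :* b) := x :* (a :* b)) ≈-refl (x ^ℤ (m ℤ.⊖ n)) x (x ^ℕ n))
    (≈-trans (·-cong ≈-refl (^ℤ-⊖ m n)) (≈-sym (^ℕ-suc x m)))))

  ^ℤ-difference : ∀ t n {m} → t ℤ.+ + n ≡ + m → x ^ℤ t · x ^ℕ n ≈ x ^ℕ m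
  ^ℤ-difference t n {m} eq = subst (λ s → x ^ℤ s · x ^ℕ n ≈ x ^ℕ m) (sym t≡m⊖n) (^ℤ-⊖ m n)
    where
    t≡m⊖n : t ≡ m ℤ.⊖ n
    t≡m⊖n = trans (lemma t (+ n)) (trans (cong (ℤ._- + n) eq) (ℤₚ.m-n≡m⊖n m n))
      where
      lemma : ∀ t u → t ≡ t ℤ.+ u ℤ.- u
      lemma = ℤSolver.solve-∀

  -- Each exponent is a difference of two naturals. Multiplying by the unit `x ^ℕ (n + n′)` clears
  -- the negative parts, which leaves the law for natural exponents and no case analysis on signs.
  ^ℤ-+ : ∀ s t → x ^ℤ (s ℤ.+ t) ≈ x ^ℤ s · x ^ℤ t
  ^ℤ-+ s t with difference s | difference t
    where
    difference : ∀ t → ∃ λ m → ∃ λ n → t ℤ.+ + n ≡ + m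
    difference (+ a)    = a , 0 , ℤₚ.+-identityʳ (+ a)
    difference -[1+ a ] = 0 , suc a , ℤₚ.n⊖n≡0 (suc a)
  ... | m , n , p | m′ , n′ , p′ = ·-cancelˡ (^ℕ-unit₀ x₀≡1 (n + n′))
    (≈-trans (R.*-comm (x ^ℕ (n + n′)) _) (≈-trans (^ℤ-difference (s ℤ.+ t) (n + n′) sum≡)
    (≈-trans (^ℕ-+ x m m′) (≈-trans (·-cong (≈-sym (^ℤ-difference s n p)) (≈-sym (^ℤ-difference t n′ p′)))
    (≈-trans (solve 4 (λ a b c d → (a :* b) :* (c :* d) := (b :* d) :* (a :* c)) ≈-refl
       (x ^ℤ s) (x ^ℕ n) (x ^ℤ t) (x ^ℕ n′))
     (·-cong (≈-sym (^ℕ-+ x n n′)) ≈-refl))))))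
    where
    sum≡ : s ℤ.+ t ℤ.+ + (n + n′) ≡ + (m + m′)
    sum≡ = trans (regroup s t (+ n) (+ n′)) (cong₂ ℤ._+_ p p′)
      where
      regroup : ∀ s t u v → s ℤ.+ t ℤ.+ (u ℤ.+ v) ≡ (s ℤ.+ u) ℤ.+ (t ℤ.+ v)
      regroup = ℤSolver.solve-∀

Endo-^ℤ : ∀ {h} → Endo h → ∀ {x} → x 0 ≡ 1ℤ → ∀ t → h (x ^ℤ t) ≈ h x ^ℤ t
Endo-^ℤ E {x} x₀≡1 (+ n)    = Endo.h-^ℕ E x n
Endo-^ℤ E {x} x₀≡1 -[1+ n ] = ≈-trans (Endo.h-^ℕ E (inv x) (suc n)) (^ℕ-cong (Endo.h-inv E x₀≡1) (suc n))

-- Eta quotients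

-- Made total by the value 1 at index 0, so that the entries of an `Eta` list need not carry a proof
-- of being nonzero.
η : ℕ → Series
η zero    = 𝟙
η (suc j) = f (suc j)

η-unit₀ : ∀ j → η j 0 ≡ 1ℤ
η-unit₀ zero    = refl
η-unit₀ (suc j) = refl

-- The entry (j , t) stands for the factor f_j^t.
Eta : Set
Eta = List (ℕ × ℤ)

⟦_⟧ : Eta → Series
⟦ [] ⟧           = 𝟙
⟦ (j , t) ∷ L ⟧ = η j ^ℤ t · ⟦ L ⟧

⟦⟧-unit₀ : ∀ L → ⟦ L ⟧ 0 ≡ 1ℤ
⟦⟧-unit₀ []            = refl
⟦⟧-unit₀ ((j , t) ∷ L) = ·-unit₀ (^ℤ-unit₀ (η-unit₀ j) t) (⟦⟧-unit₀ L)

⟦⟧-++ : ∀ L M → ⟦ L ++ M ⟧ ≈ ⟦ L ⟧ · ⟦ M ⟧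
⟦⟧-++ []            M = ≈-sym (R.*-identityˡ ⟦ M ⟧)
⟦⟧-++ ((j , t) ∷ L) M = ≈-trans (·-cong ≈-refl (⟦⟧-++ L M)) (≈-sym (R.*-assoc (η j ^ℤ t) ⟦ L ⟧ ⟦ M ⟧))

insert : ℕ → ℤ → Eta → Eta
insert j t [] = (j , t) ∷ []
insert j t ((k , s) ∷ L) with ℕₚ.<-cmp j k
... | tri< _ _ _ = (j , t) ∷ (k , s) ∷ L
... | tri≈ _ _ _ = (k , t ℤ.+ s) ∷ L
... | tri> _ _ _ = (k , s) ∷ insert j t L

sortEta : Eta → Eta
sortEta []            = []
sortEta ((j , t) ∷ L) = insert j t (sortEta L)

dropZeros : Eta → Eta
dropZeros []                  = []
dropZeros ((j , + 0) ∷ L)     = dropZeros L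
dropZeros ((j , + suc t) ∷ L) = (j , + suc t) ∷ dropZeros L
dropZeros ((j , -[1+ t ]) ∷ L) = (j , -[1+ t ]) ∷ dropZeros L

insert-⟦⟧ : ∀ j t L → ⟦ insert j t L ⟧ ≈ η j ^ℤ t · ⟦ L ⟧
insert-⟦⟧ j t [] = ≈-refl
insert-⟦⟧ j t ((k , s) ∷ L) with ℕₚ.<-cmp j k
... | tri< _ _ _    = ≈-refl
... | tri≈ _ refl _ = ≈-trans (·-cong (^ℤ-+ (η-unit₀ j) t s) ≈-refl)
  (R.*-assoc (η j ^ℤ t) (η j ^ℤ s) ⟦ L ⟧)
... | tri> _ _ _    = ≈-trans (·-cong ≈-refl (insert-⟦⟧ j t L))
  (solve 3 (λ a b c → a :* (b :* c) := b :* (a :* c)) ≈-refl (η k ^ℤ s) (η j ^ℤ t) ⟦ L ⟧)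

sortEta-⟦⟧ : ∀ L → ⟦ sortEta L ⟧ ≈ ⟦ L ⟧
sortEta-⟦⟧ []            = ≈-refl
sortEta-⟦⟧ ((j , t) ∷ L) = ≈-trans (insert-⟦⟧ j t (sortEta L)) (·-cong ≈-refl (sortEta-⟦⟧ L))

dropZeros-⟦⟧ : ∀ L → ⟦ dropZeros L ⟧ ≈ ⟦ L ⟧
dropZeros-⟦⟧ []                   = ≈-refl
dropZeros-⟦⟧ ((j , + 0) ∷ L)      = ≈-trans (dropZeros-⟦⟧ L) (≈-sym (R.*-identityˡ ⟦ L ⟧))
dropZeros-⟦⟧ ((j , + suc t) ∷ L)  = ·-cong ≈-refl (dropZeros-⟦⟧ L)
dropZeros-⟦⟧ ((j , -[1+ t ]) ∷ L) = ·-cong ≈-refl (dropZeros-⟦⟧ L)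

normalise : Eta → Eta
normalise L = dropZeros (sortEta L)

normalise-⟦⟧ : ∀ L → ⟦ normalise L ⟧ ≈ ⟦ L ⟧
normalise-⟦⟧ L = ≈-trans (dropZeros-⟦⟧ (sortEta L)) (sortEta-⟦⟧ L)

-- Sorting by index, merging exponents and dropping zeros gives a normal form, so identities between
-- concrete eta quotients are settled by `refl`.
eta-≡ : ∀ L M → normalise L ≡ normalise M → ⟦ L ⟧ ≈ ⟦ M ⟧
eta-≡ L M eq = ≈-trans (≈-sym (normalise-⟦⟧ L))
  (subst (λ K → ⟦ K ⟧ ≈ ⟦ M ⟧) (sym eq) (normalise-⟦⟧ M))

negate : Eta → Eta
negate []            = []
negate ((j , t) ∷ L) = (j , ℤ.- t) ∷ negate L

⟦⟧-negate : ∀ L → ⟦ L ⟧ · ⟦ negate L ⟧ ≈ 𝟙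
⟦⟧-negate []            = R.*-identityˡ 𝟙
⟦⟧-negate ((j , t) ∷ L) = ≈-trans
  (solve 4 (λ a b c d → (a :* b) :* (c :* d) := (a :* c) :* (b :* d)) ≈-refl
    (η j ^ℤ t) ⟦ L ⟧ (η j ^ℤ (ℤ.- t)) ⟦ negate L ⟧)
  (≈-trans (·-cong (≈-trans (≈-sym (^ℤ-+ (η-unit₀ j) t (ℤ.- t)))
    (subst (λ s → η j ^ℤ s ≈ 𝟙) (sym (ℤₚ.+-inverseʳ t)) ≈-refl)) (⟦⟧-negate L)) (R.*-identityˡ 𝟙))

·⟦⟧-transpose : ∀ {x y} L → x · ⟦ L ⟧ ≈ y → x ≈ y · ⟦ negate L ⟧
·⟦⟧-transpose {x} {y} L p = ≈-trans (≈-sym (R.*-identityʳ x)) (≈-trans (·-cong ≈-refl (≈-sym (⟦⟧-negate L)))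
  (≈-trans (≈-sym (R.*-assoc x ⟦ L ⟧ ⟦ negate L ⟧)) (·-cong p ≈-refl)))

repeatEta : ℕ → Eta → Eta
repeatEta zero    L = []
repeatEta (suc n) L = L ++ repeatEta n L

powerEta : Eta → ℤ → Eta
powerEta L (+ n)    = repeatEta n L
powerEta L -[1+ n ] = repeatEta (suc n) (negate L)

repeatEta-⟦⟧ : ∀ n L → ⟦ repeatEta n L ⟧ ≈ ⟦ L ⟧ ^ℕ n
repeatEta-⟦⟧ zero    L = ≈-refl
repeatEta-⟦⟧ (suc n) L = ≈-trans (⟦⟧-++ L (repeatEta n L))
  (≈-trans (·-cong ≈-refl (repeatEta-⟦⟧ n L)) (≈-sym (^ℕ-suc ⟦ L ⟧ n)))

powerEta-⟦⟧ : ∀ L t → ⟦ powerEta L t ⟧ ≈ ⟦ L ⟧ ^ℤ t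
powerEta-⟦⟧ L (+ n)    = repeatEta-⟦⟧ n L
powerEta-⟦⟧ L -[1+ n ] = ≈-trans (repeatEta-⟦⟧ (suc n) (negate L)) (^ℕ-cong
  (·-cancelˡ (⟦⟧-unit₀ L) (≈-trans (⟦⟧-negate L) (≈-sym (x·inv (⟦⟧-unit₀ L))))) (suc n))

substEta : (ℕ → Eta) → Eta → Eta
substEta g []            = []
substEta g ((j , t) ∷ L) = powerEta (g j) t ++ substEta g L

Endo-⟦⟧ : ∀ {h} → Endo h → ∀ g L → All (λ { (j , _) → h (η j) ≈ ⟦ g j ⟧ }) L → h ⟦ L ⟧ ≈ ⟦ substEta g L ⟧
Endo-⟦⟧ E g [] All.[]   = Endo.h-𝟙 E
Endo-⟦⟧ {h} E g ((j , t) ∷ L) (p All.∷ ps) = ≈-trans (≈-sym (Endo.h-· E (η j ^ℤ t) ⟦ L ⟧))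
  (≈-trans (·-cong (≈-trans (Endo-^ℤ E (η-unit₀ j) t)
    (≈-trans (^ℤ-cong (trans (Endo.h-0 E (η j)) (η-unit₀ j)) p t) (≈-sym (powerEta-⟦⟧ (g j) t))))
    (Endo-⟦⟧ E g L ps)) (≈-sym (⟦⟧-++ (powerEta (g j) t) (substEta g L))))

-- Product formulas for f_j and for (-q^s; q^k)_∞

f-∏ : ∀ j .{{_ : NonZero j}} → f j ≈ ∏ (λ i → 𝟙 ⊖ q^ (j * suc i))
f-∏ j = mk≈ λ n → coeff (products n) n
  where
  products : ∀ N → partialProduct j N ≈ partial (λ i → 𝟙 ⊖ q^ (j * suc i)) N
  products zero    = ≈-refl
  products (suc N) = ≈-trans (≈-sym (·-⊛ (partialProduct j N) (𝟙 ⊖ q^ (j * suc N)))) (·-cong (products N) ≈-refl)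

⊖-∔ : ∀ x y → x ⊖ y ≈ x ∔ ⊝ y
⊖-∔ x y = mk≈ λ n → sym (∔-coeff x (⊝ y) n)

𝟙⊖q^-cong : ∀ {m n} → m ≡ n → 𝟙 ⊖ q^ m ≈ 𝟙 ⊖ q^ n
𝟙⊖q^-cong refl = ≈-refl

𝟙∔q^-cong : ∀ {m n} → m ≡ n → 𝟙 ∔ q^ m ≈ 𝟙 ∔ q^ n
𝟙∔q^-cong refl = ≈-refl

𝟙⊖q^≈[]𝟙 : ∀ {m N} → N ℕ.≤ m → 𝟙 ⊖ q^ m ≈[ N ] 𝟙
𝟙⊖q^≈[]𝟙 {m} N≤m = mk≈[] λ {n} n<N →
  trans (cong (λ c → 𝟙 n ℤ.- c) (below (q^≈[]𝟘 N≤m) n<N)) (ℤₚ.+-identityʳ (𝟙 n))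

𝟙∔q^≈[]𝟙 : ∀ {m N} → N ℕ.≤ m → 𝟙 ∔ q^ m ≈[ N ] 𝟙
𝟙∔q^≈[]𝟙 {m} N≤m = mk≈[] λ {n} n<N → trans (∔-coeff 𝟙 (q^ m) n)
  (trans (cong (λ c → 𝟙 n ℤ.+ c) (below (q^≈[]𝟘 N≤m) n<N)) (ℤₚ.+-identityʳ (𝟙 n)))

f-conv : ∀ j .{{_ : NonZero j}} → Conv (λ i → 𝟙 ⊖ q^ (j * suc i))
f-conv j i = 𝟙⊖q^≈[]𝟙 (ℕₚ.m≤n*m (suc i) j)

D-𝟙⊖q^ : ∀ k .{{_ : NonZero k}} m → D k (𝟙 ⊖ q^ m) ≈ 𝟙 ⊖ q^ (m * k)
D-𝟙⊖q^ k m = D-unique k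
  (λ n → cong₂ ℤ._-_ (at 0 n) (at m n))
  (λ ¬k∣n → cong₂ ℤ._-_ (trans (sym (coeff (D-q^ k 0) _)) (D-off k 𝟙 ¬k∣n))
                          (trans (sym (coeff (D-q^ k m) _)) (D-off k (q^ m) ¬k∣n)))
  where
  at : ∀ m n → (q^ (m * k)) (n * k) ≡ (q^ m) n
  at m n = trans (sym (coeff (D-q^ k m) (n * k))) (D-* k (q^ m) n)

D-𝟙∔q^ : ∀ k .{{_ : NonZero k}} m → D k (𝟙 ∔ q^ m) ≈ 𝟙 ∔ q^ (m * k)
D-𝟙∔q^ k m = ≈-trans (D-∔ k 𝟙 (q^ m)) (∔-cong (D-q^ k 0) (D-q^ k m))

D-η : ∀ k .{{_ : NonZero k}} j → D k (η j) ≈ η (j * k)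
D-η k         zero    = D-q^ k 0
D-η k@(suc _) (suc j) = ≈-trans (D-cong k (f-∏ (suc j))) (≈-trans (D-∏ k _ (f-conv (suc j)))
  (≈-trans (∏-cong λ i → ≈-trans (D-𝟙⊖q^ k (suc j * suc i)) (𝟙⊖q^-cong (reorder (suc j) (suc i) k)))
    (≈-sym (f-∏ (suc j * k)))))
  where
  reorder : ∀ a b c → a * b * c ≡ a * c * b
  reorder = ℕSolver.solve-∀

⟦⟧-single : ∀ j → η j ≈ ⟦ (j , 1ℤ) ∷ [] ⟧
⟦⟧-single j = ≈-sym (≈-trans (R.*-identityʳ _) (≈-trans (^ℕ-suc (η j) 0) (R.*-identityʳ (η j))))

dilate : ℕ → Eta → Eta
dilate k = substEta (λ j → (j * k , 1ℤ) ∷ [])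

D-⟦⟧ : ∀ k .{{_ : NonZero k}} L → D k ⟦ L ⟧ ≈ ⟦ dilate k L ⟧
D-⟦⟧ k L = Endo-⟦⟧ (D-endo k) (λ j → (j * k , 1ℤ) ∷ []) L
  (All.universal (λ { (j , _) → ≈-trans (D-η k j) (⟦⟧-single (j * k)) }) L)

-- (-q^s; q^k)_∞
Pos : ℕ → ℕ → Series
Pos s k = ∏ (λ i → 𝟙 ∔ q^ (s + i * k))

Pos-conv : ∀ s k .{{_ : NonZero s}} .{{_ : NonZero k}} → Conv (λ i → 𝟙 ∔ q^ (s + i * k))
Pos-conv s k i = 𝟙∔q^≈[]𝟙 (ℕₚ.+-mono-≤ (ℕ.>-nonZero⁻¹ s) (ℕₚ.m≤m*n i k))

D-Pos : ∀ k .{{_ : NonZero k}} s j .{{_ : NonZero s}} .{{_ : NonZero j}} → D k (Pos s j) ≈ Pos (s * k) (j * k)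
D-Pos k s j = ≈-trans (D-∏ k _ (Pos-conv s j)) (∏-cong λ i → ≈-trans (D-𝟙∔q^ k (s + i * j)) (𝟙∔q^-cong (expand s i j k)))
  where
  expand : ∀ s i j k → (s + i * j) * k ≡ s * k + i * (j * k)
  expand = ℕSolver.solve-∀

partial-conv : ∀ (g : ℕ → ℕ → Series) → (∀ r → Conv (g r)) → ∀ m → Conv (λ i → partial (λ r → g r i) m)
partial-conv g conv zero    i = ≈⇒≈[] ≈-refl
partial-conv g conv (suc m) i = ≈[]-trans (·-cong[] (partial-conv g conv m i) (conv m i)) (≈⇒≈[] (R.*-identityˡ 𝟙))

∏-𝟙 : ∏ (λ _ → 𝟙) ≈ 𝟙
∏-𝟙 = mk≈ λ n → coeff (go n) n
  where
  go : ∀ N → partial (λ _ → 𝟙) N ≈ 𝟙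
  go zero    = ≈-refl
  go (suc N) = ≈-trans (R.*-identityʳ _) (go N)

∏-partial-swap : ∀ (g : ℕ → ℕ → Series) → (∀ r → Conv (g r)) → ∀ m →
                 ∏ (λ i → partial (λ r → g r i) m) ≈ partial (λ r → ∏ (g r)) m
∏-partial-swap g conv zero    = ∏-𝟙
∏-partial-swap g conv (suc m) = ≈-trans (≈-sym (∏-· (partial-conv g conv m) (conv m)))
  (·-cong (∏-partial-swap g conv m) ≈-refl)

-- The factors are sorted by the residue `r` of their index modulo `m`.
Pos-split : ∀ s k .{{_ : NonZero s}} .{{_ : NonZero k}} m .{{_ : NonZero m}} →
            Pos s k ≈ partial (λ r → Pos (s + r * k) (m * k)) m
Pos-split s@(suc _) k m = ≈-trans (∏-blocks _ m (Pos-conv s k))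
  (≈-trans (∏-cong λ i → partial-cong (λ r → 𝟙∔q^-cong (expand s i r k m)) m)
    (∏-partial-swap (λ r i → 𝟙 ∔ q^ (s + r * k + i * (m * k))) (λ r → Pos-conv (s + r * k) (m * k) {{_}} {{ℕₚ.m*n≢0 m k}}) m))
  where
  expand : ∀ s i r k m → s + (i * m + r) * k ≡ s + r * k + i * (m * k)
  expand = ℕSolver.solve-∀

-- Factor by factor this is (1 + q^i)(1 - q^i) = 1 - q^(2i).
Pos₁₁-η : Pos 1 1 · η 1 ≈ η 2
Pos₁₁-η = ≈-trans (·-cong (≈-refl {Pos 1 1}) (f-∏ 1)) (≈-trans (∏-· (Pos-conv 1 1) (f-conv 1))
  (≈-trans (∏-cong factor) (≈-sym (f-∏ 2))))
  where
  difference-of-squares : ∀ m → (𝟙 ∔ q^ m) · (𝟙 ⊖ q^ m) ≈ 𝟙 ⊖ q^ (m + m)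
  difference-of-squares m = ≈-trans (·-cong ≈-refl (⊖-∔ 𝟙 (q^ m)))
    (≈-trans (solve 1 (λ x → (con 1ℤ :+ x) :* (con 1ℤ :+ :- x) := con 1ℤ :+ :- (x :* x)) ≈-refl (q^ m))
    (≈-trans (∔-cong ≈-refl (R.-‿cong (q^-+ m m))) (≈-sym (⊖-∔ 𝟙 (q^ (m + m))))))
  factor : ∀ i → (𝟙 ∔ q^ (1 + i * 1)) · (𝟙 ⊖ q^ (1 * suc i)) ≈ 𝟙 ⊖ q^ (2 * suc i)
  factor i = ≈-trans (·-cong (𝟙∔q^-cong (e₁ i)) (𝟙⊖q^-cong (e₂ i)))
    (≈-trans (difference-of-squares (suc i)) (𝟙⊖q^-cong (e₃ i)))
    where
    e₁ : ∀ i → 1 + i * 1 ≡ suc i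
    e₁ = ℕSolver.solve-∀
    e₂ : ∀ i → 1 * suc i ≡ suc i
    e₂ = ℕSolver.solve-∀
    e₃ : ∀ i → suc i + suc i ≡ 2 * suc i
    e₃ = ℕSolver.solve-∀

Pos₁₁ : Pos 1 1 ≈ ⟦ (1 , ℤ.- 1ℤ) ∷ (2 , 1ℤ) ∷ [] ⟧
Pos₁₁ = ≈-trans (·⟦⟧-transpose ((1 , 1ℤ) ∷ []) (≈-trans (·-cong (≈-refl {Pos 1 1}) (≈-sym (⟦⟧-single 1)))
  (≈-trans Pos₁₁-η (⟦⟧-single 2)))) (≈-trans (≈-sym (⟦⟧-++ ((2 , 1ℤ) ∷ []) ((1 , ℤ.- 1ℤ) ∷ [])))
  (eta-≡ ((2 , 1ℤ) ∷ (1 , ℤ.- 1ℤ) ∷ []) ((1 , ℤ.- 1ℤ) ∷ (2 , 1ℤ) ∷ []) refl))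

-- Used to isolate an unknown factor of a product when the whole and the remaining factor are known
-- eta quotients.
solveFor : ∀ {x y z} L M → z ≈ y · x → y ≈ ⟦ L ⟧ → z ≈ ⟦ M ⟧ → x ≈ ⟦ normalise (M ++ negate L) ⟧
solveFor {x} {y} {z} L M z≈yx y≈ z≈ = ≈-trans
  (·⟦⟧-transpose L (≈-trans (R.*-comm x ⟦ L ⟧) (≈-trans (·-cong (≈-sym y≈) ≈-refl) (≈-trans (≈-sym z≈yx) z≈))))
  (≈-trans (≈-sym (⟦⟧-++ M (negate L))) (≈-sym (normalise-⟦⟧ (M ++ negate L))))

D-Pos-η : ∀ k .{{_ : NonZero k}} s j .{{_ : NonZero s}} .{{_ : NonZero j}} {L} → Pos s j ≈ ⟦ L ⟧ →
          Pos (s * k) (j * k) ≈ ⟦ dilate k L ⟧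
D-Pos-η k s j {L} p = ≈-trans (≈-sym (D-Pos k s j)) (≈-trans (D-cong k p) (D-⟦⟧ k L))

-- Among the factors of `Pos 1 1`, those with even exponent form `Pos 2 2`, which is `Pos 1 1` at
-- q²; the odd ones remain.
Pos₁₂ : Pos 1 2 ≈ ⟦ (1 , ℤ.- 1ℤ) ∷ (2 , + 2) ∷ (4 , ℤ.- 1ℤ) ∷ [] ⟧
Pos₁₂ = solveFor (dilate 2 ((1 , ℤ.- 1ℤ) ∷ (2 , 1ℤ) ∷ [])) ((1 , ℤ.- 1ℤ) ∷ (2 , 1ℤ) ∷ [])
  (≈-trans (Pos-split 1 1 2) (solve 2 (λ a b → (con 1ℤ :* a) :* b := b :* a) ≈-refl (Pos 1 2) (Pos 2 2)))
  (D-Pos-η 2 1 1 {(1 , ℤ.- 1ℤ) ∷ (2 , 1ℤ) ∷ []} Pos₁₁) Pos₁₁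

-- Ramanujan's theta function f(q^s, q^s′).
theta : ℕ → ℕ → Series
theta s s′ = Pos s (s + s′) · Pos s′ (s + s′) · η (s + s′)

product-⟦⟧ : ∀ {x y} L M → x ≈ ⟦ L ⟧ → y ≈ ⟦ M ⟧ → x · y ≈ ⟦ normalise (L ++ M) ⟧
product-⟦⟧ L M p q = ≈-trans (·-cong p q) (≈-trans (≈-sym (⟦⟧-++ L M))
  (≈-sym (normalise-⟦⟧ (L ++ M))))

φ-η : theta 1 1 ≈ ⟦ (1 , ℤ.- + 2) ∷ (2 , + 5) ∷ (4 , ℤ.- + 2) ∷ [] ⟧
φ-η = product-⟦⟧ (normalise (L ++ L)) ((2 , 1ℤ) ∷ []) (product-⟦⟧ L L Pos₁₂ Pos₁₂) (⟦⟧-single 2)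
  where
  L : Eta
  L = (1 , ℤ.- 1ℤ) ∷ (2 , + 2) ∷ (4 , ℤ.- 1ℤ) ∷ []

ψ-η : theta 1 3 ≈ ⟦ (1 , ℤ.- 1ℤ) ∷ (2 , + 2) ∷ [] ⟧
ψ-η = product-⟦⟧ ((1 , ℤ.- 1ℤ) ∷ (2 , + 2) ∷ (4 , ℤ.- 1ℤ) ∷ []) ((4 , 1ℤ) ∷ [])
  (≈-trans (≈-sym (≈-trans (Pos-split 1 2 2)
    (solve 2 (λ a b → (con 1ℤ :* a) :* b := a :* b) ≈-refl (Pos 1 4) (Pos 3 4)))) Pos₁₂)
  (⟦⟧-single 4)

-- `Pos 1 3 · Pos 2 3` is `Pos 1 1` without the factors whose exponent is a multiple of 3, and these
-- form `Pos 1 1` at q³.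
θ₁₂-η : theta 1 2 ≈ ⟦ (1 , ℤ.- 1ℤ) ∷ (2 , 1ℤ) ∷ (3 , + 2) ∷ (6 , ℤ.- 1ℤ) ∷ [] ⟧
θ₁₂-η = product-⟦⟧ (normalise (L ++ negate (dilate 3 L))) ((3 , 1ℤ) ∷ [])
  (solveFor (dilate 3 ((1 , ℤ.- 1ℤ) ∷ (2 , 1ℤ) ∷ [])) ((1 , ℤ.- 1ℤ) ∷ (2 , 1ℤ) ∷ [])
    (≈-trans (Pos-split 1 1 3) (solve 3 (λ a b c → ((con 1ℤ :* a) :* b) :* c := c :* (a :* b)) ≈-refl
      (Pos 1 3) (Pos 2 3) (Pos 3 3)))
    (D-Pos-η 3 1 1 {(1 , ℤ.- 1ℤ) ∷ (2 , 1ℤ) ∷ []} Pos₁₁) Pos₁₁)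
  (⟦⟧-single 3)
  where
  L : Eta
  L = (1 , ℤ.- 1ℤ) ∷ (2 , 1ℤ) ∷ []

-- The residues 1 and 5 modulo 6 are the odd ones prime to 3, so `Pos 1 2` is divided by its own
-- image at q³.
θ₁₅-η : theta 1 5 ≈ ⟦ (1 , ℤ.- 1ℤ) ∷ (2 , + 2) ∷ (3 , 1ℤ) ∷ (4 , ℤ.- 1ℤ) ∷ (6 , ℤ.- 1ℤ) ∷ (12 , 1ℤ) ∷ [] ⟧
θ₁₅-η = product-⟦⟧ (normalise (L ++ negate (dilate 3 L))) ((6 , 1ℤ) ∷ [])
  (solveFor (dilate 3 L) L
    (≈-trans (Pos-split 1 2 3) (solve 3 (λ a b c → ((con 1ℤ :* a) :* b) :* c := b :* (a :* c)) ≈-refl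
      (Pos 1 6) (Pos 3 6) (Pos 5 6)))
    (D-Pos-η 3 1 2 {L} Pos₁₂) Pos₁₂)
  (⟦⟧-single 6)
  where
  L : Eta
  L = (1 , ℤ.- 1ℤ) ∷ (2 , + 2) ∷ (4 , ℤ.- 1ℤ) ∷ []

-- Eta quotients under the substitution of -q for q

σ-𝟙⊖q^ : ∀ m n → σ (𝟙 ⊖ q^ m) n ≡ 𝟙 n ℤ.- sgn m ℤ.* (q^ m) n
σ-𝟙⊖q^ m n = trans (σ-coeff (𝟙 ⊖ q^ m) n) (trans (distrib (sgn n) (𝟙 n) ((q^ m) n))
  (cong₂ ℤ._-_ (trans (sym (σ-coeff 𝟙 n)) (coeff σ-𝟙 n))
    (trans (sym (σ-coeff (q^ m) n)) (trans (coeff (σ-q^ m) n) (scale-coeff (sgn m) (q^ m) n)))))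
  where
  distrib : ∀ a b c → a ℤ.* (b ℤ.- c) ≡ a ℤ.* b ℤ.- a ℤ.* c
  distrib = ℤSolver.solve-∀

σ-𝟙⊖q^-even : ∀ {m} → sgn m ≡ 1ℤ → σ (𝟙 ⊖ q^ m) ≈ 𝟙 ⊖ q^ m
σ-𝟙⊖q^-even {m} even = mk≈ λ n → trans (σ-𝟙⊖q^ m n)
  (cong (λ c → 𝟙 n ℤ.- c) (trans (cong (ℤ._* (q^ m) n) even) (ℤₚ.*-identityˡ _)))

σ-𝟙⊖q^-odd : ∀ {m} → sgn m ≡ ℤ.- 1ℤ → σ (𝟙 ⊖ q^ m) ≈ 𝟙 ∔ q^ m
σ-𝟙⊖q^-odd {m} odd = mk≈ λ n → trans (σ-𝟙⊖q^ m n) (trans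
  (cong (λ c → 𝟙 n ℤ.- c ℤ.* (q^ m) n) odd)
  (trans (double-negation (𝟙 n) ((q^ m) n)) (sym (∔-coeff 𝟙 (q^ m) n))))
  where
  double-negation : ∀ a b → a ℤ.- (ℤ.- 1ℤ ℤ.* b) ≡ a ℤ.+ b
  double-negation = ℤSolver.solve-∀

sgn-*2 : ∀ n → sgn (n * 2) ≡ 1ℤ
sgn-*2 zero    = refl
sgn-*2 (suc n) = trans (ℤₚ.neg-involutive (sgn (n * 2))) (sgn-*2 n)

-- The factors 1 - q^i with i odd turn into 1 + q^i and those with i even stay. Pairing consecutive
-- factors therefore gives `Pos 1 2 · η 2`.
σ-η₁ : σ (η 1) ≈ ⟦ (1 , ℤ.- 1ℤ) ∷ (2 , + 3) ∷ (4 , ℤ.- 1ℤ) ∷ [] ⟧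
σ-η₁ = ≈-trans (σ-cong (f-∏ 1)) (≈-trans (σ-∏ (λ i → 𝟙 ⊖ q^ (1 * suc i)))
  (≈-trans (∏-blocks _ 2 conv) (≈-trans (∏-cong block)
  (≈-trans (≈-sym (∏-· (Pos-conv 1 2) (f-conv 2))) (≈-trans (·-cong (≈-refl {Pos 1 2}) (≈-sym (f-∏ 2)))
  (product-⟦⟧ ((1 , ℤ.- 1ℤ) ∷ (2 , + 2) ∷ (4 , ℤ.- 1ℤ) ∷ []) ((2 , 1ℤ) ∷ []) Pos₁₂ (⟦⟧-single 2)))))))
  where
  conv : Conv (λ i → σ (𝟙 ⊖ q^ (1 * suc i)))
  conv i = mk≈[] λ {n} n<1+i → trans (σ-coeff (𝟙 ⊖ q^ (1 * suc i)) n) (trans (cong (sgn n ℤ.*_) (below (f-conv 1 i) n<1+i))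
    (trans (sym (σ-coeff 𝟙 n)) (coeff σ-𝟙 n)))
  block : ∀ i → partial (λ r → σ (𝟙 ⊖ q^ (1 * suc (i * 2 + r)))) 2 ≈ (𝟙 ∔ q^ (1 + i * 2)) · (𝟙 ⊖ q^ (2 * suc i))
  block i = ·-cong (≈-trans (R.*-identityˡ _) (≈-trans (σ-cong (𝟙⊖q^-cong (e₁ i)))
      (σ-𝟙⊖q^-odd (cong ℤ.-_ (sgn-*2 i)))))
    (≈-trans (σ-cong (𝟙⊖q^-cong (e₂ i))) (≈-trans (σ-𝟙⊖q^-even (sgn-*2 (suc i))) (𝟙⊖q^-cong (ℕₚ.*-comm (suc i) 2))))
    where
    e₁ : ∀ i → 1 * suc (i * 2 + 0) ≡ 1 + i * 2
    e₁ = ℕSolver.solve-∀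
    e₂ : ∀ i → 1 * suc (i * 2 + 1) ≡ suc i * 2
    e₂ = ℕSolver.solve-∀

σ-D : ∀ k .{{_ : NonZero k}} x {y} → (∀ n → sgn (n * k) ℤ.* x n ≡ y n) → σ (D k x) ≈ D k y
σ-D k x p = ≈-sym (D-unique k
  (λ n → trans (σ-coeff (D k x) (n * k)) (trans (cong (sgn (n * k) ℤ.*_) (D-* k x n)) (p n)))
  (λ {n} ¬k∣n → trans (σ-coeff (D k x) n) (trans (cong (sgn n ℤ.*_) (D-off k x ¬k∣n)) (ℤₚ.*-zeroʳ (sgn n)))))

σ-η-even : ∀ j → σ (η (j * 2)) ≈ η (j * 2)
σ-η-even j = ≈-trans (σ-cong (≈-sym (D-η 2 j))) (≈-trans
  (σ-D 2 (η j) {η j} λ n → trans (cong (ℤ._* η j n) (sgn-*2 n)) (ℤₚ.*-identityˡ _)) (D-η 2 j))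

-- Since 3n and n have the same parity, the sign change commutes with q ↦ q³, and the case of `η 1`
-- applies.
σ-η₃ : σ (η 3) ≈ ⟦ (3 , ℤ.- 1ℤ) ∷ (6 , + 3) ∷ (12 , ℤ.- 1ℤ) ∷ [] ⟧
σ-η₃ = ≈-trans (σ-cong (≈-sym (D-η 3 1))) (≈-trans
  (σ-D 3 (η 1) {σ (η 1)} λ n → trans (cong (ℤ._* η 1 n) (sgn-*3 n)) (sym (σ-coeff (η 1) n)))
  (≈-trans (D-cong 3 σ-η₁) (≈-trans (D-⟦⟧ 3 L) (eta-≡ (dilate 3 L) ((3 , ℤ.- 1ℤ) ∷ (6 , + 3) ∷ (12 , ℤ.- 1ℤ) ∷ []) refl))))
  where
  L : Eta
  L = (1 , ℤ.- 1ℤ) ∷ (2 , + 3) ∷ (4 , ℤ.- 1ℤ) ∷ []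
  sgn-*3 : ∀ n → sgn (n * 3) ≡ sgn n
  sgn-*3 zero    = refl
  sgn-*3 (suc n) = cong ℤ.-_ (trans (ℤₚ.neg-involutive (sgn (n * 3))) (sgn-*3 n))

-- The images of the f_j under q ↦ -q. The last clause is meant for even `j`, where f_j is a series
-- in q² and hence fixed.
conjugate : ℕ → Eta
conjugate 1 = (1 , ℤ.- 1ℤ) ∷ (2 , + 3) ∷ (4 , ℤ.- 1ℤ) ∷ []
conjugate 3 = (3 , ℤ.- 1ℤ) ∷ (6 , + 3) ∷ (12 , ℤ.- 1ℤ) ∷ []
conjugate j = (j , 1ℤ) ∷ []

σ-⟦⟧ : ∀ t₁ t₂ t₃ t₄ → let L = (1 , t₁) ∷ (2 , t₂) ∷ (3 , t₃) ∷ (4 , t₄) ∷ [] in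
       σ ⟦ L ⟧ ≈ ⟦ substEta conjugate L ⟧
σ-⟦⟧ t₁ t₂ t₃ t₄ = Endo-⟦⟧ σ-endo conjugate ((1 , t₁) ∷ (2 , t₂) ∷ (3 , t₃) ∷ (4 , t₄) ∷ [])
  (σ-η₁ All.∷ ≈-trans (σ-η-even 1) (⟦⟧-single 2) All.∷ σ-η₃ All.∷ ≈-trans (σ-η-even 2) (⟦⟧-single 4) All.∷ All.[])

-- Generating functions of families with finite fibres

infixr 5 _∘↔_

_∘↔_ : ∀ {A B C : Set} → B ↔ C → A ↔ B → A ↔ C
_∘↔_ = _↔-∘_

Fibre : {I : Set} → (I → ℕ) → ℕ → Set
Fibre {I} e n = Σ[ i ∈ I ] e i ≡ n

Fibre-≡ : ∀ {I : Set} {e : I → ℕ} {n} {u v : Fibre e n} → proj₁ u ≡ proj₁ v → u ≡ v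
Fibre-≡ {u = i , p} {v = .i , q} refl = cong (i ,_) (ℕₚ.≡-irrelevant p q)

-- x is the sum of q^(e i) over all i.
GF : {I : Set} → (I → ℕ) → Series → Set
GF e x = ∀ n → ∃ λ c → x n ≡ + c × (Fibre e n ↔ Fin c)

-- The source of every theta identity below: one family of exponents, counted in two ways.
GF-unique : ∀ {I : Set} {e : I → ℕ} {x y} → GF e x → GF e y → x ≈ y
GF-unique {x = x} {y} g h = mk≈ coincide
  where
  coincide : ∀ n → x n ≡ y n
  coincide n with g n | h n
  ... | c , x≡ , i | d , y≡ , j =
    trans x≡ (trans (cong +_ (Permutation.↔⇒≡ (j ∘↔ ↔-sym i))) (sym y≡))

GF-≈ : ∀ {I : Set} {e : I → ℕ} {x y} → x ≈ y → GF e x → GF e y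
GF-≈ p g n with g n
... | c , x≡ , i = c , trans (sym (coeff p n)) x≡ , i

GF-reindex : ∀ {I J : Set} {e : I → ℕ} {e′ : J → ℕ} {x} (φ : J ↔ I) →
             (∀ j → e′ j ≡ e (Inverse.to φ j)) → GF e x → GF e′ x
GF-reindex {e = e} {e′} φ e′≡e g n with g n
... | c , x≡ , i = c , x≡ , i ∘↔ mk↔ₛ′
  (λ { (j , p) → to j , trans (sym (e′≡e j)) p })
  (λ { (i , p) → from i , trans (e′≡e (from i)) (trans (cong e (strictlyInverseˡ i)) p) })
  (λ { (i , p) → Fibre-≡ (strictlyInverseˡ i) })
  (λ { (j , p) → Fibre-≡ (strictlyInverseʳ j) })
  where open Inverse φ using (to; from; strictlyInverseˡ; strictlyInverseʳ)

GF-⊤ : ∀ m → GF {⊤} (λ _ → m) (q^ m)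
GF-⊤ m n with n ℕ.≟ m
... | yes refl = 1 , refl , mk↔ₛ′ (λ _ → zero) (λ _ → tt , refl) (λ { zero → refl }) (λ _ → Fibre-≡ refl)
... | no n≢m   = 0 , refl ,
  mk↔ₛ′ (λ { (_ , p) → contradiction (sym p) n≢m }) (λ ()) (λ ()) (λ { (_ , p) → contradiction (sym p) n≢m })

GF-⊎ : ∀ {I J : Set} {e : I → ℕ} {e′ : J → ℕ} {x y} → GF e x → GF e′ y → GF [ e , e′ ] (x ∔ y)
GF-⊎ {e = e} {e′} {x} {y} g h n with g n | h n
... | c , x≡ , i | d , y≡ , j = c + d , trans (∔-coeff x y n) (cong₂ ℤ._+_ x≡ y≡) ,
  ↔-sym Finₚ.+↔⊎ ∘↔ (i ⊎-↔ j) ∘↔ mk↔ₛ′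
    (λ { (inj₁ i , p) → inj₁ (i , p) ; (inj₂ j , p) → inj₂ (j , p) })
    [ (λ { (i , p) → inj₁ i , p }) , (λ { (j , p) → inj₂ j , p }) ]
    (λ { (inj₁ _) → refl ; (inj₂ _) → refl })
    (λ { (inj₁ _ , _) → refl ; (inj₂ _ , _) → refl })

total : (m : ℕ) → (Fin m → ℕ) → ℕ
total zero    c = 0
total (suc m) c = c zero + total m (c ∘ suc)

Σ-Fin↔total : ∀ m (c : Fin m → ℕ) → (Σ[ i ∈ Fin m ] Fin (c i)) ↔ Fin (total m c)
Σ-Fin↔total zero    c = mk↔ₛ′ (λ ()) (λ ()) (λ ()) (λ ())
Σ-Fin↔total (suc m) c = ↔-sym Finₚ.+↔⊎ ∘↔ (↔-id _ ⊎-↔ Σ-Fin↔total m (c ∘ suc)) ∘↔ mk↔ₛ′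
  (λ { (zero , k) → inj₁ k ; (suc i , k) → inj₂ (i , k) })
  [ (zero ,_) , (λ { (i , k) → suc i , k }) ]
  (λ { (inj₁ _) → refl ; (inj₂ _) → refl })
  (λ { (zero , _) → refl ; (suc _ , _) → refl })

sum≡+total : ∀ m (a : Fin m → ℤ) c → (∀ i → a i ≡ + c i) → Sumℤ.sum a ≡ + total m c
sum≡+total zero    a c p = refl
sum≡+total (suc m) a c p = cong₂ ℤ._+_ (p zero) (sum≡+total m (a ∘ suc) (c ∘ suc) (p ∘ suc))

-- The value `k` of the first exponent splits the fibre over `n` into products of the fibres over
-- `k` and `n ∸ k`, which is the indexing of the Cauchy product.
GF-× : ∀ {I J : Set} {e : I → ℕ} {e′ : J → ℕ} {x y} → GF e x → GF e′ y →
       GF {I × J} (λ { (i , j) → e i + e′ j }) (x · y)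
GF-× {I} {J} {e} {e′} {x} {y} g h n = total (suc n) c ,
  trans (coeff (·-⊛ x y) n) (sum≡+total (suc n) _ c λ k → trans
    (cong₂ ℤ._*_ (proj₁ (proj₂ (g (toℕ k)))) (proj₁ (proj₂ (h (n ∸ toℕ k)))))
    (sym (ℤₚ.pos-* (proj₁ (g (toℕ k))) (proj₁ (h (n ∸ toℕ k)))))) ,
  Σ-Fin↔total (suc n) c ∘↔ Σ-↔ (↔-id _) (λ {k} →
    ↔-sym Finₚ.*↔× ∘↔ (proj₂ (proj₂ (g (toℕ k))) ×-↔ proj₂ (proj₂ (h (n ∸ toℕ k))))) ∘↔ split
  where
  c : Fin (suc n) → ℕ
  c k = proj₁ (g (toℕ k)) * proj₁ (h (n ∸ toℕ k))
  Split : Set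
  Split = Σ[ k ∈ Fin (suc n) ] (Fibre e (toℕ k) × Fibre e′ (n ∸ toℕ k))
  Split-≡ : ∀ {k k′ : Fin (suc n)} {u : Fibre e (toℕ k)} {v : Fibre e′ (n ∸ toℕ k)} {u′ v′} →
            k ≡ k′ → proj₁ u ≡ proj₁ u′ → proj₁ v ≡ proj₁ v′ → _≡_ {A = Split} (k , u , v) (k′ , u′ , v′)
  Split-≡ {k} refl p q = cong (k ,_) (cong₂ _,_ (Fibre-≡ p) (Fibre-≡ q))
  split : Fibre {I × J} (λ { (i , j) → e i + e′ j }) n ↔ Split
  split = mk↔ₛ′
    (λ { ((i , j) , p) → let ei≤n = subst (e i ℕ.≤_) p (ℕₚ.m≤m+n (e i) (e′ j)) in
      fromℕ< (s≤s ei≤n) , (i , sym (Finₚ.toℕ-fromℕ< (s≤s ei≤n))) ,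
      (j , trans (sym (ℕₚ.m+n∸m≡n (e i) (e′ j))) (cong₂ _∸_ p (sym (Finₚ.toℕ-fromℕ< (s≤s ei≤n))))) })
    (λ { (k , (i , p) , (j , q)) → (i , j) ,
      trans (cong₂ _+_ p q) (ℕₚ.m+[n∸m]≡n (Finₚ.toℕ≤pred[n] k)) })
    (λ { (k , (i , p) , (j , q)) → Split-≡ (Finₚ.toℕ-injective (trans (Finₚ.toℕ-fromℕ< _) p)) refl refl })
    (λ { ((i , j) , p) → Fibre-≡ refl })

GF-D : ∀ k .{{_ : NonZero k}} {I : Set} {e : I → ℕ} {x} → GF e x → GF (λ i → e i * k) (D k x)
GF-D k {e = e} {x} g n with k ∣? n
... | no ¬k∣n = 0 , refl , mk↔ₛ′ (λ { (i , p) → contradiction (divides (e i) (sym p)) ¬k∣n })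
  (λ ()) (λ ()) (λ { (i , p) → contradiction (divides (e i) (sym p)) ¬k∣n })
... | yes (divides m refl) with g m
...   | c , x≡ , i = c , x≡ , i ∘↔ mk↔ₛ′
  (λ { (i , p) → i , ℕₚ.*-cancelʳ-≡ (e i) m k p })
  (λ { (i , p) → i , cong (_* k) p })
  (λ _ → Fibre-≡ refl) (λ _ → Fibre-≡ refl)

GF-shift : ∀ c {I : Set} {e : I → ℕ} {x} → GF e x → GF (λ i → c + e i) (q^ c · x)
GF-shift c {e = e} g = GF-reindex
  (mk↔ₛ′ (tt ,_) proj₂ (λ _ → refl) (λ _ → refl)) (λ _ → refl) (GF-× (GF-⊤ c) g)

-- Finite form of the Jacobi triple product

-- Sums over a + b = n with both indices passed on, so that neither has to be written as a truncated
-- difference.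
anti : ℕ → (ℕ → ℕ → Series) → Series
anti zero    g = g 0 0
anti (suc n) g = g (suc n) 0 ∔ anti n (λ a b → g a (suc b))

anti-cong : ∀ n {g h} → (∀ a b → a + b ≡ n → g a b ≈ h a b) → anti n g ≈ anti n h
anti-cong zero    p = p 0 0 refl
anti-cong (suc n) p = ∔-cong (p (suc n) 0 (ℕₚ.+-identityʳ (suc n)))
  (anti-cong n λ a b eq → p a (suc b) (trans (ℕₚ.+-suc a b) (cong suc eq)))

anti-cong[] : ∀ n N {g h} → (∀ a b → a + b ≡ n → g a b ≈[ N ] h a b) → anti n g ≈[ N ] anti n h
anti-cong[] zero    N p = p 0 0 refl
anti-cong[] (suc n) N p = ∔-cong[] (p (suc n) 0 (ℕₚ.+-identityʳ (suc n)))
  (anti-cong[] n N λ a b eq → p a (suc b) (trans (ℕₚ.+-suc a b) (cong suc eq)))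
  where
  ∔-cong[] : ∀ {x x′ y y′ N} → x ≈[ N ] x′ → y ≈[ N ] y′ → x ∔ y ≈[ N ] x′ ∔ y′
  ∔-cong[] {x} {x′} {y} {y′} p q = mk≈[] λ {n} n<N → trans (∔-coeff x y n)
    (trans (cong₂ ℤ._+_ (below p n<N) (below q n<N)) (sym (∔-coeff x′ y′ n)))

anti-∔ : ∀ n g h → anti n (λ a b → g a b ∔ h a b) ≈ anti n g ∔ anti n h
anti-∔ zero    g h = ≈-refl
anti-∔ (suc n) g h = ≈-trans (∔-cong ≈-refl (anti-∔ n (λ a b → g a (suc b)) (λ a b → h a (suc b))))
  (solve 4 (λ a b c d → (a :+ b) :+ (c :+ d) := (a :+ c) :+ (b :+ d)) ≈-refl
    (g (suc n) 0) (h (suc n) 0) (anti n λ a b → g a (suc b)) (anti n λ a b → h a (suc b)))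

anti-· : ∀ x n g → anti n (λ a b → x · g a b) ≈ x · anti n g
anti-· x zero    g = ≈-refl
anti-· x (suc n) g = ≈-trans (∔-cong ≈-refl (anti-· x n λ a b → g a (suc b))) (≈-sym (R.distribˡ x _ _))

shiftA : (ℕ → ℕ → Series) → ℕ → ℕ → Series
shiftA g zero    b = 𝟘
shiftA g (suc a) b = g a (suc b)

anti-shiftA : ∀ n g → g n 0 ∔ anti n (shiftA g) ≈ anti n g
anti-shiftA zero    g = R.+-identityʳ (g 0 0)
anti-shiftA (suc n) g = ∔-cong ≈-refl (≈-trans
  (∔-cong ≈-refl (anti-cong n λ { zero b _ → ≈-refl ; (suc a) b _ → ≈-refl }))
  (anti-shiftA n (λ a b → g a (suc b))))

-- A Pascal rule summed along an antidiagonal: `U` is the contribution from lowering the first index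
-- and `V` that from lowering the second. On the two edges only one of them contributes, so each
-- term of both sums occurs exactly once.
anti-pascal : ∀ n {X U V : ℕ → ℕ → Series} → (∀ a → X (suc a) 0 ≈ U a 0) → (∀ b → X 0 (suc b) ≈ V 0 b) →
              (∀ a b → X (suc a) (suc b) ≈ U a (suc b) ∔ V (suc a) b) →
              anti (suc n) X ≈ anti n U ∔ anti n V
anti-pascal n {X} {U} {V} X₀ ₀X XX = ≈-trans
  (∔-cong (X₀ n) (≈-trans (anti-cong n interior) (anti-∔ n (shiftA U) V)))
  (≈-trans (≈-sym (R.+-assoc (U n 0) _ _)) (∔-cong (anti-shiftA n U) ≈-refl))
  where
  interior : ∀ a b → a + b ≡ n → X a (suc b) ≈ shiftA U a b ∔ V a b
  interior zero    b _ = ≈-trans (₀X b) (≈-sym (R.+-identityˡ (V 0 b)))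
  interior (suc a) b _ = XX a b

module _ (k : ℕ) where

  -- H a b is the Gaussian binomial coefficient (a + b choose a) in q^k.
  H : ℕ → ℕ → Series
  H zero    b       = 𝟙
  H (suc a) zero    = 𝟙
  H (suc a) (suc b) = H a (suc b) ∔ q^ (k * suc a) · H (suc a) b

  private
    P : ℕ → Series
    P = partial (λ i → 𝟙 ⊖ q^ (k * suc i))

  -- With x = q^(k(a+1)) and y = q^(k(b+1)), the inductive step comes down to (1 - x) + x(1 - y) = 1
  -- - xy.
  H-factorial : ∀ a b → H a b · (P a · P b) ≈ P (a + b)
  H-factorial zero    b       = solve 1 (λ p → con 1ℤ :* (con 1ℤ :* p) := p) ≈-refl (P b)
  H-factorial (suc a) zero    = ≈-trans (solve 1 (λ p → con 1ℤ :* (p :* con 1ℤ) := p) ≈-refl (P (suc a)))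
    (subst (λ n → P (suc a) ≈ P n) (sym (ℕₚ.+-identityʳ (suc a))) ≈-refl)
  H-factorial (suc a) (suc b) = ≈-trans (·-cong ≈-refl (·-cong (factor a) (factor b)))
    (≈-trans (solve 6 (λ h h′ pa pb x y → (h :+ x :* h′) :* ((pa :* (con 1ℤ :+ :- x)) :* (pb :* (con 1ℤ :+ :- y)))
        := (con 1ℤ :+ :- x) :* (h :* (pa :* (pb :* (con 1ℤ :+ :- y))))
           :+ (x :* (con 1ℤ :+ :- y)) :* (h′ :* ((pa :* (con 1ℤ :+ :- x)) :* pb))) ≈-refl
      (H a (suc b)) (H (suc a) b) (P a) (P b) x y)
    (≈-trans (∔-cong (·-cong ≈-refl (≈-trans (·-cong ≈-refl (·-cong ≈-refl (≈-sym (factor b)))) left))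
                     (·-cong ≈-refl (≈-trans (·-cong ≈-refl (·-cong (≈-sym (factor a)) ≈-refl)) (H-factorial (suc a) b))))
    (≈-trans (solve 3 (λ p x y → (con 1ℤ :+ :- x) :* p :+ (x :* (con 1ℤ :+ :- y)) :* p := p :* (con 1ℤ :+ :- (x :* y)))
        ≈-refl (P (suc a + b)) x y)
    (≈-trans (·-cong ≈-refl (∔-cong ≈-refl (R.-‿cong (≈-trans (q^-+ (k * suc a) (k * suc b)) (q^-cong exponent)))))
    (≈-trans (≈-sym (factor (suc a + b)))
      (subst (λ n → P (suc n) ≈ P (suc a + suc b)) (ℕₚ.+-suc a b) ≈-refl))))))
    where
    x y : Series
    x = q^ (k * suc a)
    y = q^ (k * suc b)
    factor : ∀ n → P (suc n) ≈ P n · (𝟙 ∔ ⊝ q^ (k * suc n))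
    factor n = ·-cong ≈-refl (⊖-∔ 𝟙 (q^ (k * suc n)))
    left : H a (suc b) · (P a · P (suc b)) ≈ P (suc a + b)
    left = subst (λ n → H a (suc b) · (P a · P (suc b)) ≈ P n) (ℕₚ.+-suc a b) (H-factorial a (suc b))
    exponent : k * suc a + k * suc b ≡ k * suc (suc a + b)
    exponent = identity k a b
      where
      identity : ∀ k a b → k * suc a + k * suc b ≡ k * suc (suc a + b)
      identity = ℕSolver.solve-∀

module _ (k : ℕ) .{{k≢0 : NonZero k}} where

  private
    P : ℕ → Series
    P = partial (λ i → 𝟙 ⊖ q^ (k * suc i))

  P-unit₀ : ∀ n → P n 0 ≡ 1ℤ
  P-unit₀ n = trans (sym (∏-partial (f-conv k) {0} {n} z≤n)) refl

  -- The factorial formula is symmetric and its denominator is a unit. Symmetry turns the defining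
  -- Pascal rule into `H-pascal`, where the power of q follows `b` instead of `a`.
  H-comm : ∀ a b → H k a b ≈ H k b a
  H-comm a b = ·-cancelˡ (·-unit₀ (P-unit₀ a) (P-unit₀ b)) (≈-trans (R.*-comm _ _)
    (≈-trans (H-factorial k a b) (≈-trans (subst (λ n → P (a + b) ≈ P n) (ℕₚ.+-comm a b) ≈-refl)
    (≈-trans (≈-sym (H-factorial k b a))
      (solve 3 (λ h p p′ → h :* (p′ :* p) := (p :* p′) :* h) ≈-refl (H k b a) (P a) (P b))))))

  H-pascal : ∀ a b → H k (suc a) (suc b) ≈ H k (suc a) b ∔ q^ (k * suc b) · H k a (suc b)
  H-pascal a b = ≈-trans (H-comm (suc a) (suc b))
    (∔-cong (H-comm b (suc a)) (·-cong ≈-refl (H-comm (suc b) a)))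

  -- Quantitative form of the limit of Gaussian binomials, 1/(q^k; q^k)_∞: modulo q^(m+1) all three
  -- products in the factorial formula may be replaced by f_k.
  η·H : ∀ {m a b} → m ℕ.≤ a → m ℕ.≤ b → f k · H k a b ≈[ suc m ] 𝟙
  η·H {m} {a} {b} m≤a m≤b = ·-cancelˡ[] (f-constant k) (≈[]-trans
    (≈⇒≈[] (solve 2 (λ u h → u :* (u :* h) := h :* (u :* u)) ≈-refl (f k) (H k a b)))
    (≈[]-trans (·-cong[] (≈⇒≈[] ≈-refl) (·-cong[] (limit m≤a) (limit m≤b)))
    (≈[]-trans (≈⇒≈[] (H-factorial k a b))
    (≈[]-trans (≈[]-sym (limit (ℕₚ.≤-trans m≤a (ℕₚ.m≤m+n a b)))) (≈⇒≈[] (≈-sym (R.*-identityʳ (f k))))))))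
    where
    limit : ∀ {n} → m ℕ.≤ n → f k ≈[ suc m ] P n
    limit {n} m≤n = ≈[]-trans (≈⇒≈[] (f-∏ k)) (≈[]-weaken (s≤s m≤n) (∏≈[]partial (f-conv k) n))

-- Exponents of theta series

triangle : ℕ → ℕ
triangle zero    = 0
triangle (suc n) = suc n + triangle n

-- n (n + 1) / 2, also for negative n.
tri : ℤ → ℕ
tri (+ n)    = triangle n
tri -[1+ n ] = triangle n

-- The exponent s j(j+1)/2 + s′ j(j-1)/2 of the general term of Ramanujan's f(q^s, q^s′).
expo : ℕ → ℕ → ℤ → ℕ
expo s s′ j = s * tri j + s′ * tri (ℤ.- j)

-- Exponents are compared after doubling, which makes them polynomials over ℤ.
infix 4 _⇒_

record _⇒_ (m : ℕ) (p : ℤ) : Set where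
  constructor doubles
  field double : + m ℤ.+ + m ≡ p
open _⇒_

⇒-cong : ∀ {m p r} → p ≡ r → m ⇒ p → m ⇒ r
⇒-cong refl u = u

⇒-unique : ∀ {m n p r} → m ⇒ p → n ⇒ r → p ≡ r → m ≡ n
⇒-unique {m} {n} u v p≡r = ℕₚ.*-cancelˡ-≡ m n 2 (ℤₚ.+-injective
  (trans (twice m) (trans (double u) (trans p≡r (trans (sym (double v)) (sym (twice n)))))))
  where
  twice : ∀ m → + (2 * m) ≡ + m ℤ.+ + m
  twice m = cong +_ (cong (ℕ._+_ m) (ℕₚ.+-identityʳ m))

⇒-const : ∀ m → m ⇒ + m ℤ.+ + m
⇒-const m = doubles refl

⇒-+ : ∀ {m n p r} → m ⇒ p → n ⇒ r → m + n ⇒ p ℤ.+ r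
⇒-+ {m} {n} u v = doubles (trans (regroup (+ m) (+ n)) (cong₂ ℤ._+_ (double u) (double v)))
  where
  regroup : ∀ a b → (a ℤ.+ b) ℤ.+ (a ℤ.+ b) ≡ (a ℤ.+ a) ℤ.+ (b ℤ.+ b)
  regroup = ℤSolver.solve-∀

⇒-* : ∀ c {m p} → m ⇒ p → c * m ⇒ + c ℤ.* p
⇒-* c {m} u = doubles (trans (cong₂ ℤ._+_ (ℤₚ.pos-* c m) (ℤₚ.pos-* c m))
  (trans (sym (ℤₚ.*-distribˡ-+ (+ c) (+ m) (+ m))) (cong (+ c ℤ.*_) (double u))))

⇒-*ʳ : ∀ c {m p} → m ⇒ p → m * c ⇒ + c ℤ.* p
⇒-*ʳ c {m} {p} u = subst (_⇒ + c ℤ.* p) (ℕₚ.*-comm c m) (⇒-* c u)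

⇒-triangle : ∀ n → triangle n ⇒ + n ℤ.* + n ℤ.+ + n
⇒-triangle zero    = doubles refl
⇒-triangle (suc n) = ⇒-cong (expand (+ n)) (⇒-+ (⇒-const (suc n)) (⇒-triangle n))
  where
  expand : ∀ n → ((+ 1 ℤ.+ n) ℤ.+ (+ 1 ℤ.+ n)) ℤ.+ (n ℤ.* n ℤ.+ n) ≡ (+ 1 ℤ.+ n) ℤ.* (+ 1 ℤ.+ n) ℤ.+ (+ 1 ℤ.+ n)
  expand = ℤSolver.solve-∀

⇒-tri : ∀ j → tri j ⇒ j ℤ.* j ℤ.+ j
⇒-tri (+ n)    = ⇒-triangle n
⇒-tri -[1+ n ] = ⇒-cong (reflect (+ n)) (⇒-triangle n)
  where
  reflect : ∀ n → n ℤ.* n ℤ.+ n ≡ (ℤ.- (+ 1 ℤ.+ n)) ℤ.* (ℤ.- (+ 1 ℤ.+ n)) ℤ.+ (ℤ.- (+ 1 ℤ.+ n))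
  reflect = ℤSolver.solve-∀

⇒-expo : ∀ s s′ j → expo s s′ j ⇒ + s ℤ.* (j ℤ.* j ℤ.+ j) ℤ.+ + s′ ℤ.* (j ℤ.* j ℤ.- j)
⇒-expo s s′ j = ⇒-cong (cong (λ p → + s ℤ.* (j ℤ.* j ℤ.+ j) ℤ.+ + s′ ℤ.* p) (even j))
  (⇒-+ (⇒-* s (⇒-tri j)) (⇒-* s′ (⇒-tri (ℤ.- j))))
  where
  even : ∀ j → (ℤ.- j) ℤ.* (ℤ.- j) ℤ.+ (ℤ.- j) ≡ j ℤ.* j ℤ.- j
  even = ℤSolver.solve-∀

n≤triangle : ∀ n → n ℕ.≤ triangle n
n≤triangle zero    = z≤n
n≤triangle (suc n) = ℕₚ.m≤m+n (suc n) (triangle n)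

-- Only the window |j| ≤ n can contribute to the coefficient of q^n; the same bound controls the
-- error in the triple product.
∣j∣≤expo : ∀ s s′ .{{_ : NonZero s}} .{{_ : NonZero s′}} j → ℤ.∣ j ∣ ℕ.≤ expo s s′ j
∣j∣≤expo s s′ (+ n) = ℕₚ.≤-trans (n≤triangle n) (ℕₚ.≤-trans (ℕₚ.m≤n*m (triangle n) s)
  (ℕₚ.m≤m+n (s * triangle n) _))
∣j∣≤expo s s′ -[1+ n ] = ℕₚ.≤-trans (n≤triangle (suc n)) (ℕₚ.≤-trans (ℕₚ.m≤n*m (triangle (suc n)) s′)
  (ℕₚ.m≤n+m (s′ * triangle (suc n)) (s * triangle n)))

-- Jacobi triple product

module JacobiTripleProduct (s s′ : ℕ) .{{s≢0 : NonZero s}} .{{s′≢0 : NonZero s′}} where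

  k : ℕ
  k = s + s′

  instance
    k≢0 : NonZero k
    k≢0 = ℕ.>-nonZero (ℕₚ.<-≤-trans (ℕ.>-nonZero⁻¹ s) (ℕₚ.m≤m+n s s′))

  e : ℤ → ℕ
  e = expo s s′

  -- The summation index of the theta series is j = b - N, which runs from -N to M.
  binomialSum : ℕ → ℕ → Series
  binomialSum M N = anti (M + N) (λ a b → H k a b · q^ e (b ℤ.⊖ N))

  rearrange : ∀ h {u v c w} → u + v ≡ c + w → q^ u · h · q^ v ≈ q^ c · (h · q^ w)
  rearrange h {u} {v} {c} {w} eq = ≈-trans
    (solve 3 (λ x h y → (x :* h) :* y := h :* (x :* y)) ≈-refl (q^ u) h (q^ v))
    (≈-trans (·-cong ≈-refl (≈-trans (q^-+ u v) (≈-trans (q^-cong eq) (≈-sym (q^-+ c w)))))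
      (solve 3 (λ x h y → h :* (x :* y) := x :* (h :* y)) ≈-refl (q^ c) h (q^ w)))

  collect : ∀ c x → x ∔ q^ c · x ≈ (𝟙 ∔ q^ c) · x
  collect c x = solve 2 (λ y x → x :+ y :* x := (con 1ℤ :+ y) :* x) ≈-refl (q^ c) x

  -- The Pascal rule splits the sum. With j = b - N one has e(j+1) - e(j) = s + kj and a + j = M, so
  -- the half carrying q^(ka) is q^(s+Mk) times the old sum.
  step-M : ∀ M N → binomialSum (suc M) N ≈ (𝟙 ∔ q^ (s + M * k)) · binomialSum M N
  step-M M N = ≈-trans
    (anti-pascal (M + N) {X = λ a b → H k a b · q^ e (b ℤ.⊖ N)} {U = λ a b → H k a b · q^ e (b ℤ.⊖ N)}
      {V = λ a b → q^ (k * a) · H k a b · q^ e (suc b ℤ.⊖ N)}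
      (λ { zero → ≈-refl ; (suc a) → ≈-refl })
      (λ b → ·-cong (≈-sym (≈-trans (·-cong (q^-cong (ℕₚ.*-zeroʳ k)) ≈-refl) (R.*-identityˡ 𝟙))) ≈-refl)
      (λ a b → R.distribʳ (q^ e (suc b ℤ.⊖ N)) (H k a (suc b)) (q^ (k * suc a) · H k (suc a) b)))
    (≈-trans (∔-cong ≈-refl (≈-trans
        (anti-cong (M + N) λ a b eq → rearrange (H k a b) (exponent a b eq))
        (anti-· (q^ (s + M * k)) (M + N) _)))
      (collect (s + M * k) (binomialSum M N)))
    where
    exponent : ∀ a b → a + b ≡ M + N → k * a + e (suc b ℤ.⊖ N) ≡ (s + M * k) + e (b ℤ.⊖ N)
    exponent a b eq = ⇒-unique
      (⇒-+ (⇒-* k (⇒-const a)) (⇒-expo s s′ (suc b ℤ.⊖ N)))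
      (⇒-+ (⇒-+ (⇒-const s) (⇒-*ʳ k (⇒-const M))) (⇒-expo s s′ (b ℤ.⊖ N)))
      (trans (cong₂ (λ x j⁺ → + k ℤ.* (x ℤ.+ x) ℤ.+ (+ s ℤ.* (j⁺ ℤ.* j⁺ ℤ.+ j⁺) ℤ.+ + s′ ℤ.* (j⁺ ℤ.* j⁺ ℤ.- j⁺)))
          a≡ (sym (ℤₚ.m-n≡m⊖n (suc b) N)))
        (trans (identity (+ s) (+ s′) (+ M) (+ N) (+ b))
          (cong (λ j → (+ s ℤ.+ + s ℤ.+ + k ℤ.* (+ M ℤ.+ + M)) ℤ.+ (+ s ℤ.* (j ℤ.* j ℤ.+ j) ℤ.+ + s′ ℤ.* (j ℤ.* j ℤ.- j)))
            (ℤₚ.m-n≡m⊖n b N))))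
      where
      a≡ : + a ≡ + M ℤ.+ + N ℤ.- + b
      a≡ = trans (cancel (+ a) (+ b)) (cong (ℤ._- + b) (cong +_ eq))
        where
        cancel : ∀ x y → x ≡ x ℤ.+ y ℤ.- y
        cancel = ℤSolver.solve-∀
      identity : ∀ s s′ M N b → let j = b ℤ.- N ; j⁺ = (+ 1 ℤ.+ b) ℤ.- N ; a = M ℤ.+ N ℤ.- b ; k = s ℤ.+ s′ in
        k ℤ.* (a ℤ.+ a) ℤ.+ (s ℤ.* (j⁺ ℤ.* j⁺ ℤ.+ j⁺) ℤ.+ s′ ℤ.* (j⁺ ℤ.* j⁺ ℤ.- j⁺)) ≡
        (s ℤ.+ s ℤ.+ k ℤ.* (M ℤ.+ M)) ℤ.+ (s ℤ.* (j ℤ.* j ℤ.+ j) ℤ.+ s′ ℤ.* (j ℤ.* j ℤ.- j))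
      identity = ℤSolver.solve-∀

  -- Like `step-M`, but with `H-pascal`: now e(j) - e(j-1) = kj - s′ and b - j = N produce the new
  -- factor.
  step-N : ∀ M N → binomialSum M (suc N) ≈ (𝟙 ∔ q^ (s′ + N * k)) · binomialSum M N
  step-N M N = ≈-trans (subst (λ n → anti (M + suc N) g ≈ anti n g) (ℕₚ.+-suc M N) ≈-refl) (≈-trans
    (anti-pascal (M + N) {X = g} {U = λ a b → q^ (k * b) · H k a b · q^ e (b ℤ.⊖ suc N)}
      {V = λ a b → H k a b · q^ e (b ℤ.⊖ N)}
      (λ a → ·-cong (≈-sym (≈-trans (·-cong (q^-cong (ℕₚ.*-zeroʳ k)) ≈-refl)
        (≈-trans (R.*-identityˡ (H k a 0)) (H-zero a)))) ≈-refl)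
      (λ b → ·-cong ≈-refl (q^-cong (shift b)))
      (λ a b → ≈-trans (·-cong (H-pascal k a b) ≈-refl) (≈-trans
        (R.distribʳ (q^ e (suc b ℤ.⊖ suc N)) (H k (suc a) b) (q^ (k * suc b) · H k a (suc b)))
        (≈-trans (R.+-comm _ _) (∔-cong ≈-refl (·-cong ≈-refl (q^-cong (shift b))))))))
    (≈-trans (∔-cong (≈-trans
        (anti-cong (M + N) λ a b _ → rearrange (H k a b) (exponent b))
        (anti-· (q^ (s′ + N * k)) (M + N) _)) ≈-refl)
    (≈-trans (R.+-comm _ _) (collect (s′ + N * k) (binomialSum M N)))))
    where
    g : ℕ → ℕ → Series
    g a b = H k a b · q^ e (b ℤ.⊖ suc N)
    H-zero : ∀ a → H k a 0 ≈ 𝟙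
    H-zero zero    = ≈-refl
    H-zero (suc a) = ≈-refl
    shift : ∀ b → e (suc b ℤ.⊖ suc N) ≡ e (b ℤ.⊖ N)
    shift b = cong e (ℤₚ.[1+m]⊖[1+n]≡m⊖n b N)
    exponent : ∀ b → k * b + e (b ℤ.⊖ suc N) ≡ (s′ + N * k) + e (b ℤ.⊖ N)
    exponent b = ⇒-unique
      (⇒-+ (⇒-* k (⇒-const b)) (⇒-expo s s′ (b ℤ.⊖ suc N)))
      (⇒-+ (⇒-+ (⇒-const s′) (⇒-*ʳ k (⇒-const N))) (⇒-expo s s′ (b ℤ.⊖ N)))
      (subst₂ (λ j j⁻ → + k ℤ.* (+ b ℤ.+ + b) ℤ.+ (+ s ℤ.* (j⁻ ℤ.* j⁻ ℤ.+ j⁻) ℤ.+ + s′ ℤ.* (j⁻ ℤ.* j⁻ ℤ.- j⁻)) ≡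
          (+ s′ ℤ.+ + s′ ℤ.+ + k ℤ.* (+ N ℤ.+ + N)) ℤ.+ (+ s ℤ.* (j ℤ.* j ℤ.+ j) ℤ.+ + s′ ℤ.* (j ℤ.* j ℤ.- j)))
        (ℤₚ.m-n≡m⊖n b N) (ℤₚ.m-n≡m⊖n b (suc N))
        (identity (+ s) (+ s′) (+ N) (+ b)))
      where
      identity : ∀ s s′ N b → let j = b ℤ.- N ; j⁻ = b ℤ.- (+ 1 ℤ.+ N) ; k = s ℤ.+ s′ in
        k ℤ.* (b ℤ.+ b) ℤ.+ (s ℤ.* (j⁻ ℤ.* j⁻ ℤ.+ j⁻) ℤ.+ s′ ℤ.* (j⁻ ℤ.* j⁻ ℤ.- j⁻)) ≡
        (s′ ℤ.+ s′ ℤ.+ k ℤ.* (N ℤ.+ N)) ℤ.+ (s ℤ.* (j ℤ.* j ℤ.+ j) ℤ.+ s′ ℤ.* (j ℤ.* j ℤ.- j))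
      identity = ℤSolver.solve-∀

  posPartial : ℕ → ℕ → Series
  posPartial s = partial (λ i → 𝟙 ∔ q^ (s + i * k))

  finite : ∀ M N → posPartial s M · posPartial s′ N ≈ binomialSum M N
  finite zero    zero    = ≈-trans (R.*-identityˡ 𝟙) (≈-sym (≈-trans (R.*-identityˡ _)
    (q^-cong (cong₂ _+_ (ℕₚ.*-zeroʳ s) (ℕₚ.*-zeroʳ s′)))))
  finite (suc M) N       = ≈-trans
    (solve 3 (λ x y z → (x :* y) :* z := y :* (x :* z)) ≈-refl (posPartial s M) _ (posPartial s′ N))
    (≈-trans (·-cong ≈-refl (finite M N)) (≈-sym (step-M M N)))
  finite zero    (suc N) = ≈-trans
    (solve 3 (λ x y z → x :* (y :* z) := z :* (x :* y)) ≈-refl 𝟙 (posPartial s′ N) _)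
    (≈-trans (·-cong ≈-refl (finite zero N)) (≈-sym (step-N zero N)))

  theta-anti : ∀ N → theta s s′ ≈[ suc N ] anti (N + N) (λ a b → q^ e (b ℤ.⊖ N))
  theta-anti N = ≈[]-trans
    (·-cong[] (·-cong[] (∏≈[]partial (Pos-conv s k) N) (∏≈[]partial (Pos-conv s′ k) N)) (≈⇒≈[] η≈f))
    (≈[]-trans (≈⇒≈[] (≈-trans (·-cong (finite N N) ≈-refl) (≈-trans (R.*-comm _ (f k)) (≈-sym (anti-· (f k) (N + N) _)))))
      (anti-cong[] (N + N) (suc N) limit))
    where
    η≈f : η k ≈ f k
    η≈f = go k
      where
      go : ∀ k .{{_ : NonZero k}} → η k ≈ f k
      go (suc k) = ≈-refl
    -- Put j = b - N. The smaller of a and b is N - |j|, so replacing f_k times the binomial by 1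
    -- costs an error from q^(N-|j|+1) on. The monomial q^e(j) with e(j) ≥ |j| moves it beyond q^N.
    limit : ∀ a b → a + b ≡ N + N → f k · (H k a b · q^ e (b ℤ.⊖ N)) ≈[ suc N ] q^ e (b ℤ.⊖ N)
    limit a b eq = ≈[]-trans (≈⇒≈[] (solve 3 (λ u h x → u :* (h :* x) := x :* (u :* h)) ≈-refl (f k) (H k a b) (q^ ej)))
      (≈[]-trans (≈[]-weaken bound (≈[]-q^· ej (η·H k (proj₁ m≤) (proj₂ m≤)))) (≈⇒≈[] (R.*-identityʳ (q^ ej))))
      where
      ej m : ℕ
      ej = e (b ℤ.⊖ N)
      m = N ∸ ℤ.∣ b ℤ.⊖ N ∣
      bound : suc N ℕ.≤ ej + suc m
      bound = ℕₚ.≤-trans (s≤s (ℕₚ.≤-trans (ℕₚ.m≤n+m∸n N ℤ.∣ b ℤ.⊖ N ∣)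
        (ℕₚ.+-monoˡ-≤ m (∣j∣≤expo s s′ (b ℤ.⊖ N))))) (ℕₚ.≤-reflexive (sym (ℕₚ.+-suc ej m)))
      m≤ : m ℕ.≤ a × m ℕ.≤ b
      m≤ with ℕₚ.≤-total N b
      ... | inj₁ N≤b = subst (λ z → N ∸ ℤ.∣ z ∣ ℕ.≤ a) (sym (ℤₚ.⊖-≥ N≤b))
          (ℕₚ.m≤n+o⇒m∸n≤o N (b ∸ N) (ℕₚ.+-cancelˡ-≤ N N (b ∸ N + a) (ℕₚ.≤-reflexive (trans (sym eq)
            (trans (ℕₚ.+-comm a b) (trans (cong (_+ a) (sym (ℕₚ.m+[n∸m]≡n N≤b))) (ℕₚ.+-assoc N (b ∸ N) a))))))) ,
        ℕₚ.≤-trans (ℕₚ.m∸n≤m N ℤ.∣ b ℤ.⊖ N ∣) N≤b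
      ... | inj₂ b≤N = ℕₚ.≤-trans (ℕₚ.m∸n≤m N ℤ.∣ b ℤ.⊖ N ∣) (ℕₚ.+-cancelʳ-≤ b N a
          (subst (N + b ℕ.≤_) (sym eq) (ℕₚ.+-monoʳ-≤ N b≤N))) ,
        subst (λ z → N ∸ ℤ.∣ z ∣ ℕ.≤ b) (sym (ℤₚ.⊖-≤ b≤N))
          (subst (λ z → N ∸ z ℕ.≤ b) (sym (ℤₚ.∣-i∣≡∣i∣ (+ (N ∸ b))))
            (ℕₚ.≤-reflexive (ℕₚ.m∸[m∸n]≡n b≤N)))

  GF-anti : ∀ n (E : ℕ → ℕ) → GF {Fin (suc n)} (E ∘ toℕ) (anti n (λ a b → q^ E b))
  GF-anti zero E = GF-reindex (mk↔ₛ′ (λ _ → tt) (λ _ → zero) (λ _ → refl) (λ { zero → refl }))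
    (λ { zero → refl }) (GF-⊤ (E 0))
  GF-anti (suc n) E = GF-reindex
    (mk↔ₛ′ (λ { zero → inj₁ tt ; (suc i) → inj₂ i }) [ (λ _ → zero) , suc ]
      (λ { (inj₁ _) → refl ; (inj₂ _) → refl }) (λ { zero → refl ; (suc _) → refl }))
    (λ { zero → refl ; (suc i) → refl }) (GF-⊎ (GF-⊤ (E 0)) (GF-anti n (E ∘ suc)))

  GF-theta : GF e (theta s s′)
  GF-theta n with GF-anti (n + n) (λ b → e (b ℤ.⊖ n)) n
  ... | c , x≡ , i = c , trans (below (theta-anti n) ℕₚ.≤-refl) x≡ , i ∘↔ mk↔ₛ′ to from to-from from-to
    where
    to : Fibre e n → Fibre {Fin (suc (n + n))} (λ b → e (toℕ b ℤ.⊖ n)) n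
    -- For |j| ≤ n the integer j + n is nonnegative, so the absolute value only converts it to a
    -- natural number.
    recentre : ∀ j → ℤ.∣ j ∣ ℕ.≤ n → ℤ.∣ j ℤ.+ + n ∣ ℤ.⊖ n ≡ j
    recentre (+ m)    _   = trans (sym (ℤₚ.m-n≡m⊖n (m + n) n)) (cancel (+ m) (+ n))
      where
      cancel : ∀ x y → x ℤ.+ y ℤ.- y ≡ x
      cancel = ℤSolver.solve-∀
    recentre -[1+ m ] m<n = trans (cong (λ z → ℤ.∣ z ∣ ℤ.⊖ n) (ℤₚ.⊖-≥ m<n))
      (trans (sym (ℤₚ.m-n≡m⊖n (n ∸ suc m) n)) (trans (cong (ℤ._- + n) (sym (ℤₚ.⊖-≥ m<n)))
        (trans (cong (ℤ._- + n) (sym (ℤₚ.m-n≡m⊖n n (suc m)))) (cancel (+ n) (+ suc m)))))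
      where
      cancel : ∀ x y → x ℤ.- y ℤ.- x ≡ ℤ.- y
      cancel = ℤSolver.solve-∀
    small : ∀ j → e j ≡ n → ℤ.∣ j ∣ ℕ.≤ n
    small j p = subst (ℤ.∣ j ∣ ℕ.≤_) p (∣j∣≤expo s s′ j)
    in-range : ∀ j → e j ≡ n → ℤ.∣ j ℤ.+ + n ∣ ℕ.< suc (n + n)
    in-range j p = s≤s (ℕₚ.≤-trans (ℤₚ.∣i+j∣≤∣i∣+∣j∣ j (+ n)) (ℕₚ.+-monoˡ-≤ n (small j p)))
    recentred : ∀ j (p : e j ≡ n) → toℕ (fromℕ< (in-range j p)) ℤ.⊖ n ≡ j
    recentred j p = trans (cong (ℤ._⊖ n) (Finₚ.toℕ-fromℕ< (in-range j p))) (recentre j (small j p))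
    to (j , p) = fromℕ< (in-range j p) , trans (cong e (recentred j p)) p
    from : Fibre {Fin (suc (n + n))} (λ b → e (toℕ b ℤ.⊖ n)) n → Fibre e n
    from (b , p) = toℕ b ℤ.⊖ n , p
    to-from : ∀ v → to (from v) ≡ v
    to-from (b , p) = Fibre-≡ (Finₚ.toℕ-injective (trans (Finₚ.toℕ-fromℕ< (in-range (toℕ b ℤ.⊖ n) p))
      (trans (cong (λ z → ℤ.∣ z ℤ.+ + n ∣) (sym (ℤₚ.m-n≡m⊖n (toℕ b) n))) (cong ℤ.∣_∣ (cancel (+ toℕ b) (+ n))))))
      where
      cancel : ∀ x y → x ℤ.- y ℤ.+ y ≡ x
      cancel = ℤSolver.solve-∀
    from-to : ∀ u → from (to u) ≡ u
    from-to (j , p) = Fibre-≡ (recentred j p)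

open JacobiTripleProduct using (GF-theta)

-- Residue classes of integers

GF-along : ∀ {I J : Set} {e : I → ℕ} {e′ : J → ℕ} {x} (φ : I ↔ J) →
           (∀ i → e′ (Inverse.to φ i) ≡ e i) → GF e x → GF e′ x
GF-along {e = e} {e′} φ e≡ = GF-reindex (↔-sym φ) λ j →
  trans (cong e′ (sym (Inverse.strictlyInverseˡ φ j))) (e≡ (Inverse.from φ j))

module _ (d : ℕ) .{{d≢0 : NonZero d}} where

  recompose : ℤ × Fin d → ℤ
  recompose (i , r) = i ℤ.* + d ℤ.+ + toℕ r

  -- (i - i′)d equals r′ - r, whose absolute value is below d; hence i = i′.
  recompose-injective : ∀ u v → recompose u ≡ recompose v → u ≡ v
  recompose-injective (i , r) (i′ , r′) eq = cong₂ _,_ i≡i′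
    (Finₚ.toℕ-injective (ℤₚ.+-injective (ℤGroup.∙-cancelˡ (i ℤ.* + d) _ _
      (trans eq (cong (λ z → z ℤ.* + d ℤ.+ + toℕ r′) (sym i≡i′))))))
    where
    difference : (i ℤ.- i′) ℤ.* + d ≡ + toℕ r′ ℤ.- + toℕ r
    difference = trans (isolate i i′ (+ d) (+ toℕ r)) (trans (cong (λ z → z ℤ.- i′ ℤ.* + d ℤ.- + toℕ r) eq)
      (cancel (i′ ℤ.* + d) (+ toℕ r) (+ toℕ r′)))
      where
      isolate : ∀ i i′ d r → (i ℤ.- i′) ℤ.* d ≡ (i ℤ.* d ℤ.+ r) ℤ.- i′ ℤ.* d ℤ.- r
      isolate = ℤSolver.solve-∀
      cancel : ∀ x r r′ → (x ℤ.+ r′) ℤ.- x ℤ.- r ≡ r′ ℤ.- r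
      cancel = ℤSolver.solve-∀
    small : ℤ.∣ i ℤ.- i′ ∣ * d ℕ.< 1 * d
    small = subst₂ ℕ._<_ (trans (cong ℤ.∣_∣ (sym difference)) (ℤₚ.abs-* (i ℤ.- i′) (+ d))) (sym (ℕₚ.*-identityˡ d))
      (subst (λ z → ℤ.∣ z ∣ ℕ.< d) (sym (ℤₚ.m-n≡m⊖n (toℕ r′) (toℕ r)))
        (ℕₚ.≤-<-trans (ℤₚ.∣m⊝n∣≤m⊔n (toℕ r′) (toℕ r)) (ℕₚ.⊔-lub (Finₚ.toℕ<n r′) (Finₚ.toℕ<n r))))
    i≡i′ : i ≡ i′
    i≡i′ = ℤₚ.i-j≡0⇒i≡j i i′ (ℤₚ.∣i∣≡0⇒i≡0 (ℕₚ.n<1⇒n≡0 (ℕₚ.*-cancelʳ-< d ℤ.∣ i ℤ.- i′ ∣ 1 small)))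

  residues : (ℤ × Fin d) ↔ ℤ
  residues = mk↔ₛ′ recompose decompose recompose-decompose
    (λ u → recompose-injective _ u (recompose-decompose (recompose u)))
    where
    decompose : ℤ → ℤ × Fin d
    decompose n = n ℤDivMod./ℕ d , fromℕ< (ℤDivMod.n%ℕd<d n d)
    recompose-decompose : ∀ n → recompose (decompose n) ≡ n
    recompose-decompose n = trans (cong (λ r → (n ℤDivMod./ℕ d) ℤ.* + d ℤ.+ + r) (Finₚ.toℕ-fromℕ< (ℤDivMod.n%ℕd<d n d)))
      (trans (ℤₚ.+-comm ((n ℤDivMod./ℕ d) ℤ.* + d) (+ (n ℤDivMod.%ℕ d))) (sym (ℤDivMod.a≡a%ℕn+[a/ℕn]*n n d)))

split₂ : ∀ {A : Set} → ((ℤ × A) ⊎ (ℤ × A)) ↔ (ℤ × A)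
split₂ = (residues 2 ×-↔ ↔-id _) ∘↔ mk↔ₛ′
  [ (λ { (i , x) → (i , zero) , x }) , (λ { (i , x) → (i , suc zero) , x }) ]
  (λ { ((i , zero) , x) → inj₁ (i , x) ; ((i , suc zero) , x) → inj₂ (i , x) })
  (λ { ((i , zero) , x) → refl ; ((i , suc zero) , x) → refl })
  (λ { (inj₁ _) → refl ; (inj₂ _) → refl })

split₃ : ∀ {A : Set} → ((ℤ × A) ⊎ (ℤ × A) ⊎ (ℤ × A)) ↔ (ℤ × A)
split₃ = (residues 3 ×-↔ ↔-id _) ∘↔ mk↔ₛ′
  [ (λ { (i , x) → (i , zero) , x }) , [ (λ { (i , x) → (i , suc zero) , x }) , (λ { (i , x) → (i , suc (suc zero)) , x }) ] ]
  (λ { ((i , zero) , x) → inj₁ (i , x) ; ((i , suc zero) , x) → inj₂ (inj₁ (i , x))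
     ; ((i , suc (suc zero)) , x) → inj₂ (inj₂ (i , x)) })
  (λ { ((i , zero) , x) → refl ; ((i , suc zero) , x) → refl ; ((i , suc (suc zero)) , x) → refl })
  (λ { (inj₁ _) → refl ; (inj₂ (inj₁ _)) → refl ; (inj₂ (inj₂ _)) → refl })

-- Lattice sums

ℤ² : Set
ℤ² = ℤ × ℤ

ψ φ F G : Series
ψ = theta 1 3
φ = theta 1 1
F = theta 1 2
G = theta 1 5

-- The form 3(m²+mn+n²)+m+2n, written as a sum of exponents so that it takes values in ℕ by
-- construction.
core : ℤ² → ℕ
core (m , n) = expo 2 1 m + expo 3 0 n + expo 2 1 (m ℤ.+ n)

-- The form m²+mn+n²+m+n, made ℕ-valued in the same way.
hexagonal : ℤ² → ℕ
hexagonal (m , n) = tri m + tri n + tri (m ℤ.+ n)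

⇒-core : ∀ m n → core (m , n) ⇒ + 2 ℤ.* (+ 3 ℤ.* (m ℤ.* m ℤ.+ m ℤ.* n ℤ.+ n ℤ.* n) ℤ.+ m ℤ.+ + 2 ℤ.* n)
⇒-core m n = ⇒-cong (identity m n)
  (⇒-+ (⇒-+ (⇒-expo 2 1 m) (⇒-expo 3 0 n)) (⇒-expo 2 1 (m ℤ.+ n)))
  where
  identity : ∀ m n → let s = m ℤ.+ n in
    (+ 2 ℤ.* (m ℤ.* m ℤ.+ m) ℤ.+ + 1 ℤ.* (m ℤ.* m ℤ.- m)) ℤ.+ (+ 3 ℤ.* (n ℤ.* n ℤ.+ n) ℤ.+ + 0 ℤ.* (n ℤ.* n ℤ.- n))
      ℤ.+ (+ 2 ℤ.* (s ℤ.* s ℤ.+ s) ℤ.+ + 1 ℤ.* (s ℤ.* s ℤ.- s)) ≡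
    + 2 ℤ.* (+ 3 ℤ.* (m ℤ.* m ℤ.+ m ℤ.* n ℤ.+ n ℤ.* n) ℤ.+ m ℤ.+ + 2 ℤ.* n)
  identity = ℤSolver.solve-∀

⇒-hexagonal : ∀ m n → hexagonal (m , n) ⇒ + 2 ℤ.* (m ℤ.* m ℤ.+ m ℤ.* n ℤ.+ n ℤ.* n ℤ.+ m ℤ.+ n)
⇒-hexagonal m n = ⇒-cong (identity m n) (⇒-+ (⇒-+ (⇒-tri m) (⇒-tri n)) (⇒-tri (m ℤ.+ n)))
  where
  identity : ∀ m n → let s = m ℤ.+ n in (m ℤ.* m ℤ.+ m) ℤ.+ (n ℤ.* n ℤ.+ n) ℤ.+ (s ℤ.* s ℤ.+ s) ≡
    + 2 ℤ.* (m ℤ.* m ℤ.+ m ℤ.* n ℤ.+ n ℤ.* n ℤ.+ m ℤ.+ n)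
  identity = ℤSolver.solve-∀

-- The numbers n (n - 1) / 2, n ∈ ℤ, are the numbers 2 i² - i taken twice.
GF-ψ∔ψ : GF (expo 0 1) (ψ ∔ ψ)
GF-ψ∔ψ = GF-along classes (λ { (inj₁ i) → even i ; (inj₂ i) → odd i }) (GF-⊎ (GF-theta 1 3) (GF-theta 1 3))
  where
  unit : (ℤ × ⊤) ↔ ℤ
  unit = mk↔ₛ′ proj₁ (_, tt) (λ _ → refl) (λ _ → refl)
  negate↔ : ℤ ↔ ℤ
  negate↔ = mk↔ₛ′ ℤ.-_ ℤ.-_ ℤₚ.neg-involutive ℤₚ.neg-involutive
  classes : (ℤ ⊎ ℤ) ↔ ℤ
  classes = unit ∘↔ split₂ ∘↔ (↔-sym unit ⊎-↔ (↔-sym unit ∘↔ negate↔))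
  even : ∀ i → expo 0 1 (i ℤ.* + 2 ℤ.+ + 0) ≡ expo 1 3 i
  even i = ⇒-unique (⇒-expo 0 1 (i ℤ.* + 2 ℤ.+ + 0)) (⇒-expo 1 3 i) (ℤSolver.solve (i ∷ []))
  odd : ∀ i → expo 0 1 (ℤ.- i ℤ.* + 2 ℤ.+ + 1) ≡ expo 1 3 i
  odd i = ⇒-unique (⇒-expo 0 1 (ℤ.- i ℤ.* + 2 ℤ.+ + 1)) (⇒-expo 1 3 i) (ℤSolver.solve (i ∷ []))

-- What sorting the points of `core` by the parity of `n` produces: completing the square separates
-- the variables in each class. The eta quotient f₃³/f₁ is reached only in `C-η`.
C : Series
C = D 2 F · D 6 F ∔ q^ 1 · (G · D 3 G)

swap↔ : ∀ {A B : Set} → (A × B) ↔ (B × A)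
swap↔ = mk↔ₛ′ (λ { (x , y) → y , x }) (λ { (y , x) → x , y }) (λ _ → refl) (λ _ → refl)

linear↔ : ∀ {K : Set} (t₁ t₂ s₁ s₂ : K → ℤ → ℤ → ℤ) →
          (∀ k x y → t₁ k (s₁ k x y) (s₂ k x y) ≡ x) → (∀ k x y → t₂ k (s₁ k x y) (s₂ k x y) ≡ y) →
          (∀ k u v → s₁ k (t₁ k u v) (t₂ k u v) ≡ u) → (∀ k u v → s₂ k (t₁ k u v) (t₂ k u v) ≡ v) →
          (K × ℤ²) ↔ (K × ℤ²)
linear↔ t₁ t₂ s₁ s₂ p₁ p₂ q₁ q₂ = mk↔ₛ′
  (λ { (k , u , v) → k , t₁ k u v , t₂ k u v }) (λ { (k , x , y) → k , s₁ k x y , s₂ k x y })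
  (λ { (k , x , y) → cong (k ,_) (cong₂ _,_ (p₁ k x y) (p₂ k x y)) })
  (λ { (k , u , v) → cong (k ,_) (cong₂ _,_ (q₁ k u v) (q₂ k u v)) })

plane↔ : (t₁ t₂ s₁ s₂ : ℤ → ℤ → ℤ) →
         (∀ x y → t₁ (s₁ x y) (s₂ x y) ≡ x) → (∀ x y → t₂ (s₁ x y) (s₂ x y) ≡ y) →
         (∀ u v → s₁ (t₁ u v) (t₂ u v) ≡ u) → (∀ u v → s₂ (t₁ u v) (t₂ u v) ≡ v) → ℤ² ↔ ℤ²
plane↔ t₁ t₂ s₁ s₂ p₁ p₂ q₁ q₂ = mk↔ₛ′
  (λ { (u , v) → t₁ u v , t₂ u v }) (λ { (x , y) → s₁ x y , s₂ x y })
  (λ { (x , y) → cong₂ _,_ (p₁ x y) (p₂ x y) }) (λ { (u , v) → cong₂ _,_ (q₁ u v) (q₂ u v) })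

GF-core : GF core C
GF-core = GF-along (swap↔ ∘↔ split₂ ∘↔ (α₀ ⊎-↔ α₁)) (λ { (inj₁ (u , v)) → even u v ; (inj₂ (u , v)) → odd u v })
  (GF-⊎ (GF-× (GF-D 2 (GF-theta 1 2)) (GF-D 6 (GF-theta 1 2)))
        (GF-shift 1 (GF-× (GF-theta 1 5) (GF-D 3 (GF-theta 1 5)))))
  where
  α₀ α₁ : ℤ² ↔ ℤ²
  α₀ = plane↔ (λ u v → ℤ.- v) (λ u v → v ℤ.- u) (λ x m → ℤ.- x ℤ.- m) (λ x m → ℤ.- x)
    ℤSolver.solve-∀ ℤSolver.solve-∀ ℤSolver.solve-∀ ℤSolver.solve-∀
  α₁ = plane↔ (λ u v → v ℤ.- + 1) (λ u v → u ℤ.- v) (λ x m → m ℤ.+ x ℤ.+ + 1) (λ x m → x ℤ.+ + 1)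
    ℤSolver.solve-∀ ℤSolver.solve-∀ ℤSolver.solve-∀ ℤSolver.solve-∀
  even : ∀ u v → core (v ℤ.- u , ℤ.- v ℤ.* + 2 ℤ.+ + 0) ≡ expo 1 2 u * 2 + expo 1 2 v * 6
  even u v = ⇒-unique (⇒-core (v ℤ.- u) (ℤ.- v ℤ.* + 2 ℤ.+ + 0))
    (⇒-+ (⇒-*ʳ 2 (⇒-expo 1 2 u)) (⇒-*ʳ 6 (⇒-expo 1 2 v)))
    (ℤSolver.solve (u ∷ v ∷ []))
  odd : ∀ u v → core (u ℤ.- v , (v ℤ.- + 1) ℤ.* + 2 ℤ.+ + 1) ≡ 1 + (expo 1 5 u + expo 1 5 v * 3)
  odd u v = ⇒-unique (⇒-core (u ℤ.- v) ((v ℤ.- + 1) ℤ.* + 2 ℤ.+ + 1))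
    (⇒-+ (⇒-const 1) (⇒-+ (⇒-expo 1 5 u) (⇒-*ʳ 3 (⇒-expo 1 5 v))))
    (ℤSolver.solve (u ∷ v ∷ []))

-- The form m² + mn + n² + m + n is invariant under the rotation
-- (m , n) ↦ (n , -1 - m - n), which permutes the classes of m - n modulo 3.
GF-hexagonal : GF hexagonal (C ∔ (C ∔ C))
GF-hexagonal = GF-along (shear ∘↔ split₃ ∘↔ (α₀ ⊎-↔ (α₁ ⊎-↔ α₂)))
  (λ { (inj₁ (t , u)) → class₀ t u ; (inj₂ (inj₁ (t , u))) → class₁ t u ; (inj₂ (inj₂ (t , u))) → class₂ t u })
  (GF-⊎ GF-core (GF-⊎ GF-core GF-core))
  where
  shear α₀ α₁ α₂ : ℤ² ↔ ℤ²
  shear = plane↔ (λ d n → d ℤ.+ n) (λ d n → n) (λ m n → m ℤ.- n) (λ m n → n)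
    ℤSolver.solve-∀ ℤSolver.solve-∀ ℤSolver.solve-∀ ℤSolver.solve-∀
  α₀ = plane↔ (λ t u → t) (λ t u → u ℤ.- t) (λ x n → x) (λ x n → n ℤ.+ x)
    ℤSolver.solve-∀ ℤSolver.solve-∀ ℤSolver.solve-∀ ℤSolver.solve-∀
  α₁ = plane↔ (λ t u → u) (λ t u → ℤ.- + 1 ℤ.- + 2 ℤ.* u ℤ.- t) (λ x n → ℤ.- + 1 ℤ.- + 2 ℤ.* x ℤ.- n) (λ x n → x)
    ℤSolver.solve-∀ ℤSolver.solve-∀ ℤSolver.solve-∀ ℤSolver.solve-∀
  α₂ = plane↔ (λ t u → ℤ.- + 1 ℤ.- u ℤ.- t) (λ t u → u ℤ.+ + 2 ℤ.* t)
    (λ x n → n ℤ.+ x ℤ.+ + 1) (λ x n → ℤ.- + 2 ℤ.- n ℤ.- + 2 ℤ.* x)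
    ℤSolver.solve-∀ ℤSolver.solve-∀ ℤSolver.solve-∀ ℤSolver.solve-∀
  class₀ : ∀ t u → hexagonal (t ℤ.* + 3 ℤ.+ + 0 ℤ.+ (u ℤ.- t) , u ℤ.- t) ≡ core (t , u)
  class₀ t u = ⇒-unique (⇒-hexagonal (t ℤ.* + 3 ℤ.+ + 0 ℤ.+ (u ℤ.- t)) (u ℤ.- t)) (⇒-core t u) (ℤSolver.solve (t ∷ u ∷ []))
  class₁ : ∀ t u → let n = ℤ.- + 1 ℤ.- + 2 ℤ.* u ℤ.- t in hexagonal (u ℤ.* + 3 ℤ.+ + 1 ℤ.+ n , n) ≡ core (t , u)
  class₁ t u = ⇒-unique (⇒-hexagonal (u ℤ.* + 3 ℤ.+ + 1 ℤ.+ (ℤ.- + 1 ℤ.- + 2 ℤ.* u ℤ.- t)) (ℤ.- + 1 ℤ.- + 2 ℤ.* u ℤ.- t)) (⇒-core t u) (ℤSolver.solve (t ∷ u ∷ []))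
  class₂ : ∀ t u → let n = u ℤ.+ + 2 ℤ.* t in
           hexagonal ((ℤ.- + 1 ℤ.- u ℤ.- t) ℤ.* + 3 ℤ.+ + 2 ℤ.+ n , n) ≡ core (t , u)
  class₂ t u = ⇒-unique (⇒-hexagonal ((ℤ.- + 1 ℤ.- u ℤ.- t) ℤ.* + 3 ℤ.+ + 2 ℤ.+ (u ℤ.+ + 2 ℤ.* t)) (u ℤ.+ + 2 ℤ.* t))
    (⇒-core t u) (ℤSolver.solve (t ∷ u ∷ []))

-- Here the points are sorted by the parity of `m`. Moving `n` by m/2 or (m+1)/2 separates the
-- variables; even m gives twice ψ(q²)F(q²), odd m gives φG.
GF-hexagonal-parity : GF hexagonal (D 2 (ψ ∔ ψ) · D 2 F ∔ φ · G)
GF-hexagonal-parity = GF-along (split₂ ∘↔ (α₀ ⊎-↔ α₁))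
  (λ { (inj₁ (w , v)) → even w v ; (inj₂ (w , v)) → odd w v })
  (GF-⊎ (GF-× (GF-D 2 GF-ψ∔ψ) (GF-D 2 (GF-theta 1 2))) (GF-× (GF-theta 1 1) (GF-theta 1 5)))
  where
  α₀ α₁ : ℤ² ↔ ℤ²
  α₀ = plane↔ (λ w v → ℤ.- v) (λ w v → v ℤ.- w) (λ x n → ℤ.- x ℤ.- n) (λ x n → ℤ.- x)
    ℤSolver.solve-∀ ℤSolver.solve-∀ ℤSolver.solve-∀ ℤSolver.solve-∀
  α₁ = plane↔ (λ w v → v ℤ.- + 1) (λ w v → w ℤ.- v) (λ x n → n ℤ.+ x ℤ.+ + 1) (λ x n → x ℤ.+ + 1)
    ℤSolver.solve-∀ ℤSolver.solve-∀ ℤSolver.solve-∀ ℤSolver.solve-∀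
  even : ∀ w v → hexagonal (ℤ.- v ℤ.* + 2 ℤ.+ + 0 , v ℤ.- w) ≡ expo 0 1 w * 2 + expo 1 2 v * 2
  even w v = ⇒-unique (⇒-hexagonal (ℤ.- v ℤ.* + 2 ℤ.+ + 0) (v ℤ.- w))
    (⇒-+ (⇒-*ʳ 2 (⇒-expo 0 1 w)) (⇒-*ʳ 2 (⇒-expo 1 2 v))) (ℤSolver.solve (w ∷ v ∷ []))
  odd : ∀ w v → hexagonal ((v ℤ.- + 1) ℤ.* + 2 ℤ.+ + 1 , w ℤ.- v) ≡ expo 1 1 w + expo 1 5 v
  odd w v = ⇒-unique (⇒-hexagonal ((v ℤ.- + 1) ℤ.* + 2 ℤ.+ + 1) (w ℤ.- v))
    (⇒-+ (⇒-expo 1 1 w) (⇒-expo 1 5 v)) (ℤSolver.solve (w ∷ v ∷ []))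

-- The exponents of φ G at (w , v) are even or odd with w + v.
GF-φG : GF {ℤ²} (λ { (w , v) → expo 1 1 w + expo 1 5 v }) (D 2 ψ · D 2 F ∔ q^ 1 · D 4 (C ∔ (C ∔ C)))
GF-φG = GF-along {e′ = form} (shear ∘↔ split₂ ∘↔ (↔-id _ ⊎-↔ β))
  (λ { (inj₁ _) → refl ; (inj₂ (k , j)) → odd k j })
  (GF-⊎ evenPart (GF-shift 1 (GF-D 4 GF-hexagonal)))
  where
  form : ℤ² → ℕ
  form (w , v) = expo 1 1 w + expo 1 5 v
  shear α₀ α₁ β : ℤ² ↔ ℤ²
  shear = plane↔ (λ s v → s ℤ.- v) (λ s v → v) (λ w v → w ℤ.+ v) (λ w v → v)
    ℤSolver.solve-∀ ℤSolver.solve-∀ ℤSolver.solve-∀ ℤSolver.solve-∀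
  α₀ = plane↔ (λ h i → h) (λ h i → i ℤ.+ h) (λ h v → h) (λ h v → v ℤ.- h)
    ℤSolver.solve-∀ ℤSolver.solve-∀ ℤSolver.solve-∀ ℤSolver.solve-∀
  α₁ = plane↔ (λ h i → h) (λ h i → h ℤ.+ + 1 ℤ.- i) (λ h v → h) (λ h v → h ℤ.+ + 1 ℤ.- v)
    ℤSolver.solve-∀ ℤSolver.solve-∀ ℤSolver.solve-∀ ℤSolver.solve-∀
  β = plane↔ (λ k j → j) (λ k j → ℤ.- k) (λ j v → ℤ.- v) (λ j v → j)
    ℤSolver.solve-∀ ℤSolver.solve-∀ ℤSolver.solve-∀ ℤSolver.solve-∀
  odd : ∀ k j → form (j ℤ.* + 2 ℤ.+ + 1 ℤ.- ℤ.- k , ℤ.- k) ≡ 1 + hexagonal (k , j) * 4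
  odd k j = ⇒-unique (⇒-+ (⇒-expo 1 1 (j ℤ.* + 2 ℤ.+ + 1 ℤ.- ℤ.- k)) (⇒-expo 1 5 (ℤ.- k)))
    (⇒-+ (⇒-const 1) (⇒-*ʳ 4 (⇒-hexagonal k j))) (ℤSolver.solve (k ∷ j ∷ []))
  ψF : ℤ² → ℕ
  ψF (j , i) = expo 1 2 j * 2 + expo 1 3 i * 2
  evenPart : GF {ℤ²} (λ { (j , v) → form (j ℤ.* + 2 ℤ.+ + 0 ℤ.- v , v) }) (D 2 ψ · D 2 F)
  evenPart = GF-along (split₂ ∘↔ (α₀ ⊎-↔ α₁))
    (λ { (inj₁ (h , i)) → even₀ h i ; (inj₂ (h , i)) → even₁ h i })
    (GF-reindex {e = ψF} split₂ (λ _ → refl) (GF-≈ (R.*-comm (D 2 F) (D 2 ψ))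
      (GF-× (GF-D 2 (GF-theta 1 2)) (GF-D 2 (GF-theta 1 3)))))
    where
    even₀ : ∀ h i → form ((h ℤ.* + 2 ℤ.+ + 0) ℤ.* + 2 ℤ.+ + 0 ℤ.- (i ℤ.+ h) , i ℤ.+ h) ≡ ψF (h ℤ.* + 2 ℤ.+ + 0 , i)
    even₀ h i = ⇒-unique
      (⇒-+ (⇒-expo 1 1 ((h ℤ.* + 2 ℤ.+ + 0) ℤ.* + 2 ℤ.+ + 0 ℤ.- (i ℤ.+ h))) (⇒-expo 1 5 (i ℤ.+ h)))
      (⇒-+ (⇒-*ʳ 2 (⇒-expo 1 2 (h ℤ.* + 2 ℤ.+ + 0))) (⇒-*ʳ 2 (⇒-expo 1 3 i))) (ℤSolver.solve (h ∷ i ∷ []))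
    even₁ : ∀ h i → form ((h ℤ.* + 2 ℤ.+ + 1) ℤ.* + 2 ℤ.+ + 0 ℤ.- (h ℤ.+ + 1 ℤ.- i) , h ℤ.+ + 1 ℤ.- i) ≡ ψF (h ℤ.* + 2 ℤ.+ + 1 , i)
    even₁ h i = ⇒-unique
      (⇒-+ (⇒-expo 1 1 ((h ℤ.* + 2 ℤ.+ + 1) ℤ.* + 2 ℤ.+ + 0 ℤ.- (h ℤ.+ + 1 ℤ.- i))) (⇒-expo 1 5 (h ℤ.+ + 1 ℤ.- i)))
      (⇒-+ (⇒-*ʳ 2 (⇒-expo 1 2 (h ℤ.* + 2 ℤ.+ + 1))) (⇒-*ʳ 2 (⇒-expo 1 3 i))) (ℤSolver.solve (h ∷ i ∷ []))

φG-dissection : φ · G ≈ D 2 ψ · D 2 F ∔ q^ 1 · D 4 (C ∔ (C ∔ C))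
φG-dissection = GF-unique (GF-× (GF-theta 1 1) (GF-theta 1 5)) (GF-reindex (↔-id _) (λ _ → refl) GF-φG)

hexagonal-parity : C ∔ (C ∔ C) ≈ D 2 (ψ ∔ ψ) · D 2 F ∔ φ · G
hexagonal-parity = GF-unique GF-hexagonal GF-hexagonal-parity

-- The product of three Jacobi triple products with base q³ is regrouped
-- according to the sum n = n₀ + n₁ + n₂ of the summation indices; the shift
-- (n₀ , n₁ , n₂) ↦ (n₂ + 1 , n₀ , n₁) brings n to a multiple of 3.
core-product : D 3 (ψ ∔ ψ) · (F · F) ≈ (ψ ∔ ψ) · C
core-product = GF-unique
  (GF-reindex {e′ = byClass} (change ∘↔ split₃ ∘↔ (α₀ ⊎-↔ (α₁ ⊎-↔ α₂)))
    (λ { (inj₁ (k , m , n)) → class₀ k m n ; (inj₂ (inj₁ (k , m , n))) → class₁ k m n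
       ; (inj₂ (inj₂ (k , m , n))) → class₂ k m n })
    (GF-× (GF-D 3 GF-ψ∔ψ) (GF-× (GF-theta 1 2) (GF-theta 1 2))))
  (GF-reindex split₃ (λ _ → refl) (GF-× GF-ψ∔ψ GF-core))
  where
  byClass : ((ℤ × ℤ²) ⊎ (ℤ × ℤ²) ⊎ (ℤ × ℤ²)) → ℕ
  byClass u = let n , v = Inverse.to split₃ u in expo 0 1 n + core v
  change α₀ α₁ α₂ : (ℤ × ℤ²) ↔ (ℤ × ℤ²)
  -- The third triple product has exponent 3n₂(n₂-1)/2 + 2n₂, which is `expo 1 2` at -n₂; hence the
  -- reversed sign of the last index.
  change = mk↔ₛ′ (λ { (n , n₁ , n₂) → n ℤ.- n₁ ℤ.- n₂ , n₁ , ℤ.- n₂ }) (λ { (n₀ , n₁ , b) → n₀ ℤ.+ n₁ ℤ.- b , n₁ , ℤ.- b })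
    (λ { (n₀ , n₁ , b) → cong₂ (λ x y → x , n₁ , y) (forth n₀ n₁ b) (ℤₚ.neg-involutive b) })
    (λ { (n , n₁ , n₂) → cong₂ (λ x y → x , n₁ , y) (back n n₁ n₂) (ℤₚ.neg-involutive n₂) })
    where
    forth : ∀ n₀ n₁ b → n₀ ℤ.+ n₁ ℤ.- b ℤ.- n₁ ℤ.- ℤ.- b ≡ n₀
    forth = ℤSolver.solve-∀
    back : ∀ n n₁ n₂ → n ℤ.- n₁ ℤ.- n₂ ℤ.+ n₁ ℤ.- ℤ.- n₂ ≡ n
    back = ℤSolver.solve-∀
  α₀ = linear↔ (λ k m n → m ℤ.+ k) (λ k m n → n ℤ.+ k) (λ k x y → x ℤ.- k) (λ k x y → y ℤ.- k)
    ℤSolver.solve-∀ ℤSolver.solve-∀ ℤSolver.solve-∀ ℤSolver.solve-∀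
  α₁ = linear↔ (λ k m n → k ℤ.- m ℤ.- n) (λ k m n → m ℤ.+ k)
    (λ k x y → y ℤ.- k) (λ k x y → k ℤ.- x ℤ.- (y ℤ.- k))
    ℤSolver.solve-∀ ℤSolver.solve-∀ ℤSolver.solve-∀ ℤSolver.solve-∀
  α₂ = linear↔ (λ k m n → n ℤ.+ + 1 ℤ.+ k) (λ k m n → k ℤ.- m ℤ.- n)
    (λ k x y → k ℤ.- y ℤ.- (x ℤ.- + 1 ℤ.- k)) (λ k x y → x ℤ.- + 1 ℤ.- k)
    ℤSolver.solve-∀ ℤSolver.solve-∀ ℤSolver.solve-∀ ℤSolver.solve-∀
  rule : ∀ n n₁ n₂ m m′ → _ → expo 0 1 n + core (m , m′) ≡ expo 0 1 (n ℤ.- n₁ ℤ.- n₂) * 3 + (expo 1 2 n₁ + expo 1 2 (ℤ.- n₂))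
  rule n n₁ n₂ m m′ p = ⇒-unique (⇒-+ (⇒-expo 0 1 n) (⇒-core m m′))
    (⇒-+ (⇒-*ʳ 3 (⇒-expo 0 1 (n ℤ.- n₁ ℤ.- n₂))) (⇒-+ (⇒-expo 1 2 n₁) (⇒-expo 1 2 (ℤ.- n₂)))) p
  class₀ : ∀ k m n → let N = k ℤ.* + 3 ℤ.+ + 0 ; n₁ = m ℤ.+ k ; n₂ = n ℤ.+ k in
    expo 0 1 N + core (m , n) ≡ expo 0 1 (N ℤ.- n₁ ℤ.- n₂) * 3 + (expo 1 2 n₁ + expo 1 2 (ℤ.- n₂))
  class₀ k m n = rule (k ℤ.* + 3 ℤ.+ + 0) (m ℤ.+ k) (n ℤ.+ k) m n (ℤSolver.solve (k ∷ m ∷ n ∷ []))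
  class₁ : ∀ k m n → let N = k ℤ.* + 3 ℤ.+ + 1 ; n₁ = k ℤ.- m ℤ.- n ; n₂ = m ℤ.+ k in
    expo 0 1 N + core (m , n) ≡ expo 0 1 (N ℤ.- n₁ ℤ.- n₂) * 3 + (expo 1 2 n₁ + expo 1 2 (ℤ.- n₂))
  class₁ k m n = rule (k ℤ.* + 3 ℤ.+ + 1) (k ℤ.- m ℤ.- n) (m ℤ.+ k) m n (ℤSolver.solve (k ∷ m ∷ n ∷ []))
  class₂ : ∀ k m n → let N = k ℤ.* + 3 ℤ.+ + 2 ; n₁ = n ℤ.+ + 1 ℤ.+ k ; n₂ = k ℤ.- m ℤ.- n in
    expo 0 1 N + core (m , n) ≡ expo 0 1 (N ℤ.- n₁ ℤ.- n₂) * 3 + (expo 1 2 n₁ + expo 1 2 (ℤ.- n₂))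
  class₂ k m n = rule (k ℤ.* + 3 ℤ.+ + 2) (n ℤ.+ + 1 ℤ.+ k) (k ℤ.- m ℤ.- n) m n (ℤSolver.solve (k ∷ m ∷ n ∷ []))

-- Dissections of C and of φ G, and C as an eta quotient

opaque
  unfolding _∔_

  halve : ∀ {x y} → x ∔ x ≈ y ∔ y → x ≈ y
  halve {x} {y} p = mk≈ λ n → ℤₚ.*-cancelˡ-≡ (+ 2) (x n) (y n) (trans (twice (x n)) (trans (coeff p n) (sym (twice (y n)))))
    where
    twice : ∀ c → + 2 ℤ.* c ≡ c ℤ.+ c
    twice = ℤSolver.solve-∀

  third : ∀ {x y} → x ∔ (x ∔ x) ≈ y ∔ (y ∔ y) → x ≈ y
  third {x} {y} p = mk≈ λ n → ℤₚ.*-cancelˡ-≡ (+ 3) (x n) (y n) (trans (thrice (x n)) (trans (coeff p n) (sym (thrice (y n)))))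
    where
    thrice : ∀ c → + 3 ℤ.* c ≡ c ℤ.+ (c ℤ.+ c)
    thrice = ℤSolver.solve-∀

D-∔³ : ∀ k .{{_ : NonZero k}} x → D k (x ∔ (x ∔ x)) ≈ D k x ∔ (D k x ∔ D k x)
D-∔³ k x = ≈-trans (D-∔ k x (x ∔ x)) (∔-cong ≈-refl (D-∔ k x x))

core-product′ : D 3 ψ · (F · F) ≈ ψ · C
core-product′ = halve (≈-trans
  (≈-sym (≈-trans (·-cong (D-∔ 3 ψ ψ) ≈-refl) (·-distribʳ (F · F) (D 3 ψ) (D 3 ψ))))
  (≈-trans core-product (·-distribʳ C ψ ψ)))

-- Substituting φG = ψ(q²)F(q²) + 3q C(q⁴) into 3C = 2ψ(q²)F(q²) + φG makes every term a multiple of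
-- 3.
C-dissection : C ≈ D 2 ψ · D 2 F ∔ q^ 1 · D 4 C
C-dissection = third (≈-trans hexagonal-parity (≈-trans
  (∔-cong (·-cong (D-∔ 2 ψ ψ) ≈-refl) (≈-trans φG-dissection (∔-cong ≈-refl (·-cong ≈-refl (D-∔³ 4 C)))))
  (solve 4 (λ p f x c → (p :+ p) :* f :+ (p :* f :+ x :* (c :+ (c :+ c))) :=
      (p :* f :+ x :* c) :+ ((p :* f :+ x :* c) :+ (p :* f :+ x :* c))) ≈-refl
    (D 2 ψ) (D 2 F) (q^ 1) (D 4 C))))

φG-dissection′ : φ · G ≈ D 2 ψ · D 2 F ∔ q^ 1 · (D 4 C ∔ (D 4 C ∔ D 4 C))
φG-dissection′ = ≈-trans φG-dissection (∔-cong ≈-refl (·-cong ≈-refl (D-∔³ 4 C)))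

ψᴱ Fᴱ Cᴱ : Eta
ψᴱ = (1 , ℤ.- 1ℤ) ∷ (2 , + 2) ∷ []
Fᴱ = (1 , ℤ.- 1ℤ) ∷ (2 , 1ℤ) ∷ (3 , + 2) ∷ (6 , ℤ.- 1ℤ) ∷ []
Cᴱ = (1 , ℤ.- 1ℤ) ∷ (3 , + 3) ∷ []

infixr 7 _·ᴱ_
_·ᴱ_ : ∀ {x y L M} → x ≈ ⟦ L ⟧ → y ≈ ⟦ M ⟧ → x · y ≈ ⟦ L ++ M ⟧
_·ᴱ_ {L = L} {M} p q = ≈-trans (·-cong p q) (≈-sym (⟦⟧-++ L M))

Dᴱ : ∀ k .{{_ : NonZero k}} {x L} → x ≈ ⟦ L ⟧ → D k x ≈ ⟦ dilate k L ⟧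
Dᴱ k {L = L} p = ≈-trans (D-cong k p) (D-⟦⟧ k L)

via : ∀ {x y} L M → x ≈ ⟦ L ⟧ → y ≈ ⟦ M ⟧ → normalise L ≡ normalise M → x ≈ y
via L M p q eq = ≈-trans p (≈-trans (eta-≡ L M eq) (≈-sym q))

-- Division of ψ(q³)F(q)² = ψ(q)C(q) by the unit ψ(q).
C-η : C ≈ ⟦ Cᴱ ⟧
C-η = solveFor ψᴱ (dilate 3 ψᴱ ++ Fᴱ ++ Fᴱ) ≈-refl ψ-η (≈-trans (≈-sym core-product′) (_·ᴱ_ {L = dilate 3 ψᴱ} {Fᴱ ++ Fᴱ} (Dᴱ 3 {L = ψᴱ} ψ-η) (_·ᴱ_ {L = Fᴱ} {Fᴱ} θ₁₂-η θ₁₂-η)))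

-- Dissections of the two eta quotients

ψ³ : Series
ψ³ = ψ · (ψ · ψ)

ψ³ᴱ : Eta
ψ³ᴱ = ψᴱ ++ ψᴱ ++ ψᴱ

ψ³-η : ψ³ ≈ ⟦ ψ³ᴱ ⟧
ψ³-η = _·ᴱ_ {L = ψᴱ} {ψᴱ ++ ψᴱ} ψ-η (_·ᴱ_ {L = ψᴱ} {ψᴱ} ψ-η ψ-η)

-- The even and odd parts after q² is replaced by q; the factor 3 of the second odd part is kept
-- outside `odd₂`.
even₁ odd₁ even₂ odd₂ h₁ g₁ h₂ g₂ : Series
h₁ = ψ · ⟦ (1 , ℤ.- + 6) ∷ [] ⟧
g₁ = ψ³ · ⟦ (1 , ℤ.- + 6) ∷ [] ⟧
h₂ = ⟦ (2 , ℤ.- + 1) ∷ [] ⟧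
g₂ = (ψ · ψ) · ⟦ (2 , ℤ.- + 1) ∷ [] ⟧
even₁ = ψ³ · D 3 h₁
odd₁  = ψ · D 3 g₁
even₂ = ψ³ · D 3 h₂
odd₂  = ψ · D 3 g₂

-- `M₁` and `M₂` are what remains of the images of `L₁` and `L₂` under q ↦ -q after division by C
-- and by φG. All their indices are even, so they are series in q² and multiply the two halves of a
-- dissection without mixing them.
L₁ L₂ M₁ M₂ : Eta
L₁ = (1 , + 1) ∷ (2 , ℤ.- + 4) ∷ (3 , ℤ.- + 3) ∷ (4 , + 4) ∷ []
L₂ = (1 , + 3) ∷ (2 , ℤ.- + 3) ∷ (3 , ℤ.- + 1) ∷ (4 , + 3) ∷ []
M₁ = (2 , ℤ.- + 1) ∷ (4 , + 3) ∷ (6 , ℤ.- + 9) ∷ (12 , + 3) ∷ []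
M₂ = (2 , ℤ.- + 1) ∷ (4 , + 3) ∷ (6 , ℤ.- + 2) ∷ []

ψF-η : D 2 ψ · D 2 F ≈ ⟦ dilate 2 ψᴱ ++ dilate 2 Fᴱ ⟧
ψF-η = _·ᴱ_ {L = dilate 2 ψᴱ} {dilate 2 Fᴱ} (Dᴱ 2 {L = ψᴱ} ψ-η) (Dᴱ 2 {L = Fᴱ} θ₁₂-η)

dissection₁ : σ ⟦ L₁ ⟧ ≈ D 2 even₁ ∔ q^ 1 · D 2 odd₁
dissection₁ = ≈-trans (σ-⟦⟧ (+ 1) (ℤ.- + 4) (ℤ.- + 3) (+ 4))
  (≈-trans (via (substEta conjugate L₁) (Cᴱ ++ M₁) ≈-refl (_·ᴱ_ {L = Cᴱ} {M₁} C-η ≈-refl) refl)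
  (≈-trans (·-cong C-dissection ≈-refl)
  (≈-trans (solve 4 (λ e x c m → (e :+ x :* c) :* m := e :* m :+ x :* (c :* m)) ≈-refl
    (D 2 ψ · D 2 F) (q^ 1) (D 4 C) ⟦ M₁ ⟧)
  (∔-cong
    (via ((dilate 2 ψᴱ ++ dilate 2 Fᴱ) ++ M₁) (dilate 2 (ψ³ᴱ ++ dilate 3 (ψᴱ ++ power)))
      (_·ᴱ_ {L = dilate 2 ψᴱ ++ dilate 2 Fᴱ} {M₁} ψF-η ≈-refl)
      (Dᴱ 2 {L = ψ³ᴱ ++ dilate 3 (ψᴱ ++ power)} (_·ᴱ_ {L = ψ³ᴱ} {dilate 3 (ψᴱ ++ power)} ψ³-η
        (Dᴱ 3 {L = ψᴱ ++ power} (_·ᴱ_ {L = ψᴱ} {power} ψ-η ≈-refl)))) refl)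
    (·-cong ≈-refl (via (dilate 4 Cᴱ ++ M₁) (dilate 2 (ψᴱ ++ dilate 3 (ψ³ᴱ ++ power)))
      (_·ᴱ_ {L = dilate 4 Cᴱ} {M₁} (Dᴱ 4 {L = Cᴱ} C-η) ≈-refl)
      (Dᴱ 2 {L = ψᴱ ++ dilate 3 (ψ³ᴱ ++ power)} (_·ᴱ_ {L = ψᴱ} {dilate 3 (ψ³ᴱ ++ power)} ψ-η
        (Dᴱ 3 {L = ψ³ᴱ ++ power} (_·ᴱ_ {L = ψ³ᴱ} {power} ψ³-η ≈-refl)))) refl))))))
  where
  power : Eta
  power = (1 , ℤ.- + 6) ∷ []

dissection₂ : σ ⟦ L₂ ⟧ ≈ D 2 even₂ ∔ q^ 1 · D 2 (odd₂ ∔ (odd₂ ∔ odd₂))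
dissection₂ = ≈-trans (σ-⟦⟧ (+ 3) (ℤ.- + 3) (ℤ.- + 1) (+ 3))
  (≈-trans (via (substEta conjugate L₂) ((φᴱ ++ Gᴱ) ++ M₂) ≈-refl
    (_·ᴱ_ {L = φᴱ ++ Gᴱ} {M₂} (_·ᴱ_ {L = φᴱ} {Gᴱ} φ-η θ₁₅-η) ≈-refl) refl)
  (≈-trans (·-cong φG-dissection′ ≈-refl)
  (≈-trans (solve 4 (λ e x c m → (e :+ x :* (c :+ (c :+ c))) :* m := e :* m :+ x :* (c :* m :+ (c :* m :+ c :* m))) ≈-refl
    (D 2 ψ · D 2 F) (q^ 1) (D 4 C) ⟦ M₂ ⟧)
  (∔-cong
    (via ((dilate 2 ψᴱ ++ dilate 2 Fᴱ) ++ M₂) (dilate 2 (ψ³ᴱ ++ dilate 3 power))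
      (_·ᴱ_ {L = dilate 2 ψᴱ ++ dilate 2 Fᴱ} {M₂} ψF-η ≈-refl)
      (Dᴱ 2 {L = ψ³ᴱ ++ dilate 3 power} (_·ᴱ_ {L = ψ³ᴱ} {dilate 3 power} ψ³-η (D-⟦⟧ 3 power))) refl)
    (·-cong ≈-refl (≈-trans (∔-cong oddPart (∔-cong oddPart oddPart)) (≈-sym (D-∔³ 2 odd₂))))))))
  where
  power φᴱ Gᴱ : Eta
  power = (2 , ℤ.- + 1) ∷ []
  φᴱ = (1 , ℤ.- + 2) ∷ (2 , + 5) ∷ (4 , ℤ.- + 2) ∷ []
  Gᴱ = (1 , ℤ.- 1ℤ) ∷ (2 , + 2) ∷ (3 , 1ℤ) ∷ (4 , ℤ.- 1ℤ) ∷ (6 , ℤ.- 1ℤ) ∷ (12 , 1ℤ) ∷ []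
  ψ²ᴱ : Eta
  ψ²ᴱ = ψᴱ ++ ψᴱ
  oddPart : D 4 C · ⟦ M₂ ⟧ ≈ D 2 odd₂
  oddPart = via (dilate 4 Cᴱ ++ M₂) (dilate 2 (ψᴱ ++ dilate 3 (ψ²ᴱ ++ power)))
    (_·ᴱ_ {L = dilate 4 Cᴱ} {M₂} (Dᴱ 4 {L = Cᴱ} C-η) ≈-refl)
    (Dᴱ 2 {L = ψᴱ ++ dilate 3 (ψ²ᴱ ++ power)} (_·ᴱ_ {L = ψᴱ} {dilate 3 (ψ²ᴱ ++ power)} ψ-η
      (Dᴱ 3 {L = ψ²ᴱ ++ power} (_·ᴱ_ {L = ψ²ᴱ} {power} (_·ᴱ_ {L = ψᴱ} {ψᴱ} ψ-η ψ-η) ≈-refl)))) refl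

-- Coefficients of even and of odd index

odd-not-even : ∀ n → ¬ 2 ∣ suc (n * 2)
odd-not-even n (divides m eq) = go n m eq
  where
  go : ∀ n m → suc (n * 2) ≢ m * 2
  go zero    (suc m) ()
  go (suc n) (suc m) eq = go n m (ℕₚ.suc-injective (ℕₚ.suc-injective eq))

σ-even : ∀ {x e o} → σ x ≈ D 2 e ∔ q^ 1 · D 2 o → ∀ n → x (n * 2) ≡ e n
σ-even {x} {e} {o} p n = trans (sym (trans (σ-coeff x (n * 2)) (trans (cong (ℤ._* x (n * 2)) (sgn-*2 n)) (ℤₚ.*-identityˡ _))))
  (trans (coeff p (n * 2)) (trans (∔-coeff (D 2 e) (q^ 1 · D 2 o) (n * 2))
    (trans (cong₂ ℤ._+_ (D-* 2 e n) (vanishes n)) (ℤₚ.+-identityʳ (e n)))))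
  where
  vanishes : ∀ n → (q^ 1 · D 2 o) (n * 2) ≡ 0ℤ
  vanishes zero    = q^·-low 1 (D 2 o) {0} (s≤s z≤n)
  vanishes (suc n) = trans (q^·-shift 1 (D 2 o) (suc (n * 2))) (D-off 2 o (odd-not-even n))

σ-odd : ∀ {x e o} → σ x ≈ D 2 e ∔ q^ 1 · D 2 o → ∀ n → x (suc (n * 2)) ≡ ℤ.- o n
σ-odd {x} {e} {o} p n = trans (sym (ℤₚ.neg-involutive _)) (cong ℤ.-_ (trans
  (sym (trans (σ-coeff x (suc (n * 2))) (trans (cong (λ s → ℤ.- s ℤ.* x (suc (n * 2))) (sgn-*2 n)) (ℤₚ.-1*i≡-i _))))
  (trans (coeff p (suc (n * 2))) (trans (∔-coeff (D 2 e) (q^ 1 · D 2 o) (suc (n * 2)))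
    (trans (cong₂ ℤ._+_ (D-off 2 e (odd-not-even n))
      (trans (q^·-shift 1 (D 2 o) (n * 2)) (D-* 2 o n))) (ℤₚ.+-identityˡ (o n)))))))

-- Positivity

NonNeg : Series → Set
NonNeg x = ∀ n → 0ℤ ℤ.≤ x n

AllPos : Series → Set
AllPos x = ∀ n → 0ℤ ℤ.< x n

AllPos⇒NonNeg : ∀ {x} → AllPos x → NonNeg x
AllPos⇒NonNeg p n = ℤₚ.<⇒≤ (p n)

*-nonNeg : ∀ {i j} → 0ℤ ℤ.≤ i → 0ℤ ℤ.≤ j → 0ℤ ℤ.≤ i ℤ.* j
*-nonNeg {i} {j} p q = subst (ℤ._≤ i ℤ.* j) (ℤₚ.*-zeroʳ i) (ℤₚ.*-monoˡ-≤-nonNeg i {{ℤ.nonNegative p}} q)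

*-pos : ∀ {i j} → 0ℤ ℤ.< i → 0ℤ ℤ.< j → 0ℤ ℤ.< i ℤ.* j
*-pos {i} {j} p q = subst (ℤ._< i ℤ.* j) (ℤₚ.*-zeroʳ i) (ℤₚ.*-monoˡ-<-pos i {{ℤ.positive p}} q)

sum-nonNeg : ∀ m (t : Fin m → ℤ) → (∀ i → 0ℤ ℤ.≤ t i) → 0ℤ ℤ.≤ Sumℤ.sum t
sum-nonNeg zero    t p = ℤₚ.≤-refl
sum-nonNeg (suc m) t p = ℤₚ.+-mono-≤ (p zero) (sum-nonNeg m (t ∘ suc) (p ∘ suc))

sum-pos : ∀ m (t : Fin m → ℤ) → (∀ i → 0ℤ ℤ.≤ t i) → ∀ i → 0ℤ ℤ.< t i → 0ℤ ℤ.< Sumℤ.sum t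
sum-pos (suc m) t p zero    q = ℤₚ.+-mono-<-≤ q (sum-nonNeg m (t ∘ suc) (p ∘ suc))
sum-pos (suc m) t p (suc i) q = ℤₚ.+-mono-≤-< (p zero) (sum-pos m (t ∘ suc) (p ∘ suc) i q)

·-nonNeg : ∀ {x y} → NonNeg x → NonNeg y → NonNeg (x · y)
·-nonNeg {x} {y} p q n = subst (0ℤ ℤ.≤_) (sym (coeff (·-⊛ x y) n))
  (sum-nonNeg (suc n) _ λ i → *-nonNeg (p (toℕ i)) (q (n ∸ toℕ i)))

·-pos : ∀ {x y} → NonNeg x → NonNeg y → ∀ m n → 0ℤ ℤ.< x m → 0ℤ ℤ.< y n → 0ℤ ℤ.< (x · y) (m + n)
·-pos {x} {y} p q m n xm yn = subst (0ℤ ℤ.<_) (sym (coeff (·-⊛ x y) (m + n)))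
  (sum-pos (suc (m + n)) _ (λ i → *-nonNeg (p (toℕ i)) (q (m + n ∸ toℕ i))) (fromℕ< m<)
    (subst (λ k → 0ℤ ℤ.< x k ℤ.* y (m + n ∸ k)) (sym (Finₚ.toℕ-fromℕ< m<))
      (subst (λ k → 0ℤ ℤ.< x m ℤ.* y k) (sym (ℕₚ.m+n∸m≡n m n)) (*-pos xm yn))))
  where
  m< : m ℕ.< suc (m + n)
  m< = s≤s (ℕₚ.m≤m+n m n)

·-allPos : ∀ {x y} → NonNeg x → 0ℤ ℤ.< x 0 → AllPos y → AllPos (x · y)
·-allPos p x₀ q n = ·-pos p (AllPos⇒NonNeg q) 0 n x₀ (q n)

·-zero : ∀ {x y} n → (∀ i j → i + j ≡ n → x i ℤ.* y j ≡ 0ℤ) → (x · y) n ≡ 0ℤ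
·-zero {x} {y} n p = trans (coeff (·-⊛ x y) n) (zeros (suc n) _ λ i →
  p (toℕ i) (n ∸ toℕ i) (ℕₚ.m+[n∸m]≡n (Finₚ.toℕ≤pred[n] i)))
  where
  zeros : ∀ m (t : Fin m → ℤ) → (∀ i → t i ≡ 0ℤ) → Sumℤ.sum t ≡ 0ℤ
  zeros zero    t p = refl
  zeros (suc m) t p = cong₂ ℤ._+_ (p zero) (zeros m (t ∘ suc) (p ∘ suc))

D-nonNeg : ∀ k .{{_ : NonZero k}} {x} → NonNeg x → NonNeg (D k x)
D-nonNeg k {x} p n with k ∣? n
... | yes (divides m _) = p m
... | no _              = ℤₚ.≤-refl

D-pos : ∀ k .{{_ : NonZero k}} {x} n → 0ℤ ℤ.< x n → 0ℤ ℤ.< D k x (n * k)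
D-pos k {x} n = subst (0ℤ ℤ.<_) (sym (D-* k x n))

-- The reciprocal of f₁ is a product of geometric series.
ones : Series
ones n = 1ℤ

geometric : (𝟙 ⊖ q^ 1) · ones ≈ 𝟙
geometric = ≈-trans (·-cong (⊖-∔ 𝟙 (q^ 1)) ≈-refl)
  (≈-trans (solve 2 (λ x o → (con 1ℤ :+ :- x) :* o := o :+ :- (x :* o)) ≈-refl (q^ 1) ones)
  (mk≈ λ n → trans (∔-coeff ones (⊝ (q^ 1 · ones)) n) (telescope n)))
  where
  telescope : ∀ n → 1ℤ ℤ.- (q^ 1 · ones) n ≡ 𝟙 n
  telescope zero    = cong (λ c → 1ℤ ℤ.- c) (q^·-low 1 ones {0} (s≤s z≤n))
  telescope (suc n) = cong (λ c → 1ℤ ℤ.- c) (q^·-shift 1 ones n)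

f₁⁻¹ : Series
f₁⁻¹ = ⟦ (1 , ℤ.- + 1) ∷ [] ⟧

geometricFactor : ℕ → Series
geometricFactor i = D (suc i) ones

f₁⁻¹≈∏ : f₁⁻¹ ≈ ∏ geometricFactor
f₁⁻¹≈∏ = ≈-sym (·-cancelˡ (f-constant 1) (≈-trans (·-cong (f-∏ 1) ≈-refl)
  (≈-trans (∏-· (f-conv 1) conv) (≈-trans (∏-cong factor) (≈-trans ∏-𝟙
    (≈-sym (≈-trans (·-cong (⟦⟧-single 1) ≈-refl) (⟦⟧-negate ((1 , 1ℤ) ∷ [])))))))))
  where
  conv : Conv geometricFactor
  conv i = mk≈[] λ { {zero} _ → D-* (suc i) ones 0 ; {suc n} (s≤s n<i) →
    D-off (suc i) ones λ d → ℕₚ.<⇒≱ (s≤s n<i) (∣⇒≤ d) }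
  factor : ∀ i → (𝟙 ⊖ q^ (1 * suc i)) · geometricFactor i ≈ 𝟙
  factor i = ≈-trans (·-cong (≈-sym (D-𝟙⊖q^ (suc i) 1)) ≈-refl)
    (≈-trans (D-· (suc i) (𝟙 ⊖ q^ 1) ones) (≈-trans (D-cong (suc i) geometric) (D-q^ (suc i) 0)))

f₁⁻¹-allPos : AllPos f₁⁻¹
f₁⁻¹-allPos n = subst (0ℤ ℤ.<_) (sym (coeff f₁⁻¹≈∏ n)) (go n)
  where
  nonNeg : ∀ N → NonNeg (partial geometricFactor N)
  nonNeg zero    = 𝟙-nonNeg
    where
    𝟙-nonNeg : NonNeg 𝟙
    𝟙-nonNeg zero    = ℤ.+≤+ z≤n
    𝟙-nonNeg (suc n) = ℤₚ.≤-refl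
  nonNeg (suc N) = ·-nonNeg (nonNeg N) (D-nonNeg (suc N) λ _ → ℤ.+≤+ z≤n)
  -- The first factor 1/(1-q) already has all coefficients positive, and each later one has constant
  -- term 1. A nonempty product is required, so `go` treats coefficient 0, read off the empty
  -- product, separately.
  partial-pos : ∀ N n → 0ℤ ℤ.< partial geometricFactor (suc N) n
  partial-pos zero    n = ·-pos (nonNeg 0) (D-nonNeg 1 λ _ → ℤ.+≤+ z≤n) 0 n (ℤ.+<+ (s≤s z≤n))
    (subst (λ k → 0ℤ ℤ.< D 1 ones k) (ℕₚ.*-identityʳ n) (D-pos 1 {ones} n (ℤ.+<+ (s≤s z≤n))))
  partial-pos (suc N) n = subst (λ k → 0ℤ ℤ.< partial geometricFactor (suc (suc N)) k) (ℕₚ.+-identityʳ n)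
    (·-pos (nonNeg (suc N)) (D-nonNeg (suc (suc N)) λ _ → ℤ.+≤+ z≤n) n 0 (partial-pos N n)
      (D-pos (suc (suc N)) {ones} 0 (ℤ.+<+ (s≤s z≤n))))
  go : ∀ n → 0ℤ ℤ.< ∏ geometricFactor n
  go zero    = ℤ.+<+ (s≤s z≤n)
  go (suc n) = partial-pos n (suc n)

GF-nonNeg : ∀ {I : Set} {e : I → ℕ} {x} → GF e x → NonNeg x
GF-nonNeg g n with g n
... | c , x≡ , _ = subst (0ℤ ℤ.≤_) (sym x≡) (ℤ.+≤+ z≤n)

GF-pos : ∀ {I : Set} {e : I → ℕ} {x} → GF e x → ∀ i → 0ℤ ℤ.< x (e i)
GF-pos {e = e} g i with g (e i)
... | c , x≡ , j = subst (0ℤ ℤ.<_) (sym x≡) (inhabited c (Inverse.to j (i , refl)))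
  where
  inhabited : ∀ c → Fin c → 0ℤ ℤ.< + c
  inhabited (suc c) _ = ℤ.+<+ (s≤s z≤n)

GF-zero : ∀ {I : Set} {e : I → ℕ} {x} → GF e x → ∀ {n} → (∀ i → e i ≢ n) → x n ≡ 0ℤ
GF-zero g {n} missed with g n
... | zero  , x≡ , _ = x≡
... | suc c , _  , j = let i , p = Inverse.from j zero in contradiction p (missed i)

-- The support of ψ and the signs of the dissected parts

ψ-nonNeg : NonNeg ψ
ψ-nonNeg = GF-nonNeg (GF-theta 1 3)

ψ-0 : 0ℤ ℤ.< ψ 0
ψ-0 = GF-pos (GF-theta 1 3) (+ 0)

ψ-1 : 0ℤ ℤ.< ψ 1
ψ-1 = GF-pos (GF-theta 1 3) (+ 1)

ψ-3 : 0ℤ ℤ.< ψ 3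
ψ-3 = GF-pos (GF-theta 1 3) -[1+ 0 ]

-- 2j² - j is 0 modulo 3 for j ≡ 0, 2 and 1 for j ≡ 1. Equality with 3n + 2 would, after doubling,
-- make 4, 2 or 4 a multiple of 3 in the classes 0, 1, 2 of j.
triangular-mod-3 : ∀ n j → expo 1 3 j ≢ n * 3 + 2
triangular-mod-3 n j eq = by-class (Inverse.from (residues 3) j)
  (trans (cong (expo 1 3) (Inverse.strictlyInverseˡ (residues 3) j)) eq)
  where
  not-multiple : ∀ c z → + suc c ≡ z ℤ.* + 3 → suc c % 3 ≡ 0
  not-multiple c z p = trans (cong (_% 3) (trans (cong ℤ.∣_∣ p) (ℤₚ.abs-* z (+ 3)))) (m*n%n≡0 ℤ.∣ z ∣ 3)
  by-class : ∀ u → expo 1 3 (recompose 3 u) ≢ n * 3 + 2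
  by-residue : ∀ k r → let j = recompose 3 (k , r) in
    + 1 ℤ.* (j ℤ.* j ℤ.+ j) ℤ.+ + 3 ℤ.* (j ℤ.* j ℤ.- j) ≡ + 3 ℤ.* (+ n ℤ.+ + n) ℤ.+ + 4 → ⊥
  by-class (k , r) p = by-residue k r (trans (sym (double (⇒-expo 1 3 (recompose 3 (k , r)))))
    (trans (cong (λ m → + m ℤ.+ + m) p) (double (⇒-+ (⇒-*ʳ 3 (⇒-const n)) (⇒-const 2)))))
  by-residue k zero p = contradiction (not-multiple 3 (+ 12 ℤ.* k ℤ.* k ℤ.- + 2 ℤ.* k ℤ.- + 2 ℤ.* + n)
    (trans (isolate (+ 3 ℤ.* (+ n ℤ.+ + n)) (+ 4)) (trans (cong (ℤ._- + 3 ℤ.* (+ n ℤ.+ + n)) (sym p)) (expand k (+ n))))) λ ()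
    where
    isolate : ∀ a b → b ≡ a ℤ.+ b ℤ.- a
    isolate = ℤSolver.solve-∀
    expand : ∀ k n → let j = k ℤ.* + 3 ℤ.+ + 0 in
      (+ 1 ℤ.* (j ℤ.* j ℤ.+ j) ℤ.+ + 3 ℤ.* (j ℤ.* j ℤ.- j)) ℤ.- + 3 ℤ.* (n ℤ.+ n) ≡
      (+ 12 ℤ.* k ℤ.* k ℤ.- + 2 ℤ.* k ℤ.- + 2 ℤ.* n) ℤ.* + 3
    expand = ℤSolver.solve-∀
  by-residue k (suc zero) p = contradiction (not-multiple 1 (+ 12 ℤ.* k ℤ.* k ℤ.+ + 6 ℤ.* k ℤ.- + 2 ℤ.* + n)
    (trans (isolate (+ 3 ℤ.* (+ n ℤ.+ + n))) (trans (cong (ℤ._- (+ 3 ℤ.* (+ n ℤ.+ + n) ℤ.+ + 2)) (sym p)) (expand k (+ n))))) λ ()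
    where
    isolate : ∀ a → + 2 ≡ a ℤ.+ + 4 ℤ.- (a ℤ.+ + 2)
    isolate = ℤSolver.solve-∀
    expand : ∀ k n → let j = k ℤ.* + 3 ℤ.+ + 1 in
      (+ 1 ℤ.* (j ℤ.* j ℤ.+ j) ℤ.+ + 3 ℤ.* (j ℤ.* j ℤ.- j)) ℤ.- (+ 3 ℤ.* (n ℤ.+ n) ℤ.+ + 2) ≡
      (+ 12 ℤ.* k ℤ.* k ℤ.+ + 6 ℤ.* k ℤ.- + 2 ℤ.* n) ℤ.* + 3
    expand = ℤSolver.solve-∀
  by-residue k (suc (suc zero)) p = contradiction (not-multiple 3 (+ 12 ℤ.* k ℤ.* k ℤ.+ + 14 ℤ.* k ℤ.+ + 4 ℤ.- + 2 ℤ.* + n)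
    (trans (isolate (+ 3 ℤ.* (+ n ℤ.+ + n)) (+ 4)) (trans (cong (ℤ._- + 3 ℤ.* (+ n ℤ.+ + n)) (sym p)) (expand k (+ n))))) λ ()
    where
    isolate : ∀ a b → b ≡ a ℤ.+ b ℤ.- a
    isolate = ℤSolver.solve-∀
    expand : ∀ k n → let j = k ℤ.* + 3 ℤ.+ + 2 in
      (+ 1 ℤ.* (j ℤ.* j ℤ.+ j) ℤ.+ + 3 ℤ.* (j ℤ.* j ℤ.- j)) ℤ.- + 3 ℤ.* (n ℤ.+ n) ≡
      (+ 12 ℤ.* k ℤ.* k ℤ.+ + 14 ℤ.* k ℤ.+ + 4 ℤ.- + 2 ℤ.* n) ℤ.* + 3
    expand = ℤSolver.solve-∀

ψ²-nonNeg : NonNeg (ψ · ψ)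
ψ²-nonNeg = ·-nonNeg ψ-nonNeg ψ-nonNeg

ψ³-nonNeg : NonNeg ψ³
ψ³-nonNeg = ·-nonNeg ψ-nonNeg ψ²-nonNeg

ψ³-pos : ∀ i j k → 0ℤ ℤ.< ψ i → 0ℤ ℤ.< ψ j → 0ℤ ℤ.< ψ k → 0ℤ ℤ.< ψ³ (i + (j + k))
ψ³-pos i j k p q r = ·-pos ψ-nonNeg ψ²-nonNeg i (j + k) p (·-pos ψ-nonNeg ψ-nonNeg j k q r)

-- Every residue class modulo 6 contains one of 0, …, 5, and each of these is a
-- sum of three triangular numbers.
even-allPos : ∀ {h} → NonNeg h → (∀ n → 0ℤ ℤ.< h (n * 2)) → AllPos (ψ³ · D 3 h)
even-allPos {h} h≥0 h>0 n = subst (λ m → 0ℤ ℤ.< (ψ³ · D 3 h) m) (sym split)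
  (·-pos ψ³-nonNeg (D-nonNeg 3 h≥0) (n % 6) (n / 6 * 2 * 3) (small (n % 6) (m%n<n n 6)) (D-pos 3 (n / 6 * 2) (h>0 (n / 6))))
  where
  split : n ≡ n % 6 + n / 6 * 2 * 3
  split = trans (m≡m%n+[m/n]*n n 6) (cong (n % 6 ℕ.+_) (sym (ℕₚ.*-assoc (n / 6) 2 3)))
  small : ∀ r → r ℕ.< 6 → 0ℤ ℤ.< ψ³ r
  small 0 _ = ψ³-pos 0 0 0 ψ-0 ψ-0 ψ-0
  small 1 _ = ψ³-pos 0 0 1 ψ-0 ψ-0 ψ-1
  small 2 _ = ψ³-pos 0 1 1 ψ-0 ψ-1 ψ-1
  small 3 _ = ψ³-pos 0 0 3 ψ-0 ψ-0 ψ-3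
  small 4 _ = ψ³-pos 0 1 3 ψ-0 ψ-1 ψ-3
  small 5 _ = ψ³-pos 1 1 3 ψ-1 ψ-1 ψ-3
  small (suc (suc (suc (suc (suc (suc _)))))) (s≤s (s≤s (s≤s (s≤s (s≤s (s≤s ()))))))

-- The index is that of the odd part, so the classes 0, 1, 2 modulo 3 stand for the exponents 1, 3,
-- 5 modulo 6.
record OddPattern (x : Series) : Set where
  field
    pos₀  : ∀ n → 0ℤ ℤ.< x (n * 3)
    pos₁  : ∀ n → 0ℤ ℤ.< x (1 + n * 3)
    zero₂ : ∀ n → x (2 + n * 3) ≡ 0ℤ
open OddPattern

-- g(q³) lives on multiples of 3, so the residue modulo 3 comes from ψ alone: its exponents 0 and 1
-- serve the first two classes, and it has none congruent to 2.
odd-pattern : ∀ {g} → AllPos g → OddPattern (ψ · D 3 g)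
odd-pattern {g} g>0 = record
  { pos₀  = λ n → ·-pos ψ-nonNeg D-g≥0 0 (n * 3) ψ-0 (D-pos 3 n (g>0 n))
  ; pos₁  = λ n → ·-pos ψ-nonNeg D-g≥0 1 (n * 3) ψ-1 (D-pos 3 n (g>0 n))
  ; zero₂ = λ n → ·-zero (2 + n * 3) (vanish n) }
  where
  D-g≥0 : NonNeg (D 3 g)
  D-g≥0 = D-nonNeg 3 (AllPos⇒NonNeg g>0)
  vanish : ∀ n i j → i + j ≡ 2 + n * 3 → ψ i ℤ.* D 3 g j ≡ 0ℤ
  vanish n i j eq with 3 ∣? j
  ... | no _ = ℤₚ.*-zeroʳ (ψ i)
  ... | yes (divides m refl) = trans (cong (ℤ._* g m) (GF-zero (GF-theta 1 3) {i} λ l p →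
      triangular-mod-3 (n ∸ m) l (trans p i≡))) (ℤₚ.*-zeroˡ (g m))
    where
    m≤n : m ℕ.≤ n
    m≤n = ℕ.s≤s⁻¹ (ℕₚ.*-cancelʳ-< 3 m (suc n) (s≤s (subst (m * 3 ℕ.≤_) eq (ℕₚ.m≤n+m (m * 3) i))))
    i≡ : i ≡ (n ∸ m) * 3 + 2
    i≡ = ℕₚ.+-cancelʳ-≡ (m * 3) i _ (trans eq (trans (cong (λ k → 2 + k * 3) (sym (ℕₚ.m∸n+n≡m m≤n))) (regroup (n ∸ m) m)))
      where
      regroup : ∀ d m → 2 + (d + m) * 3 ≡ d * 3 + 2 + m * 3
      regroup = ℕSolver.solve-∀

opaque
  unfolding _∔_

  triple-pattern : ∀ {x} → OddPattern x → OddPattern (x ∔ (x ∔ x))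
  triple-pattern p = record
    { pos₀  = λ n → ℤₚ.+-mono-< (pos₀ p n) (ℤₚ.+-mono-< (pos₀ p n) (pos₀ p n))
    ; pos₁  = λ n → ℤₚ.+-mono-< (pos₁ p n) (ℤₚ.+-mono-< (pos₁ p n) (pos₁ p n))
    ; zero₂ = λ n → cong (λ c → c ℤ.+ (c ℤ.+ c)) (zero₂ p n) }

repeat-allPos : ∀ n → AllPos (f₁⁻¹ ^ℕ suc n)
repeat-allPos zero    k = subst (0ℤ ℤ.<_) (sym (coeff (≈-trans (^ℕ-suc f₁⁻¹ 0) (R.*-identityʳ f₁⁻¹)) k)) (f₁⁻¹-allPos k)
repeat-allPos (suc n) k = subst (0ℤ ℤ.<_) (sym (coeff (^ℕ-suc f₁⁻¹ (suc n)) k))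
  (·-allPos (AllPos⇒NonNeg f₁⁻¹-allPos) (f₁⁻¹-allPos 0) (repeat-allPos n) k)

f₁⁻⁶-allPos : AllPos ⟦ (1 , ℤ.- + 6) ∷ [] ⟧
f₁⁻⁶-allPos n = subst (0ℤ ℤ.<_) (coeff (≈-trans (≈-sym (repeatEta-⟦⟧ 6 L)) (eta-≡ (repeatEta 6 L) ((1 , ℤ.- + 6) ∷ []) refl)) n)
  (repeat-allPos 5 n)
  where
  L : Eta
  L = (1 , ℤ.- + 1) ∷ []

f₂⁻¹≈ : D 2 f₁⁻¹ ≈ h₂
f₂⁻¹≈ = D-⟦⟧ 2 ((1 , ℤ.- + 1) ∷ [])

f₂⁻¹-nonNeg : NonNeg h₂
f₂⁻¹-nonNeg n = subst (0ℤ ℤ.≤_) (coeff f₂⁻¹≈ n) (D-nonNeg 2 (AllPos⇒NonNeg f₁⁻¹-allPos) n)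

f₂⁻¹-pos : ∀ n → 0ℤ ℤ.< h₂ (n * 2)
f₂⁻¹-pos n = subst (0ℤ ℤ.<_) (coeff f₂⁻¹≈ (n * 2)) (D-pos 2 n (f₁⁻¹-allPos n))

h₁-allPos : AllPos h₁
h₁-allPos = ·-allPos ψ-nonNeg ψ-0 f₁⁻⁶-allPos

g₁-allPos : AllPos g₁
g₁-allPos = ·-allPos ψ³-nonNeg (ψ³-pos 0 0 0 ψ-0 ψ-0 ψ-0) f₁⁻⁶-allPos

-- 1/f₂ supplies the even exponents only; the terms of ψ² at 0 and 1 reach both parities.
g₂-allPos : AllPos g₂
g₂-allPos n = subst (λ m → 0ℤ ℤ.< g₂ m) (sym (m≡m%n+[m/n]*n n 2))
  (·-pos ψ²-nonNeg f₂⁻¹-nonNeg (n % 2) (n / 2 * 2) (small (n % 2) (m%n<n n 2)) (f₂⁻¹-pos (n / 2)))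
  where
  small : ∀ r → r ℕ.< 2 → 0ℤ ℤ.< (ψ · ψ) r
  small 0 _ = ·-pos ψ-nonNeg ψ-nonNeg 0 0 ψ-0 ψ-0
  small 1 _ = ·-pos ψ-nonNeg ψ-nonNeg 0 1 ψ-0 ψ-1
  small (suc (suc _)) (s≤s (s≤s ()))

-- From the dissections to the sign pattern modulo 6

SignPattern : Series → ℕ → Set
SignPattern x n = x (2 * n) ℤ.> 0ℤ × x (6 * n + 1) ℤ.< 0ℤ × x (6 * n + 3) ℤ.< 0ℤ × x (6 * n + 5) ≡ 0ℤ

sign-pattern : ∀ {x e o} → σ x ≈ D 2 e ∔ q^ 1 · D 2 o → AllPos e → OddPattern o → ∀ n → SignPattern x n
sign-pattern {x} {e} {o} p e>0 o-pattern n =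
  subst (ℤ._> 0ℤ) (sym (trans (cong x (ℕₚ.*-comm 2 n)) (σ-even p n))) (e>0 n) ,
  subst (ℤ._< 0ℤ) (sym (trans (cong x (index₁ n)) (σ-odd p (n * 3)))) (ℤₚ.neg-mono-< (pos₀ o-pattern n)) ,
  subst (ℤ._< 0ℤ) (sym (trans (cong x (index₃ n)) (σ-odd p (1 + n * 3)))) (ℤₚ.neg-mono-< (pos₁ o-pattern n)) ,
  trans (cong x (index₅ n)) (trans (σ-odd p (2 + n * 3)) (cong ℤ.-_ (zero₂ o-pattern n)))
  where
  index₁ : ∀ n → 6 * n + 1 ≡ suc (n * 3 * 2)
  index₁ = ℕSolver.solve-∀
  index₃ : ∀ n → 6 * n + 3 ≡ suc ((1 + n * 3) * 2)
  index₃ = ℕSolver.solve-∀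
  index₅ : ∀ n → 6 * n + 5 ≡ suc ((2 + n * 3) * 2)
  index₅ = ℕSolver.solve-∀

open import Data.Vec using (Vec; []; _∷_)

a-⟦⟧ : ∀ t₁ t₂ t₃ t₄ → a (t₁ ∷ t₂ ∷ t₃ ∷ t₄ ∷ []) ≈ ⟦ (1 , t₁) ∷ (2 , t₂) ∷ (3 , t₃) ∷ (4 , t₄) ∷ [] ⟧
a-⟦⟧ t₁ t₂ t₃ t₄ = step (step (step (step ≈-refl)))
  where
  step : ∀ {x y z} → y ≈ z → x ⊛ y ≈ x · z
  step {x} {y} p = ≈-trans (≈-sym (·-⊛ x y)) (·-cong ≈-refl p)

theorem6p1 : (t₁ t₂ t₃ t₄ : ℤ) → (t₁ ∷ t₂ ∷ t₃ ∷ t₄ ∷ []) ∈ S₈ → (n : ℕ) →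
    (a (t₁ ∷ t₂ ∷ t₃ ∷ t₄ ∷ []) (2 * n) > 0ℤ) ×
    (a (t₁ ∷ t₂ ∷ t₃ ∷ t₄ ∷ []) (6 * n + 1) < 0ℤ) ×
    (a (t₁ ∷ t₂ ∷ t₃ ∷ t₄ ∷ []) (6 * n + 3) < 0ℤ) ×
    (a (t₁ ∷ t₂ ∷ t₃ ∷ t₄ ∷ []) (6 * n + 5) ≡ 0ℤ)
theorem6p1 t₁ t₂ t₃ t₄ (here refl) = sign-pattern
  (≈-trans (σ-cong (a-⟦⟧ t₁ t₂ t₃ t₄)) dissection₁)
  (even-allPos (AllPos⇒NonNeg h₁-allPos) (λ n → h₁-allPos (n * 2)))
  (odd-pattern g₁-allPos)
theorem6p1 t₁ t₂ t₃ t₄ (there (here refl)) = sign-pattern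
  (≈-trans (σ-cong (a-⟦⟧ t₁ t₂ t₃ t₄)) dissection₂)
  (even-allPos f₂⁻¹-nonNeg f₂⁻¹-pos)
  (triple-pattern (odd-pattern g₂-allPos))
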